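{- Let $T$ be an Ammann--Beenker tiling, placed so that some side of some rhombus is parallel to the horizontal axis, and let $G$ be the associated planar graph. Then $\chi'(G)=8$, and an explicit proper edge colouring of $G$ with eight colours is given by the directional alternating colouring method for the vectors $\vec u_1=(1,0)$, $\vec u_2=(1,1)$, $\vec u_3=(0,1)$, $\vec u_4=(1,-1)$.
   Context: Ammann--Beenker substitution. Prototiles: a right isosceles triangle with sides $1,1,\sqrt2$ whose hypotenuse carries an arrow pointing from one of its endpoints (tail) to the other (head), and a rhombus of side $1$ with an angle of $45^\circ$. Let $\lambda=1+\sqrt2$, $h=\sqrt2/2$. The substitution $\omega$ expands by $\lambda$ and dissects as follows. (1) The triangle with vertices $(0,0),(\sqrt2,0),(h,h)$ and arrow from $(0,0)$ to $(\sqrt2,0)$: the expanded triangle with vertices $(0,0),(2+\sqrt2,0),(1+h,1+h)$ is dissected into the triangle $(0,0),(1,0),(1,1)$ with arrow from $(1,1)$ to $(0,0)$; the triangle $(1,0),(1+\sqrt2,0),(1+h,h)$ with arrow from $(1+\sqrt2,0)$ to $(1,0)$; the triangle $(1+h,h),(2+h,h),(1+h,1+h)$ with arrow from $(2+h,h)$ to $(1+h,1+h)$; the rhombus $(1,0),(1,1),(1+h,1+h),(1+h,h)$; and the rhombus $(1+\sqrt2,0),(2+\sqrt2,0),(2+h,h),(1+h,h)$. (2) The rhombus with vertices $(0,0),(1,0),(1+h,h),(h,h)$: the expanded rhombus with vertices $(0,0),(\lambda,0),(2+3h,1+h),(1+h,1+h)$ is dissected into the rhombus $(0,0),(1,0),(1+h,h),(h,h)$;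 the rhombus $(1+h,h),(\lambda,0),(\lambda,1),(1+h,1+h)$; the rhombus $(\lambda,1),(\lambda+1,1),(2+3h,1+h),(1+3h,1+h)$; the triangle $(h,h),(1+h,h),(1+h,1+h)$ with arrow from $(h,h)$ to $(1+h,1+h)$; the triangle $(1,0),(\lambda,0),(1+h,h)$ with arrow from $(1,0)$ to $(\lambda,0)$; the triangle $(\lambda,0),(\lambda,1),(\lambda+1,1)$ with arrow from $(\lambda+1,1)$ to $(\lambda,0)$; and the triangle $(\lambda,1),(1+h,1+h),(1+3h,1+h)$ with arrow from $(1+3h,1+h)$ to $(1+h,1+h)$. The rule is extended to all congruent copies (including reflections) of the prototiles, and to collections of tiles, covariantly. An Ammann--Beenker tiling is a tiling $T$ of $\mathbb{R}^2$ by congruent copies of the (arrowed) prototiles such that every finite set of tiles of $T$ is contained in a congruent copy of $\omega^n(p)$ for some $n\ge0$ and some prototile $p$. Graph: the vertices of $G$ are the corners of the tiles, and the edges are the sides of the tiles (including the hypotenuses of the triangles). $\chi'$ denotes the chromatic index (least number of colours in a proper edge colouring). Directional alternating colouring method for pairwise non-parallel vectors $\vec u_1,\dots,\vec u_n$ such that each edge is parallel to some $\vec u_j$, with colours $c_1,\dots,c_{2n}$: for each line $l$ containing at least one edge, let $j$ be the index with $l\parallel\vec u_j$, and colour the edges contained in $l$, in the order in which they occur along $l$ (whether or not consecutive ones are adjacent), alternately with $c_{2j-1}$ and $c_{2j}$. -}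

module Defs where

open import Level using (0ℓ)
open import Algebra.Bundles using (CommutativeRing)
open import Data.Fin.Base using (Fin; combine)
open import Data.Integer.Base as ℤ using (ℤ; ∣_∣)
open import Data.List.Base using (List; []; _∷_; map; concatMap; length; lookup)
open import Data.List.Relation.Unary.All using (All)
open import Data.List.Relation.Unary.Any using (Any)
open import Data.Nat.Base as ℕ using (ℕ; zero; suc)
open import Data.Nat.DivMod using (_mod_)
open import Data.Product.Base using (Σ; ∃; _×_; _,_; proj₁; proj₂)
open import Data.Product.Relation.Binary.Pointwise.NonDependent using (×-setoid)
open import Data.Sum.Base using (_⊎_; inj₁; inj₂)
open import Data.Vec.Base as Vec using ([]; _∷_)
open import Function.Bundles using (Func; _⇔_)
open import Relation.Binary.Bundles using (Setoid)
open import Relation.Binary.Core using (Rel)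
import Relation.Binary.Construct.NonStrictToStrict as ToStrict
import Relation.Binary.Construct.On as On
open import Relation.Binary.PropositionalEquality as ≡ using (_≡_; _≢_)
open import Relation.Binary.Structures using (IsTotalOrder)
open import Relation.Nullary.Negation using (¬_)
open import Relation.Unary using (Pred; _∈_)

-- The real numbers, characterised up to isomorphism as a Dedekind-complete
-- ordered field.  Equality is a setoid equality, so that (given excluded
-- middle) Cauchy sequences of rationals form an instance.
record CompleteOrderedField : Set₁ where
  infix 4 _≤_
  field
    commutativeRing : CommutativeRing 0ℓ 0ℓ

  open CommutativeRing commutativeRing public

  field
    1≉0          : ¬ (1# ≈ 0#)
    inverse      : ∀ x → ¬ (x ≈ 0#) → ∃ λ y → x * y ≈ 1#
    _≤_          : Rel Carrier 0ℓ
    isTotalOrder : IsTotalOrder _≈_ _≤_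
    +-monoˡ-≤    : ∀ z {x y} → x ≤ y → x + z ≤ y + z
    *-nonNeg     : ∀ {x y} → 0# ≤ x → 0# ≤ y → 0# ≤ x * y

  IsUpperBound : Pred Carrier 0ℓ → Carrier → Set
  IsUpperBound P b = ∀ x → x ∈ P → x ≤ b

  field
    complete : (P : Pred Carrier 0ℓ) → ∃ P → ∃ (IsUpperBound P) →
               ∃ λ s → IsUpperBound P s × (∀ b → IsUpperBound P b → s ≤ b)

-- The numbers √2 and h = √2/2, which these equations determine uniquely.
record RootTwo (R : CompleteOrderedField) : Set where
  open CompleteOrderedField R
  field
    √2     : Carrier
    h      : Carrier
    0≤√2   : 0# ≤ √2
    √2*√2≈2 : √2 * √2 ≈ 1# + 1#
    h+h≈√2 : h + h ≈ √2

-- Parallel edges are excluded when edges are identified by their ends, which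
-- is the case for the graph of a tiling below.
record Graph : Set₁ where
  field
    vertices : Setoid 0ℓ 0ℓ
    edges    : Setoid 0ℓ 0ℓ

  Vertex : Set
  Vertex = Setoid.Carrier vertices

  Edge : Set
  Edge = Setoid.Carrier edges

  field
    Incident : Vertex → Edge → Set

  Adjacent : Edge → Edge → Set
  Adjacent e f =
    ¬ (Setoid._≈_ edges e f) × (∃ λ v → Incident v e × Incident v f)

  EdgeColouring : ℕ → Set
  EdgeColouring k = Func edges (≡.setoid (Fin k))

  Proper : ∀ {k} → EdgeColouring k → Set
  Proper c = ∀ e f → Adjacent e f → Func.to c e ≢ Func.to c f

  EdgeColourable : ℕ → Set
  EdgeColourable k = Σ (EdgeColouring k) Proper

  HasChromaticIndex : ℕ → Set
  HasChromaticIndex k = EdgeColourable k × (∀ m → EdgeColourable m → k ℕ.≤ m)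

module AmmannBeenker (R : CompleteOrderedField) (ρ : RootTwo R) where

  open CompleteOrderedField R
  open RootTwo ρ
  open ToStrict _≈_ _≤_ using (_<_)
  open import Algebra.Properties.Monoid.Sum +-monoid using (sum)

  ----------------------------------------------------------------------
  -- Plane geometry

  Point : Set
  Point = Carrier × Carrier

  pointSetoid : Setoid 0ℓ 0ℓ
  pointSetoid = ×-setoid setoid setoid

  open Setoid pointSetoid public using () renaming
    (_≈_ to _≈ₚ_; refl to ≈ₚ-refl; sym to ≈ₚ-sym; trans to ≈ₚ-trans)

  infixl 6 _⊕_ _⊖_
  infixr 7 _·_

  _⊕_ _⊖_ : Point → Point → Point
  (x , y) ⊕ (x′ , y′) = x + x′ , y + y′
  (x , y) ⊖ (x′ , y′) = x - x′ , y - y′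

  _·_ : Carrier → Point → Point
  k · (x , y) = k * x , k * y

  dot cross : Point → Point → Carrier
  dot   (x , y) (x′ , y′) = x * x′ + y * y′
  cross (x , y) (x′ , y′) = x * y′ - y * x′

  dist² : Point → Point → Carrier
  dist² p q = dot (p ⊖ q) (p ⊖ q)

  infix 4 _∥_
  _∥_ : Point → Point → Set
  v ∥ w = cross v w ≈ 0#

  -- Reflections are included.
  record Isometry : Set where
    field
      to        : Point → Point
      isometric : ∀ p q → dist² (to p) (to q) ≈ dist² p q

  ConvexHull : List Point → Pred Point 0ℓ
  ConvexHull ps q = ∃ λ (w : Fin (length ps) → Carrier) →
    (∀ i → 0# ≤ w i) ×
    sum w ≈ 1# ×
    (sum (λ i → w i * proj₁ (lookup ps i)) ,
     sum (λ i → w i * proj₂ (lookup ps i))) ≈ₚ q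

  Interior : Pred Point 0ℓ → Pred Point 0ℓ
  Interior S p = ∃ λ ε → 0# < ε × (∀ q → dist² p q < ε * ε → q ∈ S)

  Segment : Set
  Segment = Point × Point

  -- Segments (and, below, diagonals of rhombi) are unordered pairs.
  infix 4 _≈ₛ_
  _≈ₛ_ : Rel Segment 0ℓ
  s ≈ₛ (p , q) = (proj₁ s ≈ₚ p × proj₂ s ≈ₚ q) ⊎ (proj₁ s ≈ₚ q × proj₂ s ≈ₚ p)

  segmentSetoid : Setoid 0ℓ 0ℓ
  segmentSetoid = record
    { Carrier = Segment
    ; _≈_ = _≈ₛ_
    ; isEquivalence = record
      { refl  = inj₁ (≈ₚ-refl , ≈ₚ-refl)
      ; sym   = λ where
          (inj₁ (a , b)) → inj₁ (≈ₚ-sym a , ≈ₚ-sym b)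
          (inj₂ (a , b)) → inj₂ (≈ₚ-sym b , ≈ₚ-sym a)
      ; trans = λ where
          (inj₁ (a , b)) (inj₁ (c , d)) → inj₁ (≈ₚ-trans a c , ≈ₚ-trans b d)
          (inj₁ (a , b)) (inj₂ (c , d)) → inj₂ (≈ₚ-trans a c , ≈ₚ-trans b d)
          (inj₂ (a , b)) (inj₁ (c , d)) → inj₂ (≈ₚ-trans a d , ≈ₚ-trans b c)
          (inj₂ (a , b)) (inj₂ (c , d)) → inj₁ (≈ₚ-trans a d , ≈ₚ-trans b c)
      }
    }

  infix 4 _EndOf_
  _EndOf_ : Point → Segment → Set
  v EndOf (p , q) = v ≈ₚ p ⊎ v ≈ₚ q

  direction : Segment → Point
  direction (p , q) = q ⊖ p

  ----------------------------------------------------------------------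
  -- Tiles

  data Kind : Set where
    △ ◇ : Kind

  -- A triangle is given by its arrow and its right-angled corner, a rhombus
  -- by its corners in cyclic order, beginning at an acute one.
  data Tile : Set where
    triangle : (tail head apex : Point) → Tile
    rhombus  : (a b c d : Point) → Tile

  -- A rhombus is determined by its two diagonals: the four admissible
  -- labellings of its corners give equal tiles.
  infix 4 _≈ₜ_
  data _≈ₜ_ : Rel Tile 0ℓ where
    triangle : ∀ {t u a t′ u′ a′} → t ≈ₚ t′ → u ≈ₚ u′ → a ≈ₚ a′ →
               triangle t u a ≈ₜ triangle t′ u′ a′
    rhombus  : ∀ {a b c d a′ b′ c′ d′} →
               (a , c) ≈ₛ (a′ , c′) → (b , d) ≈ₛ (b′ , d′) →
               rhombus a b c d ≈ₜ rhombus a′ b′ c′ d′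

  mapTile : (Point → Point) → Tile → Tile
  mapTile f (triangle t u a)  = triangle (f t) (f u) (f a)
  mapTile f (rhombus a b c d) = rhombus (f a) (f b) (f c) (f d)

  corners : Tile → List Point
  corners (triangle t u a)  = t ∷ u ∷ a ∷ []
  corners (rhombus a b c d) = a ∷ b ∷ c ∷ d ∷ []

  sides : Tile → List Segment
  sides (triangle t u a)  = (t , u) ∷ (u , a) ∷ (a , t) ∷ []
  sides (rhombus a b c d) = (a , b) ∷ (b , c) ∷ (c , d) ∷ (d , a) ∷ []

  region : Tile → Pred Point 0ℓ
  region t = ConvexHull (corners t)

  prototile : Kind → Tile
  prototile △ = triangle (0# , 0#) (√2 , 0#) (h , h)
  prototile ◇ = rhombus (0# , 0#) (1# , 0#) (1# + h , h) (h , h)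

  ----------------------------------------------------------------------
  -- The substitution

  2# 3h : Carrier
  2# = 1# + 1#
  3h = h + h + h

  -- The expansion factor.
  Λ : Carrier
  Λ = 1# + √2

  dissection : Kind → List Tile
  dissection △ =
      triangle (1# , 1#) (0# , 0#) (1# , 0#)
    ∷ triangle (1# + √2 , 0#) (1# , 0#) (1# + h , h)
    ∷ triangle (2# + h , h) (1# + h , 1# + h) (1# + h , h)
    ∷ rhombus (1# , 0#) (1# , 1#) (1# + h , 1# + h) (1# + h , h)
    ∷ rhombus (2# + √2 , 0#) (2# + h , h) (1# + h , h) (1# + √2 , 0#)
    ∷ []
  dissection ◇ =
      rhombus (0# , 0#) (1# , 0#) (1# + h , h) (h , h)
    ∷ rhombus (Λ , 0#) (Λ , 1#) (1# + h , 1# + h) (1# + h , h)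
    ∷ rhombus (Λ , 1#) (Λ + 1# , 1#) (2# + 3h , 1# + h) (1# + 3h , 1# + h)
    ∷ triangle (h , h) (1# + h , 1# + h) (1# + h , h)
    ∷ triangle (1# , 0#) (Λ , 0#) (1# + h , h)
    ∷ triangle (Λ + 1# , 1#) (Λ , 0#) (Λ , 1#)
    ∷ triangle (1# + 3h , 1# + h) (1# + h , 1# + h) (Λ , 1#)
    ∷ []

  kind : Tile → Kind
  kind (triangle _ _ _)  = △
  kind (rhombus _ _ _ _) = ◇

  -- In both prototiles the corner that spans, with the origin, a 45° angle
  -- above the horizontal side is (h , h), so that the image of (0 , 1) is
  -- √2 times the image of (h , h) minus that of (1 , 0).
  affine : (origin e₁ slant : Point) → Point → Point
  affine o e₁ g (x , y) = Λ · o ⊕ x · e₁ ⊕ y · (√2 · g ⊖ e₁)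

  -- If t = f (prototile k) for an isometry f, then expandedFrame t is the
  -- isometry carrying the expanded prototile Λ · prototile k to the expanded
  -- tile Λ · t, that is, the map p ↦ Λ · f (Λ⁻¹ · p).
  -- Here h = 1/√2 normalises the hypotenuse.
  expandedFrame : Tile → Point → Point
  expandedFrame (triangle t u a)  = affine t (h · (u ⊖ t)) (a ⊖ t)
  expandedFrame (rhombus a b c d) = affine a (b ⊖ a) (d ⊖ a)

  ω : Tile → List Tile
  ω t = map (mapTile (expandedFrame t)) (dissection (kind t))

  ω^ : ℕ → Tile → List Tile
  ω^ zero    t = t ∷ []
  ω^ (suc n) t = concatMap ω (ω^ n t)

  ----------------------------------------------------------------------
  -- Tilings

  IsCongruentCopy : Tile → Set
  IsCongruentCopy t =
    ∃ λ k → ∃ λ f → t ≈ₜ mapTile (Isometry.to f) (prototile k)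

  record IsTiling (T : Pred Tile 0ℓ) : Set where
    field
      respects  : ∀ {t t′} → t ≈ₜ t′ → t ∈ T → t′ ∈ T
      congruent : ∀ t → t ∈ T → IsCongruentCopy t
      covers    : ∀ p → ∃ λ t → t ∈ T × p ∈ region t
      disjoint  : ∀ t t′ p → t ∈ T → t′ ∈ T →
                  p ∈ Interior (region t) → p ∈ Interior (region t′) → t ≈ₜ t′

  ContainedInSupertile : List Tile → Set
  ContainedInSupertile F = ∃ λ n → ∃ λ k → ∃ λ f →
    All (λ t → Any (t ≈ₜ_) (map (mapTile (Isometry.to f)) (ω^ n (prototile k)))) F

  record IsAmmannBeenkerTiling (T : Pred Tile 0ℓ) : Set where
    field
      isTiling   : IsTiling T
      supertiles : ∀ F → All (_∈ T) F → ContainedInSupertile F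

  HasHorizontalRhombusSide : Pred Tile 0ℓ → Set
  HasHorizontalRhombusSide T = ∃ λ t → t ∈ T × kind t ≡ ◇ ×
    Any (λ s → direction s ∥ (1# , 0#)) (sides t)

  module _ (T : Pred Tile 0ℓ) where

    IsCorner : Pred Point 0ℓ
    IsCorner v = ∃ λ t → t ∈ T × Any (v ≈ₚ_) (corners t)

    IsSide : Pred Segment 0ℓ
    IsSide s = ∃ λ t → t ∈ T × Any (s ≈ₛ_) (sides t)

    graph : Graph
    graph = record
      { vertices = On.setoid {B = ∃ IsCorner} pointSetoid proj₁
      ; edges    = On.setoid {B = ∃ IsSide} segmentSetoid proj₁
      ; Incident = λ v e → proj₁ v EndOf proj₁ e
      }

  ----------------------------------------------------------------------
  -- Directional alternating colourings

  record Line : Set where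
    field
      base     : Point
      dir      : Point
      nonzero  : ¬ (dir ≈ₚ (0# , 0#))

    OnLine : Pred Point 0ℓ
    OnLine p = ∃ λ t → p ≈ₚ base ⊕ t · dir

    Contains : Segment → Set
    Contains (p , q) = OnLine p × OnLine q

    Precedes : Rel Segment 0ℓ
    Precedes s s′ = ∀ p p′ → p EndOf s → p′ EndOf s′ → dot dir p ≤ dot dir p′

  open Line

  parity : ℤ → Fin 2
  parity z = ∣ z ∣ mod 2

  module _ (T : Pred Tile 0ℓ) where
    open Graph (graph T) using (Edge; EdgeColouring)

    -- The edges contained in l, numbered by the elements of an interval of ℤ
    -- in the order in which they occur along l; the values of position at
    -- other edges are irrelevant.
    record Numbering (l : Line) : Set where
      field
        position : Edge → ℤ
        ordered  : ∀ e f → Contains l (proj₁ e) → Contains l (proj₁ f) →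
                   Precedes l (proj₁ e) (proj₁ f) ⇔ position e ℤ.< position f
        distinct : ∀ e f → Contains l (proj₁ e) → Contains l (proj₁ f) →
                   position e ≡ position f → proj₁ e ≈ₛ proj₁ f
        interval : ∀ e f z → Contains l (proj₁ e) → Contains l (proj₁ f) →
                   position e ℤ.≤ z → z ℤ.≤ position f →
                   ∃ λ g → Contains l (proj₁ g) × position g ≡ z

    -- The colours c₁, …, c₂ₙ are the elements of Fin (n * 2) in increasing
    -- order; combine j 0 and combine j 1 are the two colours belonging to u j.
    -- Either of them may be used first on a line, since positions may be
    -- shifted.
    record IsDirectionalAlternating {n : ℕ} (u : Fin n → Point)
                                    (c : EdgeColouring (n ℕ.* 2)) : Set where
      field
        nonParallel : ∀ i j → i ≢ j → ¬ (u i ∥ u j)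
        alternating : ∀ (l : Line) (e₀ : Edge) → Contains l (proj₁ e₀) →
          ∃ λ j → dir l ∥ u j × ∃ λ (ν : Numbering l) →
            ∀ (e : Edge) → Contains l (proj₁ e) →
              Func.to c e ≡ combine j (parity (Numbering.position ν e))

  directions : Fin 4 → Point
  directions = Vec.lookup
    ((1# , 0#) ∷ (1# , 1#) ∷ (0# , 1#) ∷ (1# , - 1#) ∷ [])

{-# OPTIONS --safe #-}

-- Up to an isometry the corners of a supertile lie in ℤ[ζ], ζ = exp(iπ/4), and
-- the conjugation √2 ↦ - √2 takes all of them into one open octagon of width
-- 1 + √2: on conjugates the substitution is a contraction by √2 - 1, and there
-- is an octagonal window for each prototile such that these windows are mapped
-- into each other.  Two edges on a common line that overlap without being
-- equal would have ends whose conjugates differ by at least 1 + √2.  So the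
-- edges on a line are disjoint up to their ends, and they can be numbered.
-- Around a lattice point whose conjugate is close to the centre of the octagon,
-- eight rhombi are the only tiles whose corners have conjugates in the octagon
-- (for a triangle, the corners of the square on its legs); such points occur
-- near every tile, whence a vertex of degree eight.  An alternating colouring
-- is proper because an edge numbered between two edges that share a vertex
-- would be degenerate.
module Submission where

open import Defs
open import Level using (0ℓ)
open import Axiom.ExcludedMiddle using (ExcludedMiddle)
open import Data.Product.Base using (∃; _×_)
open import Relation.Unary using (Pred)

import Algebra.Solver.Ring as RingSolver
open import Algebra.Solver.Ring.AlmostCommutativeRing using (fromCommutativeRing; _-Raw-AlmostCommutative⟶_)
open import Data.Bool.Base using (Bool; true; false; not)
import Data.Bool.Properties as Boolₚ
open import Data.Empty using (⊥)
open import Data.Fin.Base using (Fin; zero; suc; toℕ; fromℕ<; _↑ˡ_; combine)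
open import Data.Fin.Properties as Finₚ using (all?; any?)
open import Data.Integer.Base as ℤ using (ℤ; +_; -[1+_]; 0ℤ; 1ℤ; -1ℤ)
import Data.Integer.Properties as ℤₚ
open import Data.Integer.Tactic.RingSolver using (solve-∀)
open import Data.List.Base using (List; []; _∷_; map; _++_; reverse; lookup; length; allFin; cartesianProduct)
import Data.List.Properties as Listₚ
open import Data.List.Membership.Propositional using () renaming (_∈_ to _∈ˡ_)
open import Data.List.Membership.Propositional.Properties using (∈-map⁺; ∈-cartesianProduct⁺; ∈-allFin)
open import Data.List.Relation.Binary.Pointwise.Base using (Pointwise; []; _∷_)
open import Data.List.Relation.Unary.All as All using (All; []; _∷_)
import Data.List.Relation.Unary.All.Properties as Allₚ
open import Data.List.Relation.Unary.Any as Any using (Any; here; there)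
import Data.List.Relation.Unary.Any.Properties as Anyₚ
open import Data.Maybe.Base using (Maybe; just; nothing)
open import Data.Nat.Base as ℕ using (ℕ; zero; suc)
open import Data.Nat.DivMod using (_mod_; _%_; [m+n]%n≡m%n)
import Data.Nat.Properties as ℕₚ
open import Data.Product.Base using (_,_; proj₁; proj₂)
open import Data.Product.Properties using (≡-dec)
open import Data.Sum.Base as Sum using (_⊎_; inj₁; inj₂)
open import Data.Vec.Base as Vec using ([]; _∷_)
open import Function.Base using (_∘_)
open import Function.Bundles using (Func; mk⇔; Equivalence)
open import Relation.Binary.Bundles using (Setoid)
import Relation.Binary.Construct.NonStrictToStrict as ToStrict
open import Relation.Binary.Definitions using (tri<; tri≈; tri>)
open import Relation.Binary.PropositionalEquality as ≡ using (_≡_; _≢_)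
import Relation.Binary.Reasoning.Setoid as SetoidReasoning
open import Relation.Binary.Structures using (IsTotalOrder)
open import Relation.Nullary.Decidable using
  (Dec; yes; no; True; toWitness; from-yes; map′; ¬?; _×-dec_; _⊎-dec_; _→-dec_; decidable-stable)
open import Relation.Nullary.Negation using (¬_; contradiction)
open import Relation.Unary using (_∈_)

-- The field is abstract, so nothing in it computes. All geometry is moved to integer coordinates,
-- where finite tables are decided by evaluation, and only signs travel back through `ev`. A number
-- p + q h is pinned down by two inequalities, one for it and one for its conjugate: adding them
-- eliminates one coefficient and bounds the other, which leaves finitely many cases. Overlaps on a
-- line and the tiles around a central point are both settled in this way.
--
-- The obstacle is that the tiling as a whole comes with no lattice coordinates: each finite set of
-- tiles lies in a supertile of its own, with a frame of its own. A common frame is available only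
-- for tiles named in advance in one finite list, and the tile with the horizontal side joins the
-- list so that the axes can be taken to be the standard ones. Hence edges are compared two at a
-- time, the numbering along a line uses plane coordinates, and the vertex of degree eight is found
-- by placing probes for all 48 · 48 candidate centres before the frame is known.

-- The ring ℤ[h] and the lattice ℤ[ζ]

-- (p , q) stands for p + q h, where 2 h² = 1.
Num : Set
Num = ℤ × ℤ

infixl 6 _⊞_ _⊟_
infix  8 ⊟_

_⊞_ _⊟_ : Num → Num → Num
(p , q) ⊞ (p′ , q′) = p ℤ.+ p′ , q ℤ.+ q′
(p , q) ⊟ (p′ , q′) = p ℤ.- p′ , q ℤ.- q′

⊟_ twice conj mulμ : Num → Num
⊟ (p , q) = ℤ.- p , ℤ.- q
twice (p , q) = + 2 ℤ.* p , + 2 ℤ.* q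
conj (p , q) = p , ℤ.- q
-- Multiplication by √2 - 1 = 2 h - 1.
mulμ (p , q) = q ℤ.- p , + 2 ℤ.* p ℤ.- q

-- Since 12/17 < h < 5/7 are consecutive Farey fractions, p + q h is a
-- combination of these two integers with positive coefficients.
record Pos (z : Num) : Set where
  constructor pos
  field
    lower : 0ℤ ℤ.< + 17 ℤ.* proj₁ z ℤ.+ + 12 ℤ.* proj₂ z
    upper : 0ℤ ℤ.< + 7 ℤ.* proj₁ z ℤ.+ + 5 ℤ.* proj₂ z

NonNeg : Num → Set
NonNeg z = z ≡ (0ℤ , 0ℤ) ⊎ Pos z

pos? : ∀ z → Dec (Pos z)
pos? (p , q) = map′ (λ (a , b) → pos a b) (λ (pos a b) → a , b)
  ((0ℤ ℤₚ.<? _) ×-dec (0ℤ ℤₚ.<? _))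

nonNeg? : ∀ z → Dec (NonNeg z)
nonNeg? z@(p , q) =
  map′ (λ (a , b) → ≡.cong₂ _,_ a b) (λ e → ≡.cong proj₁ e , ≡.cong proj₂ e)
    ((p ℤₚ.≟ 0ℤ) ×-dec (q ℤₚ.≟ 0ℤ))
  ⊎-dec pos? z

-- lat a₀ a₁ a₂ a₃ stands for a₀ + a₁ ζ + a₂ ζ² + a₃ ζ³, ζ = exp(iπ/4).
record Lat : Set where
  constructor lat
  field a₀ a₁ a₂ a₃ : ℤ

lat-≡ : ∀ {a b c d a′ b′ c′ d′} → a ≡ a′ → b ≡ b′ → c ≡ c′ → d ≡ d′ →
        lat a b c d ≡ lat a′ b′ c′ d′
lat-≡ ≡.refl ≡.refl ≡.refl ≡.refl = ≡.refl

infixl 6 _⊹_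

_⊹_ : Lat → Lat → Lat
lat a b c d ⊹ lat a′ b′ c′ d′ = lat (a ℤ.+ a′) (b ℤ.+ b′) (c ℤ.+ c′) (d ℤ.+ d′)

-- `mul√2` rests on √2 = ζ + ζ⁻¹ = ζ - ζ³.
neg mul√2 mulΛ : Lat → Lat
neg (lat a b c d) = lat (ℤ.- a) (ℤ.- b) (ℤ.- c) (ℤ.- d)
mul√2 (lat a b c d) = lat (b ℤ.- d) (a ℤ.+ c) (b ℤ.+ d) (c ℤ.- a)
mulΛ u = u ⊹ mul√2 u

𝟎 : Lat
𝟎 = lat 0ℤ 0ℤ 0ℤ 0ℤ

pattern d0 = zero
pattern d1 = suc d0
pattern d2 = suc d1
pattern d3 = suc d2
pattern d4 = suc d3
pattern d5 = suc d4
pattern d6 = suc d5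
pattern d7 = suc d6

opp : Fin 8 → Fin 8
opp = Vec.lookup (d4 ∷ d5 ∷ d6 ∷ d7 ∷ d0 ∷ d1 ∷ d2 ∷ d3 ∷ [])

unit : Fin 8 → Lat
unit d0 = lat 1ℤ 0ℤ 0ℤ 0ℤ
unit d1 = lat 0ℤ 1ℤ 0ℤ 0ℤ
unit d2 = lat 0ℤ 0ℤ 1ℤ 0ℤ
unit d3 = lat 0ℤ 0ℤ 0ℤ 1ℤ
unit d4 = lat -1ℤ 0ℤ 0ℤ 0ℤ
unit d5 = lat 0ℤ -1ℤ 0ℤ 0ℤ
unit d6 = lat 0ℤ 0ℤ -1ℤ 0ℤ
unit d7 = lat 0ℤ 0ℤ 0ℤ -1ℤ

-- The inner product with ζᵐ.
ℓ : Fin 8 → Lat → Num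
ℓ d0 (lat a b c d) = a , b ℤ.- d
ℓ d1 (lat a b c d) = b , a ℤ.+ c
ℓ d2 (lat a b c d) = c , b ℤ.+ d
ℓ d3 (lat a b c d) = d , c ℤ.- a
ℓ d4 u = ⊟ ℓ d0 u
ℓ d5 u = ⊟ ℓ d1 u
ℓ d6 u = ⊟ ℓ d2 u
ℓ d7 u = ⊟ ℓ d3 u

⊟-⊞ : ∀ z w → ⊟ (z ⊞ w) ≡ ⊟ z ⊞ ⊟ w
⊟-⊞ (p , q) (p′ , q′) = ≡.cong₂ _,_ (ℤₚ.neg-distrib-+ p p′) (ℤₚ.neg-distrib-+ q q′)

⊟-involutive : ∀ z → ⊟ (⊟ z) ≡ z
⊟-involutive (p , q) = ≡.cong₂ _,_ (ℤₚ.neg-involutive p) (ℤₚ.neg-involutive q)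

private
  interchange : ∀ x y z w → (x ℤ.+ y) ℤ.- (z ℤ.+ w) ≡ (x ℤ.- z) ℤ.+ (y ℤ.- w)
  interchange = solve-∀
  interchange₊ : ∀ x y z w → (x ℤ.+ y) ℤ.+ (z ℤ.+ w) ≡ (x ℤ.+ z) ℤ.+ (y ℤ.+ w)
  interchange₊ = solve-∀

ℓ-⊹ : ∀ m u v → ℓ m (u ⊹ v) ≡ ℓ m u ⊞ ℓ m v
ℓ-⊹ d0 (lat a b c d) (lat a′ b′ c′ d′) = ≡.cong₂ _,_ ≡.refl (interchange b b′ d d′)
ℓ-⊹ d1 (lat a b c d) (lat a′ b′ c′ d′) = ≡.cong₂ _,_ ≡.refl (interchange₊ a a′ c c′)
ℓ-⊹ d2 (lat a b c d) (lat a′ b′ c′ d′) = ≡.cong₂ _,_ ≡.refl (interchange₊ b b′ d d′)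
ℓ-⊹ d3 (lat a b c d) (lat a′ b′ c′ d′) = ≡.cong₂ _,_ ≡.refl (interchange c c′ a a′)
ℓ-⊹ d4 u v = ≡.trans (≡.cong ⊟_ (ℓ-⊹ d0 u v)) (⊟-⊞ (ℓ d0 u) (ℓ d0 v))
ℓ-⊹ d5 u v = ≡.trans (≡.cong ⊟_ (ℓ-⊹ d1 u v)) (⊟-⊞ (ℓ d1 u) (ℓ d1 v))
ℓ-⊹ d6 u v = ≡.trans (≡.cong ⊟_ (ℓ-⊹ d2 u v)) (⊟-⊞ (ℓ d2 u) (ℓ d2 v))
ℓ-⊹ d7 u v = ≡.trans (≡.cong ⊟_ (ℓ-⊹ d3 u v)) (⊟-⊞ (ℓ d3 u) (ℓ d3 v))

ℓ-opp : ∀ m u → ℓ (opp m) u ≡ ⊟ ℓ m u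
ℓ-opp d0 u = ≡.refl
ℓ-opp d1 u = ≡.refl
ℓ-opp d2 u = ≡.refl
ℓ-opp d3 u = ≡.refl
ℓ-opp d4 u = ≡.sym (⊟-involutive (ℓ d0 u))
ℓ-opp d5 u = ≡.sym (⊟-involutive (ℓ d1 u))
ℓ-opp d6 u = ≡.sym (⊟-involutive (ℓ d2 u))
ℓ-opp d7 u = ≡.sym (⊟-involutive (ℓ d3 u))

mul√2ₙ : Num → Num
mul√2ₙ (p , q) = q , + 2 ℤ.* p

ℓ-mul√2 : ∀ m u → ℓ m (mul√2 u) ≡ mul√2ₙ (ℓ m u)
ℓ-mul√2 d0 (lat a b c d) = ≡.cong₂ _,_ ≡.refl (lemma a c)
  where lemma : ∀ a c → (a ℤ.+ c) ℤ.- (c ℤ.- a) ≡ + 2 ℤ.* a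
        lemma = solve-∀
ℓ-mul√2 d1 (lat a b c d) = ≡.cong₂ _,_ ≡.refl (lemma b d)
  where lemma : ∀ b d → (b ℤ.- d) ℤ.+ (b ℤ.+ d) ≡ + 2 ℤ.* b
        lemma = solve-∀
ℓ-mul√2 d2 (lat a b c d) = ≡.cong₂ _,_ ≡.refl (lemma a c)
  where lemma : ∀ a c → (a ℤ.+ c) ℤ.+ (c ℤ.- a) ≡ + 2 ℤ.* c
        lemma = solve-∀
ℓ-mul√2 d3 (lat a b c d) = ≡.cong₂ _,_ ≡.refl (lemma b d)
  where lemma : ∀ b d → (b ℤ.+ d) ℤ.- (b ℤ.- d) ≡ + 2 ℤ.* d
        lemma = solve-∀
ℓ-mul√2 d4 u = ≡.trans (≡.cong ⊟_ (ℓ-mul√2 d0 u)) (≡.cong₂ _,_ ≡.refl (ℤₚ.neg-distribʳ-* (+ 2) (proj₁ (ℓ d0 u))))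
ℓ-mul√2 d5 u = ≡.trans (≡.cong ⊟_ (ℓ-mul√2 d1 u)) (≡.cong₂ _,_ ≡.refl (ℤₚ.neg-distribʳ-* (+ 2) (proj₁ (ℓ d1 u))))
ℓ-mul√2 d6 u = ≡.trans (≡.cong ⊟_ (ℓ-mul√2 d2 u)) (≡.cong₂ _,_ ≡.refl (ℤₚ.neg-distribʳ-* (+ 2) (proj₁ (ℓ d2 u))))
ℓ-mul√2 d7 u = ≡.trans (≡.cong ⊟_ (ℓ-mul√2 d3 u)) (≡.cong₂ _,_ ≡.refl (ℤₚ.neg-distribʳ-* (+ 2) (proj₁ (ℓ d3 u))))

-- The conjugate of the expansion factor is 1 - √2.
ℓ-mulΛ : ∀ m u → conj (ℓ m (mulΛ u)) ≡ mulμ (conj (ℓ (opp m) u))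
ℓ-mulΛ m u =
  ≡.trans (≡.cong conj (≡.trans (ℓ-⊹ m u (mul√2 u)) (≡.cong (ℓ m u ⊞_) (ℓ-mul√2 m u))))
  (≡.trans (lemma (ℓ m u)) (≡.cong (λ z → mulμ (conj z)) (≡.sym (ℓ-opp m u))))
  where
  first : ∀ p q → p ℤ.+ q ≡ ℤ.- (ℤ.- q) ℤ.- (ℤ.- p)
  first = solve-∀
  second : ∀ p q → ℤ.- (q ℤ.+ + 2 ℤ.* p) ≡ + 2 ℤ.* (ℤ.- p) ℤ.- ℤ.- (ℤ.- q)
  second = solve-∀
  lemma : ∀ z → conj (z ⊞ mul√2ₙ z) ≡ mulμ (conj (⊟ z))
  lemma (p , q) = ≡.cong₂ _,_ (first p q) (second p q)

-- The reflections ζᵏ ↦ ζ⁻ᵏ and ζᵏ ↦ ζ¹⁻ᵏ generate the symmetries of the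
-- lattice of units.
data Reflection : Set where
  𝐀 𝐁 : Reflection

Symmetry : Set
Symmetry = List Reflection

reflect : Reflection → Lat → Lat
reflect 𝐀 (lat a b c d) = lat a (ℤ.- d) (ℤ.- c) (ℤ.- b)
reflect 𝐁 (lat a b c d) = lat b a (ℤ.- d) (ℤ.- c)

reflectDir : Reflection → Fin 8 → Fin 8
reflectDir 𝐀 = Vec.lookup (d0 ∷ d7 ∷ d6 ∷ d5 ∷ d4 ∷ d3 ∷ d2 ∷ d1 ∷ [])
reflectDir 𝐁 = Vec.lookup (d1 ∷ d0 ∷ d7 ∷ d6 ∷ d5 ∷ d4 ∷ d3 ∷ d2 ∷ [])

act : Symmetry → Lat → Lat
act []      u = u
act (r ∷ g) u = reflect r (act g u)

actDir : Symmetry → Fin 8 → Fin 8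
actDir []      m = m
actDir (r ∷ g) m = reflectDir r (actDir g m)

private
  swap-neg : ∀ x y → x ℤ.- y ≡ ℤ.- (y ℤ.- x)
  swap-neg = solve-∀
  neg-swap : ∀ x y → ℤ.- x ℤ.- ℤ.- y ≡ y ℤ.- x
  neg-swap = solve-∀
  neg-swap₊ : ∀ x y → ℤ.- x ℤ.+ ℤ.- y ≡ ℤ.- (y ℤ.+ x)
  neg-swap₊ = solve-∀
  minus-neg : ∀ x y → x ℤ.- ℤ.- y ≡ x ℤ.+ y
  minus-neg = solve-∀
  neg-minus : ∀ x y → ℤ.- x ℤ.- y ≡ ℤ.- (y ℤ.+ x)
  neg-minus = solve-∀

-- Reflections are orthogonal and their own inverses, so they can be moved from one argument of the
-- inner product to the other.
ℓ-reflect : ∀ r m u → ℓ m (reflect r u) ≡ ℓ (reflectDir r m) u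
ℓ-reflect 𝐀 d0 (lat a b c d) = ≡.cong₂ _,_ ≡.refl (neg-swap d b)
ℓ-reflect 𝐀 d1 (lat a b c d) = ≡.cong₂ _,_ ≡.refl (swap-neg a c)
ℓ-reflect 𝐀 d2 (lat a b c d) = ≡.cong₂ _,_ ≡.refl (neg-swap₊ d b)
ℓ-reflect 𝐀 d3 (lat a b c d) = ≡.cong₂ _,_ ≡.refl (neg-minus c a)
ℓ-reflect 𝐀 d4 u = ≡.cong ⊟_ (ℓ-reflect 𝐀 d0 u)
ℓ-reflect 𝐀 d5 u = ≡.trans (≡.cong ⊟_ (ℓ-reflect 𝐀 d1 u)) (⊟-involutive (ℓ d3 u))
ℓ-reflect 𝐀 d6 u = ≡.trans (≡.cong ⊟_ (ℓ-reflect 𝐀 d2 u)) (⊟-involutive (ℓ d2 u))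
ℓ-reflect 𝐀 d7 u = ≡.trans (≡.cong ⊟_ (ℓ-reflect 𝐀 d3 u)) (⊟-involutive (ℓ d1 u))
ℓ-reflect 𝐁 d0 (lat a b c d) = ≡.cong₂ _,_ ≡.refl (minus-neg a c)
ℓ-reflect 𝐁 d1 (lat a b c d) = ≡.cong₂ _,_ ≡.refl ≡.refl
ℓ-reflect 𝐁 d2 (lat a b c d) = ≡.cong₂ _,_ ≡.refl (swap-neg a c)
ℓ-reflect 𝐁 d3 (lat a b c d) = ≡.cong₂ _,_ ≡.refl (neg-minus d b)
ℓ-reflect 𝐁 d4 u = ≡.cong ⊟_ (ℓ-reflect 𝐁 d0 u)
ℓ-reflect 𝐁 d5 u = ≡.cong ⊟_ (ℓ-reflect 𝐁 d1 u)
ℓ-reflect 𝐁 d6 u = ≡.trans (≡.cong ⊟_ (ℓ-reflect 𝐁 d2 u)) (⊟-involutive (ℓ d3 u))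
ℓ-reflect 𝐁 d7 u = ≡.trans (≡.cong ⊟_ (ℓ-reflect 𝐁 d3 u)) (⊟-involutive (ℓ d2 u))

reflect-⊹ : ∀ r u v → reflect r (u ⊹ v) ≡ reflect r u ⊹ reflect r v
reflect-⊹ 𝐀 (lat a b c d) (lat a′ b′ c′ d′) =
  lat-≡ ≡.refl (ℤₚ.neg-distrib-+ d d′) (ℤₚ.neg-distrib-+ c c′) (ℤₚ.neg-distrib-+ b b′)
reflect-⊹ 𝐁 (lat a b c d) (lat a′ b′ c′ d′) =
  lat-≡ ≡.refl ≡.refl (ℤₚ.neg-distrib-+ d d′) (ℤₚ.neg-distrib-+ c c′)

reflect-involutive : ∀ r u → reflect r (reflect r u) ≡ u
reflect-involutive 𝐀 (lat a b c d) =
  lat-≡ ≡.refl (ℤₚ.neg-involutive b) (ℤₚ.neg-involutive c) (ℤₚ.neg-involutive d)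
reflect-involutive 𝐁 (lat a b c d) =
  lat-≡ ≡.refl ≡.refl (ℤₚ.neg-involutive c) (ℤₚ.neg-involutive d)

act-⊹ : ∀ g u v → act g (u ⊹ v) ≡ act g u ⊹ act g v
act-⊹ []      u v = ≡.refl
act-⊹ (r ∷ g) u v = ≡.trans (≡.cong (reflect r) (act-⊹ g u v)) (reflect-⊹ r (act g u) (act g v))

act-++ : ∀ g g′ u → act (g ++ g′) u ≡ act g (act g′ u)
act-++ []      g′ u = ≡.refl
act-++ (r ∷ g) g′ u = ≡.cong (reflect r) (act-++ g g′ u)

act-reverse : ∀ g u → act g (act (reverse g) u) ≡ u
act-reverse []      u = ≡.refl
act-reverse (r ∷ g) u = begin
  reflect r (act g (act (reverse (r ∷ g)) u))
    ≡⟨ ≡.cong (λ x → reflect r (act g (act x u))) (Listₚ.unfold-reverse r g) ⟩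
  reflect r (act g (act (reverse g ++ r ∷ []) u))
    ≡⟨ ≡.cong (λ x → reflect r (act g x)) (act-++ (reverse g) (r ∷ []) u) ⟩
  reflect r (act g (act (reverse g) (reflect r u)))
    ≡⟨ ≡.cong (reflect r) (act-reverse g (reflect r u)) ⟩
  reflect r (reflect r u)
    ≡⟨ reflect-involutive r u ⟩
  u ∎
  where open ≡.≡-Reasoning

-- The adjoint of a symmetry is its inverse, and the inverse of a word of involutions is the
-- reversed word.
ℓ-act : ∀ g m u → ℓ m (act g u) ≡ ℓ (actDir (reverse g) m) u
ℓ-act []      m u = ≡.refl
ℓ-act (r ∷ g) m u = begin
  ℓ m (reflect r (act g u))                     ≡⟨ ℓ-reflect r m (act g u) ⟩
  ℓ (reflectDir r m) (act g u)                  ≡⟨ ℓ-act g (reflectDir r m) u ⟩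
  ℓ (actDir (reverse g) (reflectDir r m)) u     ≡⟨ ≡.cong (λ i → ℓ i u) (≡.sym (actDir-++ (reverse g) (r ∷ []) m)) ⟩
  ℓ (actDir (reverse g ++ r ∷ []) m) u          ≡⟨ ≡.cong (λ x → ℓ (actDir x m) u)
    (≡.sym (Listₚ.unfold-reverse r g)) ⟩
  ℓ (actDir (reverse (r ∷ g)) m) u              ∎
  where
  open ≡.≡-Reasoning
  actDir-++ : ∀ g g′ m → actDir (g ++ g′) m ≡ actDir g (actDir g′ m)
  actDir-++ []      g′ m = ≡.refl
  actDir-++ (r ∷ g) g′ m = ≡.cong (reflectDir r) (actDir-++ g g′ m)

next : Bool → Fin 8 → Fin 8
next true  = Vec.lookup (d1 ∷ d2 ∷ d3 ∷ d4 ∷ d5 ∷ d6 ∷ d7 ∷ d0 ∷ [])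
next false = Vec.lookup (d7 ∷ d0 ∷ d1 ∷ d2 ∷ d3 ∷ d4 ∷ d5 ∷ d6 ∷ [])

reflect-unit : ∀ r i → reflect r (unit i) ≡ unit (reflectDir r i)
reflect-unit = λ where
  𝐀 d0 → ≡.refl
  𝐀 d1 → ≡.refl
  𝐀 d2 → ≡.refl
  𝐀 d3 → ≡.refl
  𝐀 d4 → ≡.refl
  𝐀 d5 → ≡.refl
  𝐀 d6 → ≡.refl
  𝐀 d7 → ≡.refl
  𝐁 d0 → ≡.refl
  𝐁 d1 → ≡.refl
  𝐁 d2 → ≡.refl
  𝐁 d3 → ≡.refl
  𝐁 d4 → ≡.refl
  𝐁 d5 → ≡.refl
  𝐁 d6 → ≡.refl
  𝐁 d7 → ≡.refl

act-unit : ∀ g i → act g (unit i) ≡ unit (actDir g i)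
act-unit []      i = ≡.refl
act-unit (r ∷ g) i = ≡.trans (≡.cong (reflect r) (act-unit g i)) (reflect-unit r (actDir g i))

-- Neighbouring directions stay neighbours. The Boolean tells whether the sense of rotation is kept,
-- and every reflection flips it; together with the image of `d0` it determines the image of a
-- prototile.
actDir-next : ∀ g i → ∃ λ b → actDir g (next true i) ≡ next b (actDir g i) ×
                             actDir g (next false i) ≡ next (not b) (actDir g i)
actDir-next []      i = true , ≡.refl , ≡.refl
actDir-next (r ∷ g) i with actDir-next g i
... | b , e , e′ = not b , ≡.trans (≡.cong (reflectDir r) e) (flip r b (actDir g i))
                         , ≡.trans (≡.cong (reflectDir r) e′) (flip r (not b) (actDir g i))
  where
  flip : ∀ r b i → reflectDir r (next b i) ≡ next (not b) (reflectDir r i)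
  flip = λ where
    𝐀 false → toWitness {a? = all? λ i → _ Finₚ.≟ _} _
    𝐀 true  → toWitness {a? = all? λ i → _ Finₚ.≟ _} _
    𝐁 false → toWitness {a? = all? λ i → _ Finₚ.≟ _} _
    𝐁 true  → toWitness {a? = all? λ i → _ Finₚ.≟ _} _

-- Prototiles, dissections and windows in the lattice

-- A copy of `Kind` outside the module over the field, so that the tables below are closed terms.
data Shape : Set where △ ◇ : Shape

data LTile : Set where
  triangle : (tail head apex : Lat) → LTile
  rhombus  : (a b c d : Lat) → LTile

mapL : (Lat → Lat) → LTile → LTile
mapL f (triangle t u a)  = triangle (f t) (f u) (f a)
mapL f (rhombus a b c d) = rhombus (f a) (f b) (f c) (f d)

protoL : Shape → LTile
protoL △ = triangle 𝟎 (unit d1 ⊹ unit d7) (unit d1)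
protoL ◇ = rhombus 𝟎 (unit d0) (unit d0 ⊹ unit d1) (unit d1)

record Child : Set where
  constructor child
  field
    shapeᶜ  : Shape
    symᶜ   : Symmetry
    shiftᶜ : Lat

open Child

childTile : Child → LTile
childTile (child k g w) = mapL (λ u → w ⊹ act g u) (protoL k)

-- `𝐁` after `𝐀` sends ζᵏ to ζᵏ⁺¹, which is the rotation by 45°.
rot : ℕ → Symmetry
rot zero    = []
rot (suc n) = 𝐁 ∷ 𝐀 ∷ rot n

-- The dissections in lattice form; a trailing `𝐀` marks the reflected copies. `dissection-children`
-- compares this list with `dissection`.
children : Shape → List Child
children △ =
    child △ (rot 5) (lat (+ 1) (+ 0) (+ 1) (+ 0))
  ∷ child △ (rot 4 ++ 𝐀 ∷ []) (lat (+ 1) (+ 1) (+ 0) (-[1+ 0 ]))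
  ∷ child △ (rot 3) (lat (+ 2) (+ 1) (+ 0) (+ 0))
  ∷ child ◇ (rot 2 ++ 𝐀 ∷ []) (lat (+ 1) (+ 0) (+ 0) (+ 0))
  ∷ child ◇ (rot 3) (lat (+ 2) (+ 1) (+ 0) (-[1+ 0 ]))
  ∷ []
children ◇ =
    child ◇ (rot 0) (lat (+ 0) (+ 0) (+ 0) (+ 0))
  ∷ child ◇ (rot 2) (lat (+ 1) (+ 1) (+ 0) (-[1+ 0 ]))
  ∷ child ◇ (rot 0) (lat (+ 1) (+ 1) (+ 1) (-[1+ 0 ]))
  ∷ child △ (rot 1 ++ 𝐀 ∷ []) (lat (+ 0) (+ 1) (+ 0) (+ 0))
  ∷ child △ (rot 0) (lat (+ 1) (+ 0) (+ 0) (+ 0))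
  ∷ child △ (rot 5 ++ 𝐀 ∷ []) (lat (+ 2) (+ 1) (+ 1) (-[1+ 0 ]))
  ∷ child △ (rot 4) (lat (+ 1) (+ 2) (+ 1) (-[1+ 0 ]))
  ∷ []

-- The position u, in its own frame, of a tile of a supertile satisfies
-- 2 conj (ℓ m u) < window s m for all m.  These octagons are the smallest ones
-- that the substitution maps into each other.
window : Shape → Fin 8 → Num
window △ = Vec.lookup
  ( (1ℤ , + 2) ∷ (-1ℤ , 0ℤ) ∷ (1ℤ , 0ℤ) ∷ (1ℤ , + 2)
  ∷ (0ℤ , -[1+ 1 ]) ∷ (1ℤ , + 2) ∷ (1ℤ , 0ℤ) ∷ (-1ℤ , 0ℤ) ∷ [])
window ◇ = Vec.lookup
  ( (-1ℤ , + 2) ∷ (-1ℤ , + 2) ∷ (1ℤ , + 2) ∷ (1ℤ , 0ℤ)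
  ∷ (1ℤ , 0ℤ) ∷ (1ℤ , 0ℤ) ∷ (1ℤ , 0ℤ) ∷ (1ℤ , + 2) ∷ [])

-- Inner products are doubled because the half width 1/2 + h of the octagon has no integer
-- coefficients.
slack : Num → Fin 8 → Lat → Num
slack b m u = b ⊟ twice (conj (ℓ m u))

-- The constant term of the recursion in `childSlack-step`. That it is nonnegative for all `m` means
-- that the contracted and shifted window of the parent lies in the window of the child. The
-- opposite direction enters because the conjugate 1 - √2 of the expansion factor is negative.
childSlack : Shape → Child → Fin 8 → Num
childSlack k (child k′ g w) m =
  window k′ m ⊟ mulμ (window k (opp (actDir g m))) ⊟ twice (conj (ℓ (actDir g m) w))

childSlack-nonNeg : ∀ k → All (λ c → ∀ m → NonNeg (childSlack k c m)) (children k)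
childSlack-nonNeg △ = toWitness {a? = All.all? (λ c → all? λ m → nonNeg? (childSlack △ c m)) (children △)} _
childSlack-nonNeg ◇ = toWitness {a? = All.all? (λ c → all? λ m → nonNeg? (childSlack ◇ c m)) (children ◇)} _

octagon : Num
octagon = 1ℤ , + 2

-- The corners of a prototile.  The fourth corner of the square on the legs of a
-- triangle is included, since otherwise a half square could overlap a rhombus
-- unnoticed.
outline : Shape → List Lat
outline △ = 𝟎 ∷ (unit d1 ⊹ unit d7) ∷ unit d1 ∷ unit d7 ∷ []
outline ◇ = 𝟎 ∷ unit d0 ∷ (unit d0 ⊹ unit d1) ∷ unit d1 ∷ []

-- The reason why one octagon serves both shapes: the bound of a window and the conjugate of an
-- outline point never add up to more than the bound of the octagon.
outline-slack : ∀ k → All (λ δ → ∀ m → NonNeg (slack octagon m δ ⊟ window k m)) (outline k)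
outline-slack △ = toWitness {a? = All.all? (λ δ → all? λ m → nonNeg? (slack octagon m δ ⊟ window △ m)) (outline △)} _
outline-slack ◇ = toWitness {a? = All.all? (λ δ → all? λ m → nonNeg? (slack octagon m δ ⊟ window ◇ m)) (outline ◇)} _

-- A point inside each window, at which the prototile is placed to start the induction. The origin
-- will not do for the triangle, whose window has the negative bound -1 in direction `d1`.
seed : Shape → Lat
seed △ = lat 1ℤ 0ℤ 0ℤ 0ℤ
seed ◇ = lat 0ℤ 0ℤ 0ℤ 0ℤ

seed-inWindow : ∀ k m → Pos (slack (window k m) m (seed k))
seed-inWindow △ = toWitness {a? = all? λ m → pos? (slack (window △ m) m (seed △))} _
seed-inWindow ◇ = toWitness {a? = all? λ m → pos? (slack (window ◇ m) m (seed ◇))} _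

private
  childSlack-identity : ∀ W′ W y z →
    W′ ⊟ twice (mulμ y ⊞ z) ≡ mulμ (W ⊟ twice y) ⊞ (W′ ⊟ mulμ W ⊟ twice z)
  childSlack-identity (a , b) (c , d) (p , q) (r , s) =
    ≡.cong₂ _,_ (first a c d p q r) (second b c d p q s)
    where
    first : ∀ a c d p q r →
      a ℤ.- + 2 ℤ.* ((q ℤ.- p) ℤ.+ r) ≡
      ((d ℤ.- + 2 ℤ.* q) ℤ.- (c ℤ.- + 2 ℤ.* p)) ℤ.+ ((a ℤ.- (d ℤ.- c)) ℤ.- + 2 ℤ.* r)
    first = solve-∀
    second : ∀ b c d p q s →
      b ℤ.- + 2 ℤ.* ((+ 2 ℤ.* p ℤ.- q) ℤ.+ s) ≡
      (+ 2 ℤ.* (c ℤ.- + 2 ℤ.* p) ℤ.- (d ℤ.- + 2 ℤ.* q)) ℤ.+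
      ((b ℤ.- (+ 2 ℤ.* c ℤ.- d)) ℤ.- + 2 ℤ.* s)
    second = solve-∀

conj-⊞ : ∀ z w → conj (z ⊞ w) ≡ conj z ⊞ conj w
conj-⊞ (p , q) (p′ , q′) = ≡.cong (p ℤ.+ p′ ,_) (ℤₚ.neg-distrib-+ q q′)

-- Positions are measured in the axes of the tile itself, so that one window per shape covers all
-- orientations. The anchor Λ u + w of the child, known in the axes of the parent, is therefore
-- turned back by the symmetry of the child.
childPosition : Child → Lat → Lat
childPosition (child _ g w) u = act (reverse g) (mulΛ u ⊹ w)

childSlack-step : ∀ k c m u →
  slack (window (shapeᶜ c) m) m (childPosition c u) ≡
  (let m′ = opp (actDir (symᶜ c) m) in
   mulμ (slack (window k m′) m′ u) ⊞ childSlack k c m)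
childSlack-step k (child k′ g w) m u = begin
  window k′ m ⊟ twice (conj (ℓ m (act (reverse g) (mulΛ u ⊹ w))))
    ≡⟨ ≡.cong (λ z → window k′ m ⊟ twice (conj z)) position ⟩
  window k′ m ⊟ twice (conj (ℓ n (mulΛ u) ⊞ ℓ n w))
    ≡⟨ ≡.cong (λ z → window k′ m ⊟ twice z)
         (≡.trans (conj-⊞ (ℓ n (mulΛ u)) (ℓ n w)) (≡.cong (_⊞ conj (ℓ n w)) (ℓ-mulΛ n u))) ⟩
  window k′ m ⊟ twice (mulμ (conj (ℓ (opp n) u)) ⊞ conj (ℓ n w))
    ≡⟨ childSlack-identity (window k′ m) (window k (opp n)) (conj (ℓ (opp n) u)) (conj (ℓ n w)) ⟩
  mulμ (slack (window k (opp n)) (opp n) u) ⊞ childSlack k (child k′ g w) m ∎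
  where
  open ≡.≡-Reasoning
  n = actDir g m
  position : ℓ m (act (reverse g) (mulΛ u ⊹ w)) ≡ ℓ n (mulΛ u) ⊞ ℓ n w
  position = ≡.trans (ℓ-act (reverse g) m (mulΛ u ⊹ w))
    (≡.trans (≡.cong (λ x → ℓ (actDir x m) (mulΛ u ⊹ w)) (Listₚ.reverse-involutive g))
           (ℓ-⊹ n (mulΛ u) w))

slack-⊹ : ∀ b c m u v → slack b m (u ⊹ v) ≡ slack c m u ⊞ (slack b m v ⊟ c)
slack-⊹ b c m u v =
  ≡.trans (≡.cong (λ z → b ⊟ twice (conj z)) (ℓ-⊹ m u v)) (lemma b c (ℓ m u) (ℓ m v))
  where
  first : ∀ b c p r → b ℤ.- + 2 ℤ.* (p ℤ.+ r) ≡ (c ℤ.- + 2 ℤ.* p) ℤ.+ ((b ℤ.- + 2 ℤ.* r) ℤ.- c)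
  first = solve-∀
  second : ∀ b c p r → b ℤ.- + 2 ℤ.* (ℤ.- (p ℤ.+ r)) ≡ (c ℤ.- + 2 ℤ.* (ℤ.- p)) ℤ.+ ((b ℤ.- + 2 ℤ.* (ℤ.- r)) ℤ.- c)
  second = solve-∀
  lemma : ∀ b c y z → b ⊟ twice (conj (y ⊞ z)) ≡ (c ⊟ twice (conj y)) ⊞ ((b ⊟ twice (conj z)) ⊟ c)
  lemma (b , b′) (c , c′) (p , q) (r , s) = ≡.cong₂ _,_ (first b c p r) (second b′ c′ q s)

Apart : Num → Set
Apart z = Pos z ⊎ Pos (⊟ z)

apart? : ∀ z → Dec (Apart z)
apart? z = pos? z ⊎-dec pos? (⊟ z)

⊹-identityʳ : ∀ u → u ⊹ 𝟎 ≡ u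
⊹-identityʳ (lat a b c d) =
  lat-≡ (ℤₚ.+-identityʳ a) (ℤₚ.+-identityʳ b) (ℤₚ.+-identityʳ c) (ℤₚ.+-identityʳ d)

⊹-identityˡ : ∀ u → 𝟎 ⊹ u ≡ u
⊹-identityˡ (lat a b c d) =
  lat-≡ (ℤₚ.+-identityˡ a) (ℤₚ.+-identityˡ b) (ℤₚ.+-identityˡ c) (ℤₚ.+-identityˡ d)

⊹-assoc : ∀ u v w → (u ⊹ v) ⊹ w ≡ u ⊹ (v ⊹ w)
⊹-assoc (lat a b c d) (lat a′ b′ c′ d′) (lat a″ b″ c″ d″) =
  lat-≡ (ℤₚ.+-assoc a a′ a″) (ℤₚ.+-assoc b b′ b″) (ℤₚ.+-assoc c c′ c″) (ℤₚ.+-assoc d d′ d″)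

⊹-comm : ∀ u v → u ⊹ v ≡ v ⊹ u
⊹-comm (lat a b c d) (lat a′ b′ c′ d′) =
  lat-≡ (ℤₚ.+-comm a a′) (ℤₚ.+-comm b b′) (ℤₚ.+-comm c c′) (ℤₚ.+-comm d d′)

⊹-inverseʳ : ∀ u → u ⊹ neg u ≡ 𝟎
⊹-inverseʳ (lat a b c d) =
  lat-≡ (ℤₚ.+-inverseʳ a) (ℤₚ.+-inverseʳ b) (ℤₚ.+-inverseʳ c) (ℤₚ.+-inverseʳ d)

-- The images of the prototiles under the sixteen symmetries: `i` is the image of direction 0 and
-- `b` the sense of rotation. Unlike words of reflections, these parameters range over a finite set
-- and can be searched.
oriented : Shape → Fin 8 → Bool → LTile
oriented △ i b = triangle 𝟎 (unit (next b i) ⊹ unit (next (not b) i)) (unit (next b i))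
oriented ◇ i b = rhombus 𝟎 (unit i) (unit i ⊹ unit (next b i)) (unit (next b i))

orientedOutline : Shape → Fin 8 → Bool → List Lat
orientedOutline △ i b =
  𝟎 ∷ (unit (next b i) ⊹ unit (next (not b) i)) ∷ unit (next b i) ∷ unit (next (not b) i) ∷ []
orientedOutline ◇ i b = 𝟎 ∷ unit i ∷ (unit i ⊹ unit (next b i)) ∷ unit (next b i) ∷ []

cornersL : LTile → List Lat
cornersL (triangle t u a)  = t ∷ u ∷ a ∷ []
cornersL (rhombus a b c d) = a ∷ b ∷ c ∷ d ∷ []

sidesL : LTile → List (Lat × Lat)
sidesL (triangle t u a)  = (t , u) ∷ (u , a) ∷ (a , t) ∷ []
sidesL (rhombus a b c d) = (a , b) ∷ (b , c) ∷ (c , d) ∷ (d , a) ∷ []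

module _ (g : Symmetry) where
  private
    i = actDir g d0
    b = proj₁ (actDir-next g d0)

    act-𝟎 : act g 𝟎 ≡ 𝟎
    act-𝟎 = begin
      act g 𝟎                       ≡⟨ ⊹-identityʳ (act g 𝟎) ⟨
      act g 𝟎 ⊹ 𝟎                   ≡⟨ ≡.cong (act g 𝟎 ⊹_) (⊹-inverseʳ (act g 𝟎)) ⟨
      act g 𝟎 ⊹ (act g 𝟎 ⊹ neg (act g 𝟎))
        ≡⟨ ⊹-assoc (act g 𝟎) (act g 𝟎) (neg (act g 𝟎)) ⟨
      (act g 𝟎 ⊹ act g 𝟎) ⊹ neg (act g 𝟎)
        ≡⟨ ≡.cong (_⊹ neg (act g 𝟎)) (act-⊹ g 𝟎 𝟎) ⟨
      act g 𝟎 ⊹ neg (act g 𝟎)       ≡⟨ ⊹-inverseʳ (act g 𝟎) ⟩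
      𝟎                             ∎
      where open ≡.≡-Reasoning

    act-d1 : act g (unit d1) ≡ unit (next b i)
    act-d1 = ≡.trans (act-unit g d1) (≡.cong unit (proj₁ (proj₂ (actDir-next g d0))))

    act-d7 : act g (unit d7) ≡ unit (next (not b) i)
    act-d7 = ≡.trans (act-unit g d7) (≡.cong unit (proj₂ (proj₂ (actDir-next g d0))))

    act-hypotenuse : act g (unit d1 ⊹ unit d7) ≡ unit (next b i) ⊹ unit (next (not b) i)
    act-hypotenuse = ≡.trans (act-⊹ g (unit d1) (unit d7)) (≡.cong₂ _⊹_ act-d1 act-d7)

    act-diagonal : act g (unit d0 ⊹ unit d1) ≡ unit i ⊹ unit (next b i)
    act-diagonal = ≡.trans (act-⊹ g (unit d0) (unit d1)) (≡.cong₂ _⊹_ (act-unit g d0) act-d1)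

  act-protoL : ∀ s → mapL (act g) (protoL s) ≡ oriented s i b
  act-protoL △ = cong₃ triangle act-𝟎 act-hypotenuse act-d1
    where
    cong₃ : ∀ (f : Lat → Lat → Lat → LTile) {x x′ y y′ z z′} →
            x ≡ x′ → y ≡ y′ → z ≡ z′ → f x y z ≡ f x′ y′ z′
    cong₃ f ≡.refl ≡.refl ≡.refl = ≡.refl
  act-protoL ◇ = cong₄ rhombus act-𝟎 (act-unit g d0) act-diagonal act-d1
    where
    cong₄ : ∀ (f : Lat → Lat → Lat → Lat → LTile) {x x′ y y′ z z′ t t′} →
            x ≡ x′ → y ≡ y′ → z ≡ z′ → t ≡ t′ → f x y z t ≡ f x′ y′ z′ t′
    cong₄ f ≡.refl ≡.refl ≡.refl ≡.refl = ≡.refl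

  act-outline : ∀ s → map (act g) (outline s) ≡ orientedOutline s i b
  act-outline △ = ≡.cong₂ _∷_ act-𝟎 (≡.cong₂ _∷_ act-hypotenuse (≡.cong₂ _∷_ act-d1 (≡.cong₂ _∷_ act-d7 ≡.refl)))
  act-outline ◇ = ≡.cong₂ _∷_ act-𝟎 (≡.cong₂ _∷_ (act-unit g d0)
    (≡.cong₂ _∷_ act-diagonal (≡.cong₂ _∷_ act-d1 ≡.refl)))

-- Finite tables decided by evaluation

all-bool? : ∀ {P : Bool → Set} → (∀ b → Dec (P b)) → Dec (∀ b → P b)
all-bool? P? = map′ (λ { (f , t) false → f ; (f , t) true → t }) (λ p → p false , p true)
                    (P? false ×-dec P? true)

all-shape? : ∀ {P : Shape → Set} → (∀ s → Dec (P s)) → Dec (∀ s → P s)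
all-shape? P? = map′ (λ { (f , t) △ → f ; (f , t) ◇ → t }) (λ p → p △ , p ◇)
                     (P? △ ×-dec P? ◇)

-- The extent 1 + h of a rhombus along one of its sides is the largest extent that occurs in the
-- eight directions.
diameter : ∀ s i b → All (λ δ → All (λ δ′ → ∀ m →
  NonNeg ((1ℤ , 1ℤ) ⊟ ℓ m δ ⊞ ℓ m δ′)) (orientedOutline s i b)) (orientedOutline s i b)
diameter = toWitness {a? = all-shape? λ s → all? λ i → all-bool? λ b →
  All.all? (λ δ → All.all? (λ δ′ → all? λ m → nonNeg? ((1ℤ , 1ℤ) ⊟ ℓ m δ ⊞ ℓ m δ′))
    (orientedOutline s i b)) (orientedOutline s i b)} _

trit : Fin 3 → ℤ
trit = Vec.lookup (-1ℤ ∷ 0ℤ ∷ 1ℤ ∷ [])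

-- The seven numbers 0, ±1, ±h, ±(1 + h). By `near-value` no others satisfy |z| ≤ 3h and |conj z| <
-- 2h; the last conjunct removes ±(1 - h), whose conjugate is too large.
NearValue : Num → Set
NearValue (p , q) = (∃ λ t → p ≡ trit t) × (∃ λ t → q ≡ trit t) × ¬ (p ℤ.+ q ≡ 0ℤ × ¬ p ≡ 0ℤ)

Near : Lat → Set
Near u = ∀ m → NearValue (ℓ m u)

nearValue? : ∀ z → Dec (NearValue z)
nearValue? (p , q) = any? (λ t → p ℤₚ.≟ trit t) ×-dec any? (λ t → q ℤₚ.≟ trit t) ×-dec
  ¬? ((p ℤ.+ q ℤₚ.≟ 0ℤ) ×-dec ¬? (p ℤₚ.≟ 0ℤ))

near? : ∀ u → Dec (Near u)
near? u = all? λ m → nearValue? (ℓ m u)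

_≟L_ : (u v : Lat) → Dec (u ≡ v)
lat a b c d ≟L lat a′ b′ c′ d′ =
  map′ (λ (p , q , r , s) → lat-≡ p q r s)
       (λ e → ≡.cong Lat.a₀ e , ≡.cong Lat.a₁ e , ≡.cong Lat.a₂ e , ≡.cong Lat.a₃ e)
       (a ℤₚ.≟ a′ ×-dec b ℤₚ.≟ b′ ×-dec c ℤₚ.≟ c′ ×-dec d ℤₚ.≟ d′)

-- (√2 - 1) ζᵏ, a lattice point on the segment from 0 to ζᵏ.
spoke : Fin 8 → Lat
spoke k = mul√2 (unit k) ⊹ neg (unit k)

module _ (k : Fin 8) (t : LTile) where
  HasSpoke : Set
  HasSpoke = Any (λ (u , v) → (u ≡ 𝟎 × v ≡ unit k) ⊎ (u ≡ unit k × v ≡ 𝟎)) (sidesL t)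

  -- A separating half-plane: its boundary passes through the origin, it contains all corners of the
  -- tile, and the point `spoke k` lies strictly outside.
  AvoidsSpoke : Set
  AvoidsSpoke = ∃ λ m → Pos (ℓ m (spoke k)) × All (λ u → NonNeg (⊟ ℓ m u)) (cornersL t)

  spoke? : Dec (HasSpoke ⊎ AvoidsSpoke)
  spoke? = Any.any? (λ (u , v) → (u ≟L 𝟎 ×-dec v ≟L unit k) ⊎-dec (u ≟L unit k ×-dec v ≟L 𝟎)) (sidesL t)
    ⊎-dec any? (λ m → pos? (ℓ m (spoke k)) ×-dec All.all? (λ u → nonNeg? (⊟ ℓ m u)) (cornersL t))

-- The coefficients of a lattice vector are the rational parts of its first four inner products, so
-- a near vector is one of these 81.
box : Fin 3 → Fin 3 → Fin 3 → Fin 3 → Lat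
box a b c d = lat (trit a) (trit b) (trit c) (trit d)

-- In effect: a tile all of whose corners are near the origin is one of the
-- eight rhombi around it.
star : ∀ a b c d → Near (box a b c d) → ∀ s i o →
  All (λ δ → Near (box a b c d ⊹ δ)) (orientedOutline s i o) →
  ∀ k → HasSpoke k (mapL (box a b c d ⊹_) (oriented s i o)) ⊎
        AvoidsSpoke k (mapL (box a b c d ⊹_) (oriented s i o))
star = toWitness {a? = all? λ a → all? λ b → all? λ c → all? λ d →
  near? (box a b c d) →-dec all-shape? λ s → all? λ i → all-bool? λ o →
  All.all? (λ δ → near? (box a b c d ⊹ δ)) (orientedOutline s i o) →-dec
  all? λ k → spoke? k (mapL (box a b c d ⊹_) (oriented s i o))} _

edgeLength : Bool → Num
edgeLength false = 1ℤ , 0ℤ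
edgeLength true  = 0ℤ , + 2

-- What an overlap of two edges on a line entails, if `β` leads from base to base: the two
-- inequalities saying that the intervals overlap, and then, for each of the four pairs of ends,
-- both signs of the bound 1 + √2 on the difference of their conjugates.
overlapBounds : Num → Bool → Bool → List Num
overlapBounds β l l′ = (β ⊞ edgeLength l′) ∷ (edgeLength l ⊟ β) ∷
  (octagon ⊟ conj β) ∷ (octagon ⊞ conj β) ∷
  (octagon ⊟ conj (β ⊞ edgeLength l′)) ∷ (octagon ⊞ conj (β ⊞ edgeLength l′)) ∷
  (octagon ⊟ conj (β ⊟ edgeLength l)) ∷ (octagon ⊞ conj (β ⊟ edgeLength l)) ∷
  (octagon ⊟ conj (β ⊞ edgeLength l′ ⊟ edgeLength l)) ∷
  (octagon ⊞ conj (β ⊞ edgeLength l′ ⊟ edgeLength l)) ∷ []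

-- Nine offsets p + n√2 survive the integer bounds in `overlap-impossible`. Unless the two edges
-- coincide, one of the ten quantities fails to be positive.
no-overlap : ∀ p n l l′ →
  (trit p ≡ 0ℤ × trit n ≡ 0ℤ × l ≡ l′) ⊎
  Any (λ z → NonNeg (⊟ z)) (overlapBounds (trit p , + 2 ℤ.* trit n) l l′)
no-overlap = toWitness {a? = all? λ p → all? λ n → all-bool? λ l → all-bool? λ l′ →
  (trit p ℤₚ.≟ 0ℤ ×-dec trit n ℤₚ.≟ 0ℤ ×-dec l Boolₚ.≟ l′) ⊎-dec
  Any.any? (λ z → nonNeg? (⊟ z)) (overlapBounds (trit p , + 2 ℤ.* trit n) l l′)} _

trit-range : ∀ {p} → -[1+ 1 ] ℤ.< p → p ℤ.< + 2 → ∃ λ t → p ≡ trit t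
trit-range {+ zero}          _ _ = suc zero , ≡.refl
trit-range {+ suc zero}      _ _ = suc (suc zero) , ≡.refl
trit-range {+ suc (suc n)}   _ (ℤ.+<+ (ℕ.s≤s (ℕ.s≤s ())))
trit-range { -[1+ zero ]}    _ _ = zero , ≡.refl
trit-range { -[1+ suc zero ]} (ℤ.-<- (ℕ.s≤s ())) _
trit-range { -[1+ suc (suc n) ]} (ℤ.-<- (ℕ.s≤s ())) _

-- Division of an integer inequality by `k`; for numerals the side condition is discharged by
-- evaluation.
linear-cancel : ∀ k {a c t p} → c ℤ.< a ℤ.+ + k ℤ.* p → {True (a ℤ.+ + k ℤ.* t ℤₚ.≤? c)} → t ℤ.< p
linear-cancel k {a} {c} {t} {p} c< {≤c} = ℤₚ.≰⇒> λ p≤t →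
  ℤₚ.<⇒≱ c< (ℤₚ.≤-trans (ℤₚ.+-monoʳ-≤ a (ℤₚ.*-monoˡ-≤-nonNeg (+ k) p≤t)) (toWitness ≤c))

neg-bound : ∀ {p} k → ℤ.- k ℤ.< ℤ.- p → p ℤ.< k
neg-bound {p} k lt = ≡.subst₂ ℤ._<_ (ℤₚ.neg-involutive p) (ℤₚ.neg-involutive k) (ℤₚ.neg-mono-< lt)


⊟-swap : ∀ z w → ⊟ (z ⊟ w) ≡ w ⊟ z
⊟-swap (p , q) (p′ , q′) = ≡.cong₂ _,_ (one p p′) (one q q′)
  where
  one : ∀ a b → ℤ.- (a ℤ.- b) ≡ b ℤ.- a
  one = solve-∀

⊞-conj : ∀ c z → c ⊟ conj (⊟ z) ≡ c ⊞ conj z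
⊞-conj (a , b) (p , q) = ≡.cong₂ _,_ (≡.cong (λ x → a ℤ.+ x) (ℤₚ.neg-involutive p))
                                      (≡.cong (λ x → b ℤ.+ x) (ℤₚ.neg-involutive (ℤ.- q)))

quarter : Fin 4 → Fin 8
quarter = Vec.lookup (d2 ∷ d3 ∷ d4 ∷ d5 ∷ [])

-- A lattice vector orthogonal to iζᵐ is a multiple p + n √2 of ζᵐ.
axial : ∀ (m : Fin 4) u → ℓ (quarter m) u ≡ (0ℤ , 0ℤ) → ∃ λ n →
  proj₂ (ℓ (m ↑ˡ 4) u) ≡ + 2 ℤ.* n × (ℓ (m ↑ˡ 4) u ≡ (0ℤ , 0ℤ) → u ≡ 𝟎)
axial = λ where
    d0 (lat a b c d) e → b
      , double b d (≡.cong proj₂ e)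
      , λ e′ → lat-≡ (≡.cong proj₁ e′) (both b d (≡.cong proj₂ e) (≡.cong proj₂ e′))
                     (≡.cong proj₁ e) (both′ b d (≡.cong proj₂ e) (≡.cong proj₂ e′))
    d1 (lat a b c d) e → a
      , double₊ a c (≡.cong proj₂ e)
      , λ e′ → lat-≡ (both a c (≡.cong proj₂ e′) (flip c a (≡.cong proj₂ e))) (≡.cong proj₁ e′)
                     (both′ a c (≡.cong proj₂ e′) (flip c a (≡.cong proj₂ e))) (≡.cong proj₁ e)
    d2 (lat a b c d) e → b
      , double₊ b d (flip b d (unneg (≡.cong proj₂ e)))
      , λ e′ → lat-≡ (unneg (≡.cong proj₁ e)) (both b d (≡.cong proj₂ e′) (unneg (≡.cong proj₂ e)))
                     (≡.cong proj₁ e′) (both′ b d (≡.cong proj₂ e′) (unneg (≡.cong proj₂ e)))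
    d3 (lat a b c d) e → c
      , double c a (≡.trans (ℤₚ.+-comm c a) (unneg (≡.cong proj₂ e)))
      , λ e′ → lat-≡ (both a c (unneg (≡.cong proj₂ e)) (flip c a (≡.cong proj₂ e′))) (unneg (≡.cong proj₁ e))
                     (both′ a c (unneg (≡.cong proj₂ e)) (flip c a (≡.cong proj₂ e′))) (≡.cong proj₁ e′)
  where
  unneg : ∀ {x} → ℤ.- x ≡ 0ℤ → x ≡ 0ℤ
  unneg {x} e = ≡.trans (≡.sym (ℤₚ.neg-involutive x)) (≡.cong ℤ.-_ e)
  flip : ∀ x y → x ℤ.- y ≡ 0ℤ → y ℤ.- x ≡ 0ℤ
  flip x y e = ≡.trans (f x y) (≡.cong ℤ.-_ e)
    where f : ∀ x y → y ℤ.- x ≡ ℤ.- (x ℤ.- y)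
          f = solve-∀
  double : ∀ x y → x ℤ.+ y ≡ 0ℤ → x ℤ.- y ≡ + 2 ℤ.* x
  double x y e = ≡.trans (f x y) (≡.trans (≡.cong (λ z → + 2 ℤ.* x ℤ.- z) e) (ℤₚ.+-identityʳ _))
    where f : ∀ x y → x ℤ.- y ≡ + 2 ℤ.* x ℤ.- (x ℤ.+ y)
          f = solve-∀
  double₊ : ∀ x y → y ℤ.- x ≡ 0ℤ → x ℤ.+ y ≡ + 2 ℤ.* x
  double₊ x y e = ≡.trans (f x y) (≡.trans (≡.cong (λ z → + 2 ℤ.* x ℤ.+ z) e) (ℤₚ.+-identityʳ _))
    where f : ∀ x y → x ℤ.+ y ≡ + 2 ℤ.* x ℤ.+ (y ℤ.- x)
          f = solve-∀
  both : ∀ x y → x ℤ.+ y ≡ 0ℤ → x ℤ.- y ≡ 0ℤ → x ≡ 0ℤ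
  both x y e e′ = ℤₚ.*-cancelˡ-≡ (+ 2) x 0ℤ (≡.trans (f x y) (≡.cong₂ ℤ._+_ e e′))
    where f : ∀ x y → + 2 ℤ.* x ≡ (x ℤ.+ y) ℤ.+ (x ℤ.- y)
          f = solve-∀
  both′ : ∀ x y → x ℤ.+ y ≡ 0ℤ → x ℤ.- y ≡ 0ℤ → y ≡ 0ℤ
  both′ x y e e′ = ℤₚ.*-cancelˡ-≡ (+ 2) y 0ℤ (≡.trans (f x y) (≡.cong₂ ℤ._-_ e e′))
    where f : ∀ x y → + 2 ℤ.* y ≡ (x ℤ.+ y) ℤ.- (x ℤ.- y)
          f = solve-∀

ℓ-neg : ∀ m u → ℓ m (neg u) ≡ ⊟ ℓ m u
ℓ-neg m u = ≡.trans (unique (ℓ m u) (ℓ m (neg u)) (≡.trans (≡.sym (ℓ-⊹ m u (neg u)))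
  (≡.trans (≡.cong (ℓ m) (⊹-inverseʳ u)) (ℓ-𝟎 m)))) ≡.refl
  where
  ℓ-𝟎 : ∀ m → ℓ m 𝟎 ≡ (0ℤ , 0ℤ)
  ℓ-𝟎 = toWitness {a? = all? λ m → ≡-dec ℤₚ._≟_ ℤₚ._≟_ (ℓ m 𝟎) (0ℤ , 0ℤ)} _
  one : ∀ p q → p ℤ.+ q ≡ 0ℤ → q ≡ ℤ.- p
  one p q e = ≡.trans (f p q) (≡.trans (≡.cong (ℤ._- p) e) (ℤₚ.+-identityˡ _))
    where f : ∀ p q → q ≡ (p ℤ.+ q) ℤ.- p
          f = solve-∀
  unique : ∀ z w → z ⊞ w ≡ (0ℤ , 0ℤ) → w ≡ ⊟ z
  unique (p , q) (p′ , q′) e = ≡.cong₂ _,_ (one p p′ (≡.cong proj₁ e)) (one q q′ (≡.cong proj₂ e))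


-- Integers and signs in the ordered field

module OrderedField (R : CompleteOrderedField) (ρ : RootTwo R) where
  open CompleteOrderedField R hiding (zero)
  open RootTwo ρ
  open ToStrict _≈_ _≤_ using (_<_)
  open IsTotalOrder isTotalOrder using (antisym; total; ≤-respˡ-≈; ≤-respʳ-≈)
    renaming (trans to ≤-trans; refl to ≤-refl; reflexive to ≤-reflexive)
  open import Algebra.Properties.Ring ring
    using (-‿+-comm; -‿distribˡ-*; -‿distribʳ-*; -0#≈0#; -‿involutive)
  open import Relation.Binary.Reasoning.Setoid setoid

  -- The separate clause for 1 makes `ι` send 1 and 2 to `1#` and `1# + 1#` definitionally, so that
  -- the numerals of the solver match those in the definitions of the tiles.
  ιℕ : ℕ → Carrier
  ιℕ zero          = 0#
  ιℕ (suc zero)    = 1#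
  ιℕ (suc (suc n)) = ιℕ (suc n) + 1#

  ι : ℤ → Carrier
  ι (+ n)      = ιℕ n
  ι (-[1+ n ]) = - ιℕ (suc n)

  ιℕ-suc : ∀ n → ιℕ (suc n) ≈ ιℕ n + 1#
  ιℕ-suc zero    = sym (+-identityˡ 1#)
  ιℕ-suc (suc n) = refl

  ιℕ-+ : ∀ m n → ιℕ (m ℕ.+ n) ≈ ιℕ m + ιℕ n
  ιℕ-+ zero    n = sym (+-identityˡ _)
  ιℕ-+ (suc m) n = begin
    ιℕ (suc (m ℕ.+ n))      ≈⟨ ιℕ-suc (m ℕ.+ n) ⟩
    ιℕ (m ℕ.+ n) + 1#       ≈⟨ +-congʳ (ιℕ-+ m n) ⟩
    ιℕ m + ιℕ n + 1#        ≈⟨ +-assoc _ _ _ ⟩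
    ιℕ m + (ιℕ n + 1#)      ≈⟨ +-congˡ (+-comm _ _) ⟩
    ιℕ m + (1# + ιℕ n)      ≈⟨ +-assoc _ _ _ ⟨
    ιℕ m + 1# + ιℕ n        ≈⟨ +-congʳ (ιℕ-suc m) ⟨
    ιℕ (suc m) + ιℕ n       ∎

  ιℕ-* : ∀ m n → ιℕ (m ℕ.* n) ≈ ιℕ m * ιℕ n
  ιℕ-* zero    n = sym (zeroˡ _)
  ιℕ-* (suc m) n = begin
    ιℕ (n ℕ.+ m ℕ.* n)        ≈⟨ ιℕ-+ n (m ℕ.* n) ⟩
    ιℕ n + ιℕ (m ℕ.* n)       ≈⟨ +-cong (sym (*-identityˡ _)) (ιℕ-* m n) ⟩
    1# * ιℕ n + ιℕ m * ιℕ n   ≈⟨ distribʳ _ _ _ ⟨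
    (1# + ιℕ m) * ιℕ n        ≈⟨ *-congʳ (trans (+-comm _ _) (sym (ιℕ-suc m))) ⟩
    ιℕ (suc m) * ιℕ n         ∎

  ι-neg : ∀ i → ι (ℤ.- i) ≈ - ι i
  ι-neg (+ zero)   = sym -0#≈0#
  ι-neg (+ suc n)  = refl
  ι-neg (-[1+ n ]) = sym (-‿involutive _)

  ι-⊖ : ∀ m n → ι (m ℤ.⊖ n) ≈ ιℕ m - ιℕ n
  ι-⊖ m zero = trans (sym (+-identityʳ _)) (+-congˡ (sym -0#≈0#))
  ι-⊖ zero (suc n) = sym (+-identityˡ _)
  ι-⊖ (suc m) (suc n) = begin
    ι (suc m ℤ.⊖ suc n)          ≈⟨ reflexive (≡.cong ι (ℤₚ.[1+m]⊖[1+n]≡m⊖n m n)) ⟩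
    ι (m ℤ.⊖ n)                  ≈⟨ ι-⊖ m n ⟩
    ιℕ m - ιℕ n                  ≈⟨ +-congʳ (+-identityʳ _) ⟨
    ιℕ m + 0# - ιℕ n             ≈⟨ +-congʳ (+-congˡ (-‿inverseʳ 1#)) ⟨
    ιℕ m + (1# - 1#) - ιℕ n      ≈⟨ +-congʳ (+-assoc _ _ _) ⟨
    ιℕ m + 1# - 1# - ιℕ n        ≈⟨ +-assoc _ _ _ ⟩
    ιℕ m + 1# + (- 1# - ιℕ n)    ≈⟨ +-congˡ (trans (+-comm _ _) (-‿+-comm _ _)) ⟩
    ιℕ m + 1# - (ιℕ n + 1#)      ≈⟨ +-cong (ιℕ-suc m) (-‿cong (ιℕ-suc n)) ⟨
    ιℕ (suc m) - ιℕ (suc n)      ∎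

  ι-+ : ∀ i j → ι (i ℤ.+ j) ≈ ι i + ι j
  ι-+ (+ m)      (+ n)      = ιℕ-+ m n
  ι-+ (+ m)      (-[1+ n ]) = ι-⊖ m (suc n)
  ι-+ (-[1+ m ]) (+ n)      = trans (ι-⊖ n (suc m)) (+-comm _ _)
  ι-+ (-[1+ m ]) (-[1+ n ]) = begin
    - ιℕ (suc (suc (m ℕ.+ n)))     ≈⟨ -‿cong (reflexive (≡.cong ιℕ (≡.sym (ℕₚ.+-suc (suc m) n)))) ⟩
    - ιℕ (suc m ℕ.+ suc n)         ≈⟨ -‿cong (ιℕ-+ (suc m) (suc n)) ⟩
    - (ιℕ (suc m) + ιℕ (suc n))    ≈⟨ -‿+-comm _ _ ⟨
    - ιℕ (suc m) - ιℕ (suc n)      ∎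

  ι-*-pos : ∀ m j → ι (+ m ℤ.* j) ≈ ιℕ m * ι j
  ι-*-pos m (+ n) = trans (reflexive (≡.cong ι (≡.sym (ℤₚ.pos-* m n)))) (ιℕ-* m n)
  ι-*-pos m (-[1+ n ]) = begin
    ι (+ m ℤ.* -[1+ n ])            ≈⟨ reflexive (≡.cong ι (≡.sym (ℤₚ.neg-distribʳ-* (+ m) (+ suc n)))) ⟩
    ι (ℤ.- (+ m ℤ.* + suc n))       ≈⟨ ι-neg (+ m ℤ.* + suc n) ⟩
    - ι (+ m ℤ.* + suc n)           ≈⟨ -‿cong (ι-*-pos m (+ suc n)) ⟩
    - (ιℕ m * ιℕ (suc n))           ≈⟨ -‿distribʳ-* _ _ ⟩
    ιℕ m * - ιℕ (suc n)             ∎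

  ι-* : ∀ i j → ι (i ℤ.* j) ≈ ι i * ι j
  ι-* (+ m)      j = ι-*-pos m j
  ι-* (-[1+ m ]) j = begin
    ι (-[1+ m ] ℤ.* j)         ≈⟨ reflexive (≡.cong ι (≡.sym (ℤₚ.neg-distribˡ-* (+ suc m) j))) ⟩
    ι (ℤ.- (+ suc m ℤ.* j))    ≈⟨ ι-neg (+ suc m ℤ.* j) ⟩
    - ι (+ suc m ℤ.* j)        ≈⟨ -‿cong (ι-*-pos (suc m) j) ⟩
    - (ιℕ (suc m) * ι j)       ≈⟨ -‿distribˡ-* _ _ ⟩
    - ιℕ (suc m) * ι j         ∎

  ι-weakly≟ : ∀ i j → Maybe (ι i ≈ ι j)
  ι-weakly≟ i j with i ℤₚ.≟ j
  ... | yes e = just (reflexive (≡.cong ι e))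
  ... | no _  = nothing

  ι-morphism : ℤ.+-*-rawRing -Raw-AlmostCommutative⟶ fromCommutativeRing commutativeRing
  ι-morphism = record
    { ⟦_⟧    = ι
    ; +-homo = ι-+
    ; *-homo = ι-*
    ; -‿homo = ι-neg
    ; 0-homo = refl
    ; 1-homo = refl
    }

  module Solver = RingSolver ℤ.+-*-rawRing (fromCommutativeRing commutativeRing) ι-morphism ι-weakly≟
  open Solver using (solve; _:=_; _:+_; _:*_; _:-_; :-_; con)

  Nonneg Positive : Carrier → Set
  Nonneg x = 0# ≤ x
  Positive x = 0# < x

  nonneg-resp : ∀ {x y} → x ≈ y → Nonneg x → Nonneg y
  nonneg-resp = ≤-respʳ-≈

  positive-resp : ∀ {x y} → x ≈ y → Positive x → Positive y
  positive-resp x≈y (0≤x , 0≉x) = nonneg-resp x≈y 0≤x , λ 0≈y → 0≉x (trans 0≈y (sym x≈y))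

  ≤⇒nonneg : ∀ {x y} → x ≤ y → Nonneg (y - x)
  ≤⇒nonneg {x} {y} x≤y = ≤-respˡ-≈ (-‿inverseʳ x) (+-monoˡ-≤ (- x) x≤y)

  nonneg⇒≤ : ∀ {x y} → Nonneg (y - x) → x ≤ y
  nonneg⇒≤ {x} {y} p = ≤-respˡ-≈ (+-identityˡ x)
    (≤-respʳ-≈ (solve 2 (λ x y → (y :- x) :+ x := y) refl x y) (+-monoˡ-≤ x p))

  +-nonneg : ∀ {x y} → Nonneg x → Nonneg y → Nonneg (x + y)
  +-nonneg {x} {y} p q = ≤-trans q (≤-respˡ-≈ (+-identityˡ y) (+-monoˡ-≤ y p))

  nonneg-neg⇒≈0 : ∀ {x} → Nonneg x → Nonneg (- x) → x ≈ 0#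
  nonneg-neg⇒≈0 {x} p q = antisym (nonneg⇒≤ (nonneg-resp (sym (+-identityˡ _)) q)) p

  +-positive : ∀ {x y} → Positive x → Nonneg y → Positive (x + y)
  +-positive {x} {y} (p , ne) q = +-nonneg p q , λ e → ne (sym (nonneg-neg⇒≈0 p
    (nonneg-resp (trans (solve 2 (λ x y → y := (x :+ y) :- x) refl x y)
                  (trans (+-congʳ (sym e)) (+-identityˡ _))) q)))

  nonneg? : ∀ x → Nonneg x ⊎ Nonneg (- x)
  nonneg? x with total 0# x
  ... | inj₁ p = inj₁ p
  ... | inj₂ p = inj₂ (nonneg-resp (+-identityˡ _) (≤⇒nonneg p))

  ¬nonneg-neg⇒positive : ∀ {x} → ¬ Nonneg (- x) → Positive x
  ¬nonneg-neg⇒positive {x} n with nonneg? x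
  ... | inj₁ p = p , λ e → n (≤-reflexive (sym (trans (-‿cong (sym e)) -0#≈0#)))
  ... | inj₂ p = contradiction p n

  positive⇒¬nonneg-neg : ∀ {x} → Positive x → ¬ Nonneg (- x)
  positive⇒¬nonneg-neg (p , ne) q = ne (sym (nonneg-neg⇒≈0 p q))

  square-nonneg : ∀ x → Nonneg (x * x)
  square-nonneg x with nonneg? x
  ... | inj₁ p = *-nonNeg p p
  ... | inj₂ p = nonneg-resp (solve 1 (λ x → (:- x) :* (:- x) := x :* x) refl x) (*-nonNeg p p)

  *-cancel-≈0 : ∀ {x y} → x * y ≈ 0# → ¬ y ≈ 0# → x ≈ 0#
  *-cancel-≈0 {x} {y} e y≉0 with inverse y y≉0
  ... | z , yz≈1 = begin
    x            ≈⟨ *-identityʳ x ⟨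
    x * 1#       ≈⟨ *-congˡ yz≈1 ⟨
    x * (y * z)  ≈⟨ *-assoc _ _ _ ⟨
    x * y * z    ≈⟨ *-congʳ e ⟩
    0# * z       ≈⟨ zeroˡ z ⟩
    0#           ∎

  *-positive : ∀ {x y} → Positive x → Positive y → Positive (x * y)
  *-positive (p , x≉0) (q , y≉0) =
    *-nonNeg p q , λ e → x≉0 (sym (*-cancel-≈0 (sym e) (y≉0 ∘ sym)))

  *-cancel-nonneg : ∀ {x y} → Positive y → Nonneg (x * y) → Nonneg x
  *-cancel-nonneg {x} {y} py p with nonneg? x
  ... | inj₁ q = q
  ... | inj₂ q = ≤-reflexive (sym (*-cancel-≈0
          (nonneg-neg⇒≈0 p (nonneg-resp (solve 2 (λ x y → :- x :* y := :- (x :* y)) refl x y)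
            (*-nonNeg q (proj₁ py))))
          (proj₂ py ∘ sym)))

  *-cancel-positive : ∀ {x y} → Positive y → Positive (x * y) → Positive x
  *-cancel-positive {x} {y} py (p , ne) =
    *-cancel-nonneg py p , λ e → ne (sym (trans (*-congʳ (sym e)) (zeroˡ y)))

  1-positive : Positive 1#
  1-positive = nonneg-resp (*-identityˡ 1#) (square-nonneg 1#) , 1≉0 ∘ sym

  ιℕ-nonneg : ∀ n → Nonneg (ιℕ n)
  ιℕ-nonneg zero    = ≤-refl
  ιℕ-nonneg (suc n) = nonneg-resp (sym (ιℕ-suc n)) (+-nonneg (ιℕ-nonneg n) (proj₁ 1-positive))

  ι-nonneg : ∀ {i} → 0ℤ ℤ.≤ i → Nonneg (ι i)
  ι-nonneg {+ n} _ = ιℕ-nonneg n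

  ι-positive : ∀ {i} → 0ℤ ℤ.< i → Positive (ι i)
  ι-positive {+ suc n} _ = positive-resp (trans (+-comm _ _) (sym (ιℕ-suc n)))
    (+-positive 1-positive (ιℕ-nonneg n))
  ι-positive {+ zero} (ℤ.+<+ ())

  2-positive : Positive (1# + 1#)
  2-positive = ι-positive {+ 2} (ℤ.+<+ (ℕ.s≤s ℕ.z≤n))

  halve-nonneg : ∀ {x} → Nonneg (x + x) → Nonneg x
  halve-nonneg {x} p = *-cancel-nonneg 2-positive
    (nonneg-resp (solve 1 (λ x → x :+ x := x :* con (+ 2)) refl x) p)

  halve-positive : ∀ {x} → Positive (x + x) → Positive x
  halve-positive {x} p = *-cancel-positive 2-positive
    (positive-resp (solve 1 (λ x → x :+ x := x :* con (+ 2)) refl x) p)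

  halve-≈0 : ∀ {x} → x + x ≈ 0# → x ≈ 0#
  halve-≈0 {x} e = *-cancel-≈0 (trans (solve 1 (λ x → x :* con (+ 2) := x :+ x) refl x) e)
                               (proj₂ 2-positive ∘ sym)

  2hh≈1 : h * h + h * h ≈ 1#
  2hh≈1 = trans (solve 1 (λ x → x := (x :- con 1ℤ) :+ con 1ℤ) refl _)
    (trans (+-congʳ (halve-≈0 (begin
      (h * h + h * h - 1#) + (h * h + h * h - 1#)
        ≈⟨ solve 1 (λ h → (h :* h :+ h :* h :- con 1ℤ) :+ (h :* h :+ h :* h :- con 1ℤ) :=
                          (h :+ h) :* (h :+ h) :- con (+ 2)) refl h ⟩
      (h + h) * (h + h) - (1# + 1#)
        ≈⟨ +-congʳ (trans (*-cong h+h≈√2 h+h≈√2) √2*√2≈2) ⟩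
      (1# + 1#) - (1# + 1#)
        ≈⟨ -‿inverseʳ _ ⟩
      0# ∎))) (+-identityˡ 1#))

  h-nonneg : Nonneg h
  h-nonneg = halve-nonneg (nonneg-resp (sym h+h≈√2) 0≤√2)

  -1-not-nonneg : ∀ {x} → x ≈ - 1# → ¬ Nonneg x
  -1-not-nonneg e p = positive⇒¬nonneg-neg 1-positive (nonneg-resp e p)

  -- Since 2h² = 1, twice (7h - 5)(7h + 5) equals 49 - 50 = -1, so 7h - 5 cannot be nonnegative.
  h-upper : Positive (ι (+ 5) - ι (+ 7) * h)
  h-upper = ¬nonneg-neg⇒positive λ p → -1-not-nonneg
    (begin
      (- (ι (+ 5) - ι (+ 7) * h) * (ι (+ 7) * h + ι (+ 5))) * (1# + 1#)
        ≈⟨ solve 1 (λ h → (:- (con (+ 5) :- con (+ 7) :* h) :* (con (+ 7) :* h :+ con (+ 5))) :* con (+ 2) :=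
             con (+ 49) :* (h :* h :+ h :* h) :- con (+ 50)) refl h ⟩
      ι (+ 49) * (h * h + h * h) - ι (+ 50)  ≈⟨ +-congʳ (*-congˡ 2hh≈1) ⟩
      ι (+ 49) * 1# - ι (+ 50)
        ≈⟨ solve 0 (con (+ 49) :* con 1ℤ :- con (+ 50) := con (-[1+ 0 ])) refl ⟩
      - 1# ∎)
    (*-nonNeg (*-nonNeg p (+-nonneg (*-nonNeg (ι-nonneg {+ 7} (ℤ.+≤+ ℕ.z≤n)) h-nonneg)
                                    (ι-nonneg {+ 5} (ℤ.+≤+ ℕ.z≤n))))
              (proj₁ 2-positive))

  -- Twice (12 - 17h)(12 + 17h) equals 288 - 289 = -1.
  h-lower : Positive (ι (+ 17) * h - ι (+ 12))
  h-lower = ¬nonneg-neg⇒positive λ p → -1-not-nonneg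
    (begin
      (- (ι (+ 17) * h - ι (+ 12)) * (ι (+ 17) * h + ι (+ 12))) * (1# + 1#)
        ≈⟨ solve 1 (λ h → (:- (con (+ 17) :* h :- con (+ 12)) :* (con (+ 17) :* h :+ con (+ 12))) :* con (+ 2) :=
             con (+ 288) :- con (+ 289) :* (h :* h :+ h :* h)) refl h ⟩
      ι (+ 288) - ι (+ 289) * (h * h + h * h)  ≈⟨ +-congˡ (-‿cong (*-congˡ 2hh≈1)) ⟩
      ι (+ 288) - ι (+ 289) * 1#
        ≈⟨ solve 0 (con (+ 288) :- con (+ 289) :* con 1ℤ := con (-[1+ 0 ])) refl ⟩
      - 1# ∎)
    (*-nonNeg (*-nonNeg p (+-nonneg (*-nonNeg (ι-nonneg {+ 17} (ℤ.+≤+ ℕ.z≤n)) h-nonneg)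
                                    (ι-nonneg {+ 12} (ℤ.+≤+ ℕ.z≤n))))
              (proj₁ 2-positive))

  -- Only the double negation is constructive here: `x` is cancelled under the assumption that it is
  -- nonzero. Excluded middle removes the negations in `dot-self-≈0`.
  square-sum-≈0 : ∀ {x y} → x * x + y * y ≈ 0# → ¬ ¬ (x ≈ 0#)
  square-sum-≈0 {x} {y} e x≉0 = x≉0 (*-cancel-≈0 (nonneg-neg⇒≈0 (square-nonneg x)
    (nonneg-resp (trans (solve 2 (λ x y → y := (x :+ y) :- x) refl (x * x) (y * y))
                        (trans (+-congʳ e) (+-identityˡ _))) (square-nonneg y))) x≉0)

  -- Evaluation of p + q h in the field

  ev : Num → Carrier
  ev (p , q) = ι p + ι q * h

  ev-cong : ∀ {z w} → z ≡ w → ev z ≈ ev w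
  ev-cong e = reflexive (≡.cong ev e)

  ι-- : ∀ i j → ι (i ℤ.- j) ≈ ι i - ι j
  ι-- i j = trans (ι-+ i (ℤ.- j)) (+-congˡ (ι-neg j))

  ev-⊞ : ∀ z w → ev (z ⊞ w) ≈ ev z + ev w
  ev-⊞ (p , q) (p′ , q′) = trans (+-cong (ι-+ p p′) (*-congʳ (ι-+ q q′)))
    (solve 5 (λ p q p′ q′ h → (p :+ p′) :+ (q :+ q′) :* h := (p :+ q :* h) :+ (p′ :+ q′ :* h))
      refl (ι p) (ι q) (ι p′) (ι q′) h)

  ev-⊟ : ∀ z w → ev (z ⊟ w) ≈ ev z - ev w
  ev-⊟ (p , q) (p′ , q′) = trans (+-cong (ι-- p p′) (*-congʳ (ι-- q q′)))
    (solve 5 (λ p q p′ q′ h → (p :- p′) :+ (q :- q′) :* h := (p :+ q :* h) :- (p′ :+ q′ :* h))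
      refl (ι p) (ι q) (ι p′) (ι q′) h)

  ev-neg : ∀ z → ev (⊟ z) ≈ - ev z
  ev-neg (p , q) = trans (+-cong (ι-neg p) (*-congʳ (ι-neg q)))
    (solve 3 (λ p q h → :- p :+ :- q :* h := :- (p :+ q :* h)) refl (ι p) (ι q) h)

  ev-twice : ∀ z → ev (twice z) ≈ ev z + ev z
  ev-twice (p , q) = trans (+-cong (ι-* (+ 2) p) (*-congʳ (ι-* (+ 2) q)))
    (solve 3 (λ p q h → con (+ 2) :* p :+ con (+ 2) :* q :* h := (p :+ q :* h) :+ (p :+ q :* h))
      refl (ι p) (ι q) h)

  ev-mul√2 : ∀ z → ev (mul√2ₙ z) ≈ √2 * ev z
  ev-mul√2 (p , q) = begin
    ι q + ι (+ 2 ℤ.* p) * h                       ≈⟨ +-cong (sym (*-identityʳ _)) (*-congʳ (ι-* (+ 2) p)) ⟩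
    ι q * 1# + ι (+ 2) * ι p * h                  ≈⟨ +-congʳ (*-congˡ 2hh≈1) ⟨
    ι q * (h * h + h * h) + ι (+ 2) * ι p * h
      ≈⟨ solve 3 (λ p q h → q :* (h :* h :+ h :* h) :+ con (+ 2) :* p :* h := (h :+ h) :* (p :+ q :* h))
           refl (ι p) (ι q) h ⟩
    (h + h) * (ι p + ι q * h)                     ≈⟨ *-congʳ h+h≈√2 ⟩
    √2 * (ι p + ι q * h)                          ∎

  ev-mulμ : ∀ z → ev (mulμ z) ≈ (h + h - 1#) * ev z
  ev-mulμ (p , q) = begin
    ι (q ℤ.- p) + ι (+ 2 ℤ.* p ℤ.- q) * h
      ≈⟨ +-cong (ι-- q p) (*-congʳ (trans (ι-- (+ 2 ℤ.* p) q) (+-congʳ (ι-* (+ 2) p)))) ⟩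
    (ι q - ι p) + (ι (+ 2) * ι p - ι q) * h
      ≈⟨ solve 3 (λ p q h → (q :- p) :+ (con (+ 2) :* p :- q) :* h :=
                            q :* con 1ℤ :+ ((con (+ 2) :* p :- q) :* h :- p)) refl (ι p) (ι q) h ⟩
    ι q * 1# + ((ι (+ 2) * ι p - ι q) * h - ι p)
      ≈⟨ +-congʳ (*-congˡ 2hh≈1) ⟨
    ι q * (h * h + h * h) + ((ι (+ 2) * ι p - ι q) * h - ι p)
      ≈⟨ solve 3 (λ p q h → q :* (h :* h :+ h :* h) :+ ((con (+ 2) :* p :- q) :* h :- p) :=
                            (h :+ h :- con 1ℤ) :* (p :+ q :* h)) refl (ι p) (ι q) h ⟩
    (h + h - 1#) * (ι p + ι q * h) ∎

  -- The matrix with rows (17, 12) and (7, 5) has determinant 1; its inverse supplies the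
  -- coefficients 5 - 7h and 17h - 12, both positive.
  ev-positive : ∀ {z} → Pos z → Positive (ev z)
  ev-positive {p , q} (pos a b) = positive-resp
    (begin
      ι (+ 17 ℤ.* p ℤ.+ + 12 ℤ.* q) * (ι (+ 5) - ι (+ 7) * h) +
      ι (+ 7 ℤ.* p ℤ.+ + 5 ℤ.* q) * (ι (+ 17) * h - ι (+ 12))
        ≈⟨ +-cong (*-congʳ (expand (+ 17) (+ 12))) (*-congʳ (expand (+ 7) (+ 5))) ⟩
      (ι (+ 17) * ι p + ι (+ 12) * ι q) * (ι (+ 5) - ι (+ 7) * h) +
      (ι (+ 7) * ι p + ι (+ 5) * ι q) * (ι (+ 17) * h - ι (+ 12))
        ≈⟨ solve 3 (λ p q h →
             (con (+ 17) :* p :+ con (+ 12) :* q) :* (con (+ 5) :- con (+ 7) :* h) :+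
             (con (+ 7) :* p :+ con (+ 5) :* q) :* (con (+ 17) :* h :- con (+ 12)) :=
             p :+ q :* h) refl (ι p) (ι q) h ⟩
      ι p + ι q * h ∎)
    (+-positive (*-positive (ι-positive a) h-upper) (proj₁ (*-positive (ι-positive b) h-lower)))
    where
    expand : ∀ m n → ι (m ℤ.* p ℤ.+ n ℤ.* q) ≈ ι m * ι p + ι n * ι q
    expand m n = trans (ι-+ (m ℤ.* p) (n ℤ.* q)) (+-cong (ι-* m p) (ι-* n q))

  ev-nonneg : ∀ {z} → NonNeg z → Nonneg (ev z)
  ev-nonneg (inj₁ ≡.refl) = ≤-reflexive (solve 1 (λ h → con 0ℤ := con 0ℤ :+ con 0ℤ :* h) refl h)
  ev-nonneg (inj₂ p)      = proj₁ (ev-positive p)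

  positive⇒¬NonNeg : ∀ {z} → Positive (ev z) → ¬ NonNeg (⊟ z)
  positive⇒¬NonNeg {z} p n = positive⇒¬nonneg-neg p (nonneg-resp (ev-neg z) (ev-nonneg n))

  ≈0⇒¬Apart : ∀ {z} → ev z ≈ 0# → ¬ Apart z
  ≈0⇒¬Apart     e (inj₁ p) = proj₂ (ev-positive p) (sym e)
  ≈0⇒¬Apart {z} e (inj₂ p) = proj₂ (ev-positive p) (sym (trans (ev-neg z) (trans (-‿cong e) -0#≈0#)))

  h-positive : Positive h
  h-positive = positive-resp (solve 1 (λ h → con 0ℤ :+ con 1ℤ :* h := h) refl h)
    (ev-positive {0ℤ , 1ℤ} (pos (ℤ.+<+ (ℕ.s≤s ℕ.z≤n)) (ℤ.+<+ (ℕ.s≤s ℕ.z≤n))))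

  -- Turns a sign in the field into an integer bound: p + b h increases with p, and it is already
  -- negative at p = c.
  bound₁ : ∀ {a b} c → Positive (ev (a , b)) → Pos (⊟ (c , b)) → c ℤ.< a
  bound₁ {a} {b} c p n with c ℤₚ.<? a
  ... | yes q = q
  ... | no ¬q = contradiction
    (nonneg-resp
      (begin
        ev (⊟ (c , b)) + ι (c ℤ.- a)    ≈⟨ +-cong (ev-neg (c , b)) (ι-- c a) ⟩
        - (ι c + ι b * h) + (ι c - ι a)
          ≈⟨ solve 4 (λ a b c h → :- (c :+ b :* h) :+ (c :- a) := :- (a :+ b :* h)) refl (ι a) (ι b) (ι c) h ⟩
        - (ι a + ι b * h)               ∎)
      (+-nonneg (proj₁ (ev-positive n)) (ι-nonneg (ℤₚ.i≤j⇒0≤j-i (ℤₚ.≮⇒≥ ¬q)))))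
    (positive⇒¬nonneg-neg p)

  -- The same for the second coefficient, as h is nonnegative.
  bound₂ : ∀ {a b} c → Positive (ev (a , b)) → Pos (⊟ (a , c)) → c ℤ.< b
  bound₂ {a} {b} c p n with c ℤₚ.<? b
  ... | yes q = q
  ... | no ¬q = contradiction
    (nonneg-resp
      (begin
        ev (⊟ (a , c)) + ι (c ℤ.- b) * h    ≈⟨ +-cong (ev-neg (a , c)) (*-congʳ (ι-- c b)) ⟩
        - (ι a + ι c * h) + (ι c - ι b) * h
          ≈⟨ solve 4 (λ a b c h → :- (a :+ c :* h) :+ (c :- b) :* h := :- (a :+ b :* h)) refl (ι a) (ι b) (ι c) h ⟩
        - (ι a + ι b * h)               ∎)
      (+-nonneg (proj₁ (ev-positive n)) (*-nonNeg (ι-nonneg (ℤₚ.i≤j⇒0≤j-i (ℤₚ.≮⇒≥ ¬q))) h-nonneg)))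
    (positive⇒¬nonneg-neg p)

module Tilings (em : ExcludedMiddle 0ℓ) (R : CompleteOrderedField) (ρ : RootTwo R) where
  open CompleteOrderedField R hiding (zero)
  open RootTwo ρ
  open AmmannBeenker R ρ
  open OrderedField R ρ
  open Solver using (solve; _:=_; _:+_; _:*_; _:-_; :-_; con)
  open IsTotalOrder isTotalOrder using (antisym; total; ≤-respˡ-≈; ≤-respʳ-≈)
    renaming (trans to ≤-trans; refl to ≤-refl; reflexive to ≤-reflexive)
  open import Algebra.Properties.Ring ring using (-0#≈0#)
  open import Algebra.Properties.Monoid.Sum +-monoid using (sum)

  -- Frames and the substitution

  InOctagon : Lat → Set
  InOctagon u = ∀ m → Positive (ev (slack octagon m u))

  InWindow : Shape → Lat → Set
  InWindow s u = ∀ m → Positive (ev (slack (window s m) m u))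

  -- The slack of a child is √2 - 1 times a slack of its parent plus a nonnegative constant, so
  -- strict positivity is inherited.
  childPosition-inWindow : ∀ s {u} → InWindow s u →
    All (λ c → InWindow (Child.shapeᶜ c) (childPosition c u)) (children s)
  childPosition-inWindow s {u} win = All.map
    (λ {c} nn m → positive-resp
       (sym (trans (ev-cong (childSlack-step s c m u))
            (trans (ev-⊞ (mulμ (slack (window s (m′ c m)) (m′ c m) u)) (childSlack s c m))
                   (+-congʳ (ev-mulμ (slack (window s (m′ c m)) (m′ c m) u))))))
       (+-positive (*-positive μ-positive (win (m′ c m))) (ev-nonneg (nn m))))
    (childSlack-nonNeg s)
    where
    m′ : Child → Fin 8 → Fin 8
    m′ c m = opp (actDir (Child.symᶜ c) m)
    μ-positive : Positive (h + h - 1#)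
    μ-positive = positive-resp
      (solve 1 (λ h → con -1ℤ :+ con (+ 2) :* h := h :+ h :- con 1ℤ) refl h)
      (ev-positive { -1ℤ , + 2} (pos (ℤ.+<+ (ℕ.s≤s ℕ.z≤n)) (ℤ.+<+ (ℕ.s≤s ℕ.z≤n))))

  outline-inOctagon : ∀ s {u} → InWindow s u → All (λ δ → InOctagon (u ⊹ δ)) (outline s)
  outline-inOctagon s {u} win = All.map
    (λ {δ} nn m → positive-resp
       (sym (trans (ev-cong (slack-⊹ octagon (window s m) m u δ))
                   (ev-⊞ (slack (window s m) m u) (slack octagon m δ ⊟ window s m))))
       (+-positive (win m) (ev-nonneg (nn m))))
    (outline-slack s)

  act-inOctagon : ∀ g {u} → InOctagon u → InOctagon (act g u)
  act-inOctagon g {u} oct m = ≡.subst (λ z → Positive (ev (octagon ⊟ twice (conj z))))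
    (≡.sym (ℓ-act g m u)) (oct (actDir (reverse g) m))

  emb : Lat → Point
  emb u = ev (ℓ d0 u) , ev (ℓ d2 u)

  record Frame : Set where
    constructor frame
    field
      O U V : Point

  open Frame

  lin : Frame → Point → Point
  lin φ (x , y) = x · U φ ⊕ y · V φ

  at : Frame → Lat → Point
  at φ u = O φ ⊕ lin φ (emb u)

  infix 4 _≋_
  -- Finer than `_≈ₜ_`, with corners equal in their labelled order. `expandedFrame` reads the
  -- labels, so the substitution is followed with this relation and relabelled rhombi are identified
  -- only afterwards.
  data _≋_ : Tile → Tile → Set where
    triangle : ∀ {t u a t′ u′ a′} → t ≈ₚ t′ → u ≈ₚ u′ → a ≈ₚ a′ →
               triangle t u a ≋ triangle t′ u′ a′
    rhombus  : ∀ {a b c d a′ b′ c′ d′} → a ≈ₚ a′ → b ≈ₚ b′ → c ≈ₚ c′ → d ≈ₚ d′ →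
               rhombus a b c d ≋ rhombus a′ b′ c′ d′

  ≋⇒≈ₜ : ∀ {t t′} → t ≋ t′ → t ≈ₜ t′
  ≋⇒≈ₜ (triangle p q r)  = triangle p q r
  ≋⇒≈ₜ (rhombus p q r s) = rhombus (inj₁ (p , r)) (inj₁ (q , s))

  ≋-trans : ∀ {t t′ t″} → t ≋ t′ → t′ ≋ t″ → t ≋ t″
  ≋-trans (triangle p q r)  (triangle p′ q′ r′)     =
    triangle (≈ₚ-trans p p′) (≈ₚ-trans q q′) (≈ₚ-trans r r′)
  ≋-trans (rhombus p q r s) (rhombus p′ q′ r′ s′) =
    rhombus (≈ₚ-trans p p′) (≈ₚ-trans q q′) (≈ₚ-trans r r′) (≈ₚ-trans s s′)

  realise : (Lat → Point) → LTile → Tile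
  realise f (triangle t u a)  = triangle (f t) (f u) (f a)
  realise f (rhombus a b c d) = rhombus (f a) (f b) (f c) (f d)

  realise-cong : ∀ {f f′} → (∀ u → f u ≈ₚ f′ u) → ∀ l → realise f l ≋ realise f′ l
  realise-cong e (triangle t u a)  = triangle (e t) (e u) (e a)
  realise-cong e (rhombus a b c d) = rhombus (e a) (e b) (e c) (e d)

  realise-mapL : ∀ f k l → realise f (mapL k l) ≡ realise (f ∘ k) l
  realise-mapL f k (triangle t u a)  = ≡.refl
  realise-mapL f k (rhombus a b c d) = ≡.refl

  mapTile-realise : ∀ F f l {t} → (∀ {p p′} → p ≈ₚ p′ → F p ≈ₚ F p′) →
                    t ≋ realise f l → mapTile F t ≋ realise (F ∘ f) l
  mapTile-realise F f (triangle _ _ _)  c (triangle p q r)  = triangle (c p) (c q) (c r)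
  mapTile-realise F f (rhombus _ _ _ _) c (rhombus p q r s) = rhombus (c p) (c q) (c r) (c s)

  ev-d1 : ∀ u → ev (ℓ d1 u) ≈ h * (ev (ℓ d0 u) + ev (ℓ d2 u))
  ev-d1 (lat a b c d) = begin
    ι b + ι (a ℤ.+ c) * h
      ≈⟨ +-cong (sym (*-identityʳ _)) (*-congʳ (ι-+ a c)) ⟩
    ι b * 1# + (ι a + ι c) * h
      ≈⟨ +-congʳ (*-congˡ 2hh≈1) ⟨
    ι b * (h * h + h * h) + (ι a + ι c) * h
      ≈⟨ solve 5 (λ a b c d h → b :* (h :* h :+ h :* h) :+ (a :+ c) :* h :=
           h :* ((a :+ (b :- d) :* h) :+ (c :+ (b :+ d) :* h))) refl (ι a) (ι b) (ι c) (ι d) h ⟩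
    h * ((ι a + (ι b - ι d) * h) + (ι c + (ι b + ι d) * h))
      ≈⟨ *-congˡ (+-cong (+-congˡ (*-congʳ (ι-- b d))) (+-congˡ (*-congʳ (ι-+ b d)))) ⟨
    h * ((ι a + ι (b ℤ.- d) * h) + (ι c + ι (b ℤ.+ d) * h)) ∎
    where open SetoidReasoning setoid

  ev-d3 : ∀ u → ev (ℓ d3 u) ≈ h * (ev (ℓ d2 u) - ev (ℓ d0 u))
  ev-d3 (lat a b c d) = begin
    ι d + ι (c ℤ.- a) * h
      ≈⟨ +-cong (sym (*-identityʳ _)) (*-congʳ (ι-- c a)) ⟩
    ι d * 1# + (ι c - ι a) * h
      ≈⟨ +-congʳ (*-congˡ 2hh≈1) ⟨
    ι d * (h * h + h * h) + (ι c - ι a) * h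
      ≈⟨ solve 5 (λ a b c d h → d :* (h :* h :+ h :* h) :+ (c :- a) :* h :=
           h :* ((c :+ (b :+ d) :* h) :- (a :+ (b :- d) :* h))) refl (ι a) (ι b) (ι c) (ι d) h ⟩
    h * ((ι c + (ι b + ι d) * h) - (ι a + (ι b - ι d) * h))
      ≈⟨ *-congˡ (+-cong (+-congˡ (*-congʳ (ι-+ b d))) (-‿cong (+-congˡ (*-congʳ (ι-- b d))))) ⟨
    h * ((ι c + ι (b ℤ.+ d) * h) - (ι a + ι (b ℤ.- d) * h)) ∎
    where open SetoidReasoning setoid

  reflectFrame : Reflection → Frame → Frame
  reflectFrame 𝐀 (frame o u (v₁ , v₂)) = frame o u (- v₁ , - v₂)
  reflectFrame 𝐁 (frame o u v) = frame o (h · (u ⊕ v)) (h · (u ⊖ v))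

  -- Precomposition of a frame with a symmetry, whence the outermost reflection of the word is
  -- applied to the frame first.
  actFrame : Symmetry → Frame → Frame
  actFrame []      φ = φ
  actFrame (r ∷ g) φ = actFrame g (reflectFrame r φ)

  at-reflect : ∀ r φ u → at (reflectFrame r φ) u ≈ₚ at φ (reflect r u)
  at-reflect 𝐀 (frame (o₁ , o₂) (u₁ , u₂) (v₁ , v₂)) u = lemma o₁ u₁ v₁ , lemma o₂ u₂ v₂
    where
    open SetoidReasoning setoid
    lemma : ∀ o a b → o + (ev (ℓ d0 u) * a + ev (ℓ d2 u) * - b) ≈
                      o + (ev (ℓ d0 (reflect 𝐀 u)) * a + ev (ℓ d2 (reflect 𝐀 u)) * b)
    lemma o a b = begin
      o + (ev (ℓ d0 u) * a + ev (ℓ d2 u) * - b)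
        ≈⟨ solve 5 (λ o a b x y → o :+ (x :* a :+ y :* :- b) := o :+ (x :* a :+ :- y :* b))
             refl o a b (ev (ℓ d0 u)) (ev (ℓ d2 u)) ⟩
      o + (ev (ℓ d0 u) * a + - ev (ℓ d2 u) * b)
        ≈⟨ +-congˡ (+-cong (*-congʳ (ev-cong (ℓ-reflect 𝐀 d0 u)))
                           (*-congʳ (trans (ev-cong (ℓ-reflect 𝐀 d2 u)) (ev-neg (ℓ d2 u))))) ⟨
      o + (ev (ℓ d0 (reflect 𝐀 u)) * a + ev (ℓ d2 (reflect 𝐀 u)) * b) ∎
  at-reflect 𝐁 (frame (o₁ , o₂) (u₁ , u₂) (v₁ , v₂)) u = lemma o₁ u₁ v₁ , lemma o₂ u₂ v₂
    where
    open SetoidReasoning setoid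
    x y : Carrier
    x = ev (ℓ d0 u)
    y = ev (ℓ d2 u)
    lemma : ∀ o a b → o + (x * (h * (a + b)) + y * (h * (a - b))) ≈
                      o + (ev (ℓ d0 (reflect 𝐁 u)) * a + ev (ℓ d2 (reflect 𝐁 u)) * b)
    lemma o a b = begin
      o + (x * (h * (a + b)) + y * (h * (a - b)))
        ≈⟨ solve 6 (λ o a b x y h → o :+ (x :* (h :* (a :+ b)) :+ y :* (h :* (a :- b))) :=
             o :+ (h :* (x :+ y) :* a :+ :- (h :* (y :- x)) :* b)) refl o a b x y h ⟩
      o + (h * (x + y) * a + - (h * (y - x)) * b)
        ≈⟨ +-congˡ (+-cong
             (*-congʳ (trans (ev-cong (ℓ-reflect 𝐁 d0 u)) (ev-d1 u)))
             (*-congʳ (trans (ev-cong (ℓ-reflect 𝐁 d2 u)) (trans (ev-neg (ℓ d3 u)) (-‿cong (ev-d3 u)))))) ⟨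
      o + (ev (ℓ d0 (reflect 𝐁 u)) * a + ev (ℓ d2 (reflect 𝐁 u)) * b) ∎

  at-act : ∀ g φ u → at (actFrame g φ) u ≈ₚ at φ (act g u)
  at-act []      φ u = ≈ₚ-refl
  at-act (r ∷ g) φ u = ≈ₚ-trans (at-act g (reflectFrame r φ) u) (at-reflect r φ (act g u))

  -- The axes are not scaled, since an expanded tile is cut into tiles of the original size; the
  -- factor Λ goes into the positions.
  expand : Frame → Frame
  expand (frame o u v) = frame (Λ · o) u v

  expand-act : ∀ g φ → expand (actFrame g φ) ≡ actFrame g (expand φ)
  expand-act []      φ = ≡.refl
  expand-act (𝐀 ∷ g) φ = expand-act g (reflectFrame 𝐀 φ)
  expand-act (𝐁 ∷ g) φ = expand-act g (reflectFrame 𝐁 φ)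

  ev-mulΛ : ∀ m u → ev (ℓ m (mulΛ u)) ≈ Λ * ev (ℓ m u)
  ev-mulΛ m u = begin
    ev (ℓ m (u ⊹ mul√2 u))               ≈⟨ ev-cong (ℓ-⊹ m u (mul√2 u)) ⟩
    ev (ℓ m u ⊞ ℓ m (mul√2 u))           ≈⟨ ev-⊞ (ℓ m u) (ℓ m (mul√2 u)) ⟩
    ev (ℓ m u) + ev (ℓ m (mul√2 u))      ≈⟨ +-cong (sym (*-identityˡ _))
      (trans (ev-cong (ℓ-mul√2 m u)) (ev-mul√2 (ℓ m u))) ⟩
    1# * ev (ℓ m u) + √2 * ev (ℓ m u)    ≈⟨ distribʳ _ _ _ ⟨
    Λ * ev (ℓ m u)                       ∎
    where open SetoidReasoning setoid

  emb-⊹ : ∀ u v → emb (u ⊹ v) ≈ₚ emb u ⊕ emb v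
  emb-⊹ u v = trans (ev-cong (ℓ-⊹ d0 u v)) (ev-⊞ (ℓ d0 u) (ℓ d0 v))
            , trans (ev-cong (ℓ-⊹ d2 u v)) (ev-⊞ (ℓ d2 u) (ℓ d2 v))

  ⊕-cong : ∀ {p p′ q q′} → p ≈ₚ p′ → q ≈ₚ q′ → p ⊕ q ≈ₚ p′ ⊕ q′
  ⊕-cong (a , b) (c , d) = +-cong a c , +-cong b d

  ⊖-cong : ∀ {p p′ q q′} → p ≈ₚ p′ → q ≈ₚ q′ → p ⊖ q ≈ₚ p′ ⊖ q′
  ⊖-cong (a , b) (c , d) = +-cong a (-‿cong c) , +-cong b (-‿cong d)

  ·-cong : ∀ {k k′ p p′} → k ≈ k′ → p ≈ₚ p′ → k · p ≈ₚ k′ · p′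
  ·-cong e (a , b) = *-cong e a , *-cong e b

  lin-cong : ∀ φ {p p′} → p ≈ₚ p′ → lin φ p ≈ₚ lin φ p′
  lin-cong φ (a , b) = ⊕-cong (·-cong a ≈ₚ-refl) (·-cong b ≈ₚ-refl)

  at-difference : ∀ φ u v → at φ (u ⊹ v) ⊖ at φ u ≈ₚ lin φ (emb v)
  at-difference φ@(frame (o₁ , o₂) (u₁ , u₂) (v₁ , v₂)) u v =
    lemma o₁ u₁ v₁ , lemma o₂ u₂ v₂
    where
    x y x′ y′ : Carrier
    x = ev (ℓ d0 u)
    y = ev (ℓ d2 u)
    x′ = ev (ℓ d0 v)
    y′ = ev (ℓ d2 v)
    lemma : ∀ o a b → (o + (ev (ℓ d0 (u ⊹ v)) * a + ev (ℓ d2 (u ⊹ v)) * b)) - (o + (x * a + y * b)) ≈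
                      x′ * a + y′ * b
    lemma o a b = trans
      (+-congʳ (+-congˡ (+-cong (*-congʳ (proj₁ (emb-⊹ u v))) (*-congʳ (proj₂ (emb-⊹ u v))))))
      (solve 7 (λ o a b x y x′ y′ → (o :+ ((x :+ x′) :* a :+ (y :+ y′) :* b)) :- (o :+ (x :* a :+ y :* b)) :=
         x′ :* a :+ y′ :* b) refl o a b x y x′ y′)

  affine-cong : ∀ {o o′ e e′ g g′ p p′} → o ≈ₚ o′ → e ≈ₚ e′ → g ≈ₚ g′ → p ≈ₚ p′ →
                affine o e g p ≈ₚ affine o′ e′ g′ p′
  affine-cong a b c (d , e) =
    ⊕-cong (⊕-cong (·-cong refl a) (·-cong d b)) (·-cong e (⊖-cong (·-cong refl c) b))

  -- The image of (0 , 1) is √2 (h U + h V) - U = V.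
  affine-frame : ∀ φ u d →
    affine (at φ u) (U φ) (h · U φ ⊕ h · V φ) (emb d) ≈ₚ at (expand φ) (mulΛ u ⊹ d)
  affine-frame (frame (o₁ , o₂) (u₁ , u₂) (v₁ , v₂)) u d = lemma o₁ u₁ v₁ , lemma o₂ u₂ v₂
    where
    open SetoidReasoning setoid
    x y x′ y′ : Carrier
    x = ev (ℓ d0 u)
    y = ev (ℓ d2 u)
    x′ = ev (ℓ d0 d)
    y′ = ev (ℓ d2 d)
    lemma : ∀ o a b → Λ * (o + (x * a + y * b)) + x′ * a + y′ * (√2 * (h * a + h * b) - a) ≈
      Λ * o + (ev (ℓ d0 (mulΛ u ⊹ d)) * a + ev (ℓ d2 (mulΛ u ⊹ d)) * b)
    lemma o a b = begin
      Λ * (o + (x * a + y * b)) + x′ * a + y′ * (√2 * (h * a + h * b) - a)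
        ≈⟨ +-congˡ (*-congˡ (+-congʳ (trans (*-congʳ (sym h+h≈√2))
             (solve 3 (λ h a b → (h :+ h) :* (h :* a :+ h :* b) := (h :* h :+ h :* h) :* (a :+ b)) refl h a b)))) ⟩
      Λ * (o + (x * a + y * b)) + x′ * a + y′ * ((h * h + h * h) * (a + b) - a)
        ≈⟨ +-congˡ (*-congˡ (+-congʳ (*-congʳ 2hh≈1))) ⟩
      Λ * (o + (x * a + y * b)) + x′ * a + y′ * (1# * (a + b) - a)
        ≈⟨ solve 8 (λ L o a b x y x′ y′ →
             L :* (o :+ (x :* a :+ y :* b)) :+ x′ :* a :+ y′ :* (con 1ℤ :* (a :+ b) :- a) :=
             L :* o :+ ((L :* x :+ x′) :* a :+ (L :* y :+ y′) :* b)) refl Λ o a b x y x′ y′ ⟩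
      Λ * o + ((Λ * x + x′) * a + (Λ * y + y′) * b)
        ≈⟨ +-congˡ (+-cong (*-congʳ (coordinate d0)) (*-congʳ (coordinate d2))) ⟨
      Λ * o + (ev (ℓ d0 (mulΛ u ⊹ d)) * a + ev (ℓ d2 (mulΛ u ⊹ d)) * b) ∎
      where
      coordinate : ∀ m → ev (ℓ m (mulΛ u ⊹ d)) ≈ Λ * ev (ℓ m u) + ev (ℓ m d)
      coordinate m = trans (ev-cong (ℓ-⊹ m (mulΛ u) d))
        (trans (ev-⊞ (ℓ m (mulΛ u)) (ℓ m d)) (+-congʳ (ev-mulΛ m u)))

  lin-d0 : ∀ φ → lin φ (emb (unit d0)) ≈ₚ U φ
  lin-d0 (frame _ (u₁ , u₂) (v₁ , v₂)) = lemma u₁ v₁ , lemma u₂ v₂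
    where
    lemma : ∀ a b → (1# + 0# * h) * a + (0# + 0# * h) * b ≈ a
    lemma = solve 3 (λ h a b → (con 1ℤ :+ con 0ℤ :* h) :* a :+ (con 0ℤ :+ con 0ℤ :* h) :* b := a) refl h

  lin-d1 : ∀ φ → lin φ (emb (unit d1)) ≈ₚ h · U φ ⊕ h · V φ
  lin-d1 (frame _ (u₁ , u₂) (v₁ , v₂)) = lemma u₁ v₁ , lemma u₂ v₂
    where
    lemma : ∀ a b → (0# + 1# * h) * a + (0# + 1# * h) * b ≈ h * a + h * b
    lemma = solve 3 (λ h a b → (con 0ℤ :+ con 1ℤ :* h) :* a :+ (con 0ℤ :+ con 1ℤ :* h) :* b := h :* a :+ h :* b) refl h

  lin-hypotenuse : ∀ φ → h · lin φ (emb (unit d1 ⊹ unit d7)) ≈ₚ U φ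
  lin-hypotenuse (frame _ (u₁ , u₂) (v₁ , v₂)) = lemma u₁ v₁ , lemma u₂ v₂
    where
    lemma : ∀ a b → h * ((0# + (1# + 1#) * h) * a + (0# + 0# * h) * b) ≈ a
    lemma a b = trans (solve 3 (λ h a b →
        h :* ((con 0ℤ :+ con (+ 2) :* h) :* a :+ (con 0ℤ :+ con 0ℤ :* h) :* b) := (h :* h :+ h :* h) :* a) refl h a b)
      (trans (*-congʳ 2hh≈1) (*-identityˡ a))

  -- A tile reveals the frame it was placed in: its first corner is the image of `w`, its first side
  -- or its normalised hypotenuse is the first axis, and the slanted side is the diagonal between
  -- the axes.
  expandedFrame-at : ∀ s φ w {t} → t ≋ realise (λ u → at φ (w ⊹ u)) (protoL s) →
    ∀ {p d} → p ≈ₚ emb d → expandedFrame t p ≈ₚ at (expand φ) (mulΛ w ⊹ d)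
  expandedFrame-at △ φ w (triangle {t} {u} {a} p q r) {d = d} e = ≈ₚ-trans
    (affine-cong tail
      (≈ₚ-trans (·-cong refl (≈ₚ-trans (⊖-cong q tail) (at-difference φ w (unit d1 ⊹ unit d7))))
        (lin-hypotenuse φ))
      (≈ₚ-trans (⊖-cong r tail) (≈ₚ-trans (at-difference φ w (unit d1)) (lin-d1 φ)))
      e)
    (affine-frame φ w d)
    where
    tail : t ≈ₚ at φ w
    tail = ≈ₚ-trans p (≡.subst (λ x → at φ (w ⊹ 𝟎) ≈ₚ at φ x) (⊹-identityʳ w) ≈ₚ-refl)
  expandedFrame-at ◇ φ w (rhombus {a} p q r s) {d = d} e = ≈ₚ-trans
    (affine-cong acute
      (≈ₚ-trans (⊖-cong q acute) (≈ₚ-trans (at-difference φ w (unit d0)) (lin-d0 φ)))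
      (≈ₚ-trans (⊖-cong s acute) (≈ₚ-trans (at-difference φ w (unit d1)) (lin-d1 φ)))
      e)
    (affine-frame φ w d)
    where
    acute : a ≈ₚ at φ w
    acute = ≈ₚ-trans p (≡.subst (λ x → at φ (w ⊹ 𝟎) ≈ₚ at φ x) (⊹-identityʳ w) ≈ₚ-refl)

  kindOf : Shape → Kind
  kindOf △ = △
  kindOf ◇ = ◇

  private
    c₀ : 0# ≈ ev (0ℤ , 0ℤ)
    c₀ = solve 1 (λ h → con 0ℤ := con 0ℤ :+ con 0ℤ :* h) refl h
    c₁ : 1# ≈ ev (1ℤ , 0ℤ)
    c₁ = solve 1 (λ h → con 1ℤ := con 1ℤ :+ con 0ℤ :* h) refl h
    ch : h ≈ ev (0ℤ , 1ℤ)
    ch = solve 1 (λ h → h := con 0ℤ :+ con 1ℤ :* h) refl h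
    c₁h : 1# + h ≈ ev (1ℤ , 1ℤ)
    c₁h = solve 1 (λ h → con 1ℤ :+ h := con 1ℤ :+ con 1ℤ :* h) refl h
    c₂h : 2# + h ≈ ev (+ 2 , 1ℤ)
    c₂h = solve 1 (λ h → con (+ 2) :+ h := con (+ 2) :+ con 1ℤ :* h) refl h
    c₁3h : 1# + 3h ≈ ev (1ℤ , + 3)
    c₁3h = solve 1 (λ h → con 1ℤ :+ (h :+ h :+ h) := con 1ℤ :+ con (+ 3) :* h) refl h
    c₂3h : 2# + 3h ≈ ev (+ 2 , + 3)
    c₂3h = solve 1 (λ h → con (+ 2) :+ (h :+ h :+ h) := con (+ 2) :+ con (+ 3) :* h) refl h
    c√2 : √2 ≈ ev (0ℤ , + 2)
    c√2 = trans (sym h+h≈√2) (solve 1 (λ h → h :+ h := con 0ℤ :+ con (+ 2) :* h) refl h)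
    cΛ : Λ ≈ ev (1ℤ , + 2)
    cΛ = trans (+-congˡ (sym h+h≈√2)) (solve 1 (λ h → con 1ℤ :+ (h :+ h) := con 1ℤ :+ con (+ 2) :* h) refl h)
    cΛ₁ : Λ + 1# ≈ ev (+ 2 , + 2)
    cΛ₁ = trans (+-congʳ (+-congˡ (sym h+h≈√2)))
      (solve 1 (λ h → (con 1ℤ :+ (h :+ h)) :+ con 1ℤ := con (+ 2) :+ con (+ 2) :* h) refl h)
    c₂√2 : 2# + √2 ≈ ev (+ 2 , + 2)
    c₂√2 = trans (+-congˡ (sym h+h≈√2))
      (solve 1 (λ h → con (+ 2) :+ (h :+ h) := con (+ 2) :+ con (+ 2) :* h) refl h)

  prototile-lattice : ∀ s → prototile (kindOf s) ≋ realise emb (protoL s)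
  prototile-lattice △ = triangle (c₀ , c₀) (c√2 , c₀) (ch , ch)
  prototile-lattice ◇ = rhombus (c₀ , c₀) (c₁ , c₀) (c₁h , ch) (ch , ch)

  -- The check that `children` transcribes the real dissections faithfully, corner by corner.
  dissection-children : ∀ s →
    Pointwise (λ t c → t ≋ realise emb (childTile c)) (dissection (kindOf s)) (children s)
  dissection-children △ =
      triangle (c₁ , c₁) (c₀ , c₀) (c₁ , c₀)
    ∷ triangle (cΛ , c₀) (c₁ , c₀) (c₁h , ch)
    ∷ triangle (c₂h , ch) (c₁h , c₁h) (c₁h , ch)
    ∷ rhombus (c₁ , c₀) (c₁ , c₁) (c₁h , c₁h) (c₁h , ch)
    ∷ rhombus (c₂√2 , c₀) (c₂h , ch) (c₁h , ch) (cΛ , c₀)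
    ∷ []
  dissection-children ◇ =
      rhombus (c₀ , c₀) (c₁ , c₀) (c₁h , ch) (ch , ch)
    ∷ rhombus (cΛ , c₀) (cΛ , c₁) (c₁h , c₁h) (c₁h , ch)
    ∷ rhombus (cΛ , c₁) (cΛ₁ , c₁) (c₂3h , c₁h) (c₁3h , c₁h)
    ∷ triangle (ch , ch) (c₁h , c₁h) (c₁h , ch)
    ∷ triangle (c₁ , c₀) (cΛ , c₀) (c₁h , ch)
    ∷ triangle (cΛ₁ , c₁) (cΛ , c₀) (cΛ , c₁)
    ∷ triangle (c₁3h , c₁h) (c₁h , c₁h) (cΛ , c₁)
    ∷ []

  -- Supertiles

  record TileAt (f : Lat → Point) (t : Tile) : Set where
    constructor tileAt
    field
      sym     : Symmetry
      position : Lat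
      shape   : Shape
      tile≋   : t ≋ realise (λ u → f (act sym (position ⊹ u))) (protoL shape)
      inWindow : InWindow shape position

  childTile-position : ∀ g (c : Child) w u →
    act g (mulΛ w ⊹ (Child.shiftᶜ c ⊹ act (Child.symᶜ c) u)) ≡ act (g ++ Child.symᶜ c) (childPosition c w ⊹ u)
  childTile-position g (child k g′ w′) w u = begin
    act g (mulΛ w ⊹ (w′ ⊹ act g′ u))
      ≡⟨ ≡.cong (act g) (⊹-assoc (mulΛ w) w′ (act g′ u)) ⟨
    act g ((mulΛ w ⊹ w′) ⊹ act g′ u)
      ≡⟨ ≡.cong (λ x → act g (x ⊹ act g′ u)) (act-reverse g′ (mulΛ w ⊹ w′)) ⟨
    act g (act g′ (act (reverse g′) (mulΛ w ⊹ w′)) ⊹ act g′ u)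
      ≡⟨ ≡.cong (act g) (act-⊹ g′ (act (reverse g′) (mulΛ w ⊹ w′)) u) ⟨
    act g (act g′ (act (reverse g′) (mulΛ w ⊹ w′) ⊹ u))
      ≡⟨ act-++ g g′ (act (reverse g′) (mulΛ w ⊹ w′) ⊹ u) ⟨
    act (g ++ g′) (act (reverse g′) (mulΛ w ⊹ w′) ⊹ u) ∎
    where open ≡.≡-Reasoning

  mapTile-emb : ∀ F f l {t} → (∀ {p d} → p ≈ₚ emb d → F p ≈ₚ f d) →
                t ≋ realise emb l → mapTile F t ≋ realise f l
  mapTile-emb F f (triangle _ _ _)  c (triangle p q r)  = triangle (c p) (c q) (c r)
  mapTile-emb F f (rhombus _ _ _ _) c (rhombus p q r s) = rhombus (c p) (c q) (c r) (c s)

  kind-≋ : ∀ s {f t} → t ≋ realise f (protoL s) → kind t ≡ kindOf s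
  kind-≋ △ (triangle _ _ _)  = ≡.refl
  kind-≋ ◇ (rhombus _ _ _ _) = ≡.refl

  -- In the axes of its parent a child sits at Λ w plus its shift; rewriting this in its own axes
  -- gives `childPosition`, to which the contraction of windows applies. All tiles of the supertile
  -- keep sharing one frame, of which only the origin moves.
  ω-step : ∀ Φ {t} → TileAt (at Φ) t → All (TileAt (at (expand Φ))) (ω t)
  ω-step Φ {t} (tileAt g w s t≋ win) =
    Allₚ.map⁺ (≡.subst (λ k → All (TileAt (at (expand Φ)) ∘ mapTile (expandedFrame t)) (dissection k))
      (≡.sym (kind-≋ s t≋)) (pair-up (dissection-children s) (childPosition-inWindow s win)))
    where
    φ = actFrame g Φ
    t≋φ : t ≋ realise (λ u → at φ (w ⊹ u)) (protoL s)
    t≋φ = ≋-trans t≋ (realise-cong (λ u → ≈ₚ-sym (at-act g Φ (w ⊹ u))) (protoL s))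
    corner : ∀ (c : Child) u → at (expand φ) (mulΛ w ⊹ (Child.shiftᶜ c ⊹ act (Child.symᶜ c) u)) ≈ₚ
                               at (expand Φ) (act (g ++ Child.symᶜ c) (childPosition c w ⊹ u))
    corner c@(child _ g′ w′) u =
      ≡.subst₂ (λ ψ v → at ψ (mulΛ w ⊹ (w′ ⊹ act g′ u)) ≈ₚ at (expand Φ) v)
        (≡.sym (expand-act g Φ)) (childTile-position g c w u)
        (at-act g (expand Φ) (mulΛ w ⊹ (w′ ⊹ act g′ u)))
    pair-up : ∀ {ds cs} → Pointwise (λ d c → d ≋ realise emb (childTile c)) ds cs →
              All (λ c → InWindow (Child.shapeᶜ c) (childPosition c w)) cs →
              All (TileAt (at (expand Φ)) ∘ mapTile (expandedFrame t)) ds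
    pair-up []       []         = []
    pair-up (_∷_ {y = c@(child s′ g′ w′)} e es) (win′ ∷ wins) =
      tileAt (g ++ g′) (childPosition c w) s′
        (≋-trans
          (≡.subst (mapTile (expandedFrame t) _ ≋_)
            (realise-mapL (λ v → at (expand φ) (mulΛ w ⊹ v)) (λ u → w′ ⊹ act g′ u) (protoL s′))
            (mapTile-emb (expandedFrame t) (λ v → at (expand φ) (mulΛ w ⊹ v)) (childTile c)
              (expandedFrame-at s φ w t≋φ) e))
          (realise-cong (corner c) (protoL s′)))
        win′
      ∷ pair-up es wins

  e₁ e₂ : Point
  e₁ = 1# , 0#
  e₂ = 0# , 1#

  supertile-tiles : ∀ s n → ∃ λ o → All (TileAt (at (frame o e₁ e₂))) (ω^ n (prototile (kindOf s)))
  supertile-tiles s zero =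
    -- The origin is moved back by the seed, so that the prototile stays where it is although its
    -- lattice position is not 0.
    (0# , 0#) ⊖ emb (seed s) ,
    tileAt [] (seed s) s
      (≋-trans (prototile-lattice s) (realise-cong corner (protoL s)))
      (λ m → ev-positive (seed-inWindow s m)) ∷ []
    where
    corner : ∀ u → emb u ≈ₚ at (frame ((0# , 0#) ⊖ emb (seed s)) e₁ e₂) (seed s ⊹ u)
    corner u = first , second
      where
      x = ev (ℓ d0 (seed s))
      y = ev (ℓ d2 (seed s))
      first : ev (ℓ d0 u) ≈ (0# - x) + (ev (ℓ d0 (seed s ⊹ u)) * 1# + ev (ℓ d2 (seed s ⊹ u)) * 0#)
      first = trans (solve 3 (λ x z w → z := (con 0ℤ :- x) :+ ((x :+ z) :* con 1ℤ :+ w :* con 0ℤ)) refl x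
        (ev (ℓ d0 u)) _)
                    (+-congˡ (+-congʳ (*-congʳ (sym (proj₁ (emb-⊹ (seed s) u))))))
      second : ev (ℓ d2 u) ≈ (0# - y) + (ev (ℓ d0 (seed s ⊹ u)) * 0# + ev (ℓ d2 (seed s ⊹ u)) * 1#)
      second = trans (solve 3 (λ y z w → z := (con 0ℤ :- y) :+ (w :* con 0ℤ :+ (y :+ z) :* con 1ℤ)) refl y
        (ev (ℓ d2 u)) _)
                     (+-congˡ (+-congˡ (*-congʳ (sym (proj₂ (emb-⊹ (seed s) u))))))
  supertile-tiles s (suc n) with supertile-tiles s n
  ... | o , tiles = Λ · o , Allₚ.concat⁺ (Allₚ.map⁺ (All.map (ω-step (frame o e₁ e₂)) tiles))

  -- Isometries as orthonormal frames

  record Orthonormal (φ : Frame) : Set where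
    constructor orthonormal
    field
      UU : dot (U φ) (U φ) ≈ 1#
      VV : dot (V φ) (V φ) ≈ 1#
      UV : dot (U φ) (V φ) ≈ 0#

  dot-self-≈0 : ∀ {p} → dot p p ≈ 0# → p ≈ₚ (0# , 0#)
  dot-self-≈0 e = decidable-stable em (square-sum-≈0 e)
                , decidable-stable em (square-sum-≈0 (trans (+-comm _ _) e))

  module _ (f : Isometry) (o : Point) where
    open SetoidReasoning setoid
    private
      F : Point → Point
      F = Isometry.to f

      -- An isometry is given through distances only; this expresses inner products by them.
      polarisation : ∀ p q r → dot (p ⊖ r) (q ⊖ r) + dot (p ⊖ r) (q ⊖ r) ≈
                               dist² p r + dist² q r - dist² p q
      polarisation (p₁ , p₂) (q₁ , q₂) (r₁ , r₂) =
        solve 6 (λ p₁ p₂ q₁ q₂ r₁ r₂ →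
          ((p₁ :- r₁) :* (q₁ :- r₁) :+ (p₂ :- r₂) :* (q₂ :- r₂)) :+
          ((p₁ :- r₁) :* (q₁ :- r₁) :+ (p₂ :- r₂) :* (q₂ :- r₂)) :=
          ((p₁ :- r₁) :* (p₁ :- r₁) :+ (p₂ :- r₂) :* (p₂ :- r₂)) :+
          ((q₁ :- r₁) :* (q₁ :- r₁) :+ (q₂ :- r₂) :* (q₂ :- r₂)) :-
          ((p₁ :- q₁) :* (p₁ :- q₁) :+ (p₂ :- q₂) :* (p₂ :- q₂))) refl p₁ p₂ q₁ q₂ r₁ r₂

      halve : ∀ {x y} → x + x ≈ y + y → x ≈ y
      halve {x} {y} e = begin
        x            ≈⟨ solve 2 (λ x y → x := (x :- y) :+ y) refl x y ⟩
        x - y + y    ≈⟨ +-congʳ (halve-≈0 (begin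
          (x - y) + (x - y)  ≈⟨ solve 2 (λ x y → (x :- y) :+ (x :- y) := (x :+ x) :- (y :+ y)) refl x y ⟩
          (x + x) - (y + y)  ≈⟨ +-congʳ e ⟩
          (y + y) - (y + y)  ≈⟨ -‿inverseʳ _ ⟩
          0#                 ∎)) ⟩
        0# + y       ≈⟨ +-identityˡ y ⟩
        y            ∎

      preserves-dot : ∀ p q → dot (F p ⊖ F o) (F q ⊖ F o) ≈ dot (p ⊖ o) (q ⊖ o)
      preserves-dot p q = halve (trans (polarisation (F p) (F q) (F o))
        (trans (+-cong (+-cong (Isometry.isometric f p o) (Isometry.isometric f q o))
                       (-‿cong (Isometry.isometric f p q)))
               (sym (polarisation p q o))))

    image : Frame
    image = frame (F o) (F (o ⊕ e₁) ⊖ F o) (F (o ⊕ e₂) ⊖ F o)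

    private
      cancel : ∀ p → (o ⊕ p) ⊖ o ≈ₚ p
      cancel (x , y) = lemma (proj₁ o) x , lemma (proj₂ o) y
        where
        lemma : ∀ a b → (a + b) - a ≈ b
        lemma = solve 2 (λ a b → (a :+ b) :- a := b) refl

      dot-cong : ∀ {p p′ q q′} → p ≈ₚ p′ → q ≈ₚ q′ → dot p q ≈ dot p′ q′
      dot-cong (a , b) (c , d) = +-cong (*-cong a c) (*-cong b d)

      dot-e₁ : ∀ p → dot p e₁ ≈ proj₁ p
      dot-e₁ (x , y) = solve 2 (λ x y → x :* con 1ℤ :+ y :* con 0ℤ := x) refl x y

      dot-e₂ : ∀ p → dot p e₂ ≈ proj₂ p
      dot-e₂ (x , y) = solve 2 (λ x y → x :* con 0ℤ :+ y :* con 1ℤ := y) refl x y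

      image-dot₁ : ∀ p → dot (F p ⊖ F o) (U image) ≈ proj₁ (p ⊖ o)
      image-dot₁ p = trans (preserves-dot p (o ⊕ e₁)) (trans (dot-cong ≈ₚ-refl (cancel e₁)) (dot-e₁ (p ⊖ o)))

      image-dot₂ : ∀ p → dot (F p ⊖ F o) (V image) ≈ proj₂ (p ⊖ o)
      image-dot₂ p = trans (preserves-dot p (o ⊕ e₂)) (trans (dot-cong ≈ₚ-refl (cancel e₂)) (dot-e₂ (p ⊖ o)))

    image-orthonormal : Orthonormal image
    image-orthonormal = orthonormal
      (trans (image-dot₁ (o ⊕ e₁)) (proj₁ (cancel e₁)))
      (trans (image-dot₂ (o ⊕ e₂)) (proj₂ (cancel e₂)))
      (trans (image-dot₂ (o ⊕ e₁)) (proj₂ (cancel e₁)))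

    -- The difference X - x U - y V of the two sides has norm zero.
    isometry-affine : ∀ p → F p ≈ₚ F o ⊕ lin image (p ⊖ o)
    isometry-affine p = shift (dot-self-≈0 norm)
      where
      X B C : Point
      X = F p ⊖ F o
      B = U image
      C = V image
      x y : Carrier
      x = proj₁ (p ⊖ o)
      y = proj₂ (p ⊖ o)
      bilinear : ∀ X B C x y → let D = X ⊖ (x · B ⊕ y · C) in
        dot D D ≈ (dot X X - (x * dot X B + x * dot X B) - (y * dot X C + y * dot X C)) +
                  (x * x * dot B B + y * y * dot C C + (x * y * dot B C + x * y * dot B C))
      bilinear (X₁ , X₂) (B₁ , B₂) (C₁ , C₂) x y = trans
        (+-cong (one X₁ B₁ C₁) (one X₂ B₂ C₂))
        (solve 14 (λ a b c d e f a′ b′ c′ d′ e′ f′ x y →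
          ((a :- (x :* b :+ x :* b) :- (y :* c :+ y :* c)) :+
            (x :* x :* d :+ y :* y :* e :+ (x :* y :* f :+ x :* y :* f))) :+
          ((a′ :- (x :* b′ :+ x :* b′) :- (y :* c′ :+ y :* c′)) :+
            (x :* x :* d′ :+ y :* y :* e′ :+ (x :* y :* f′ :+ x :* y :* f′))) :=
          ((a :+ a′) :- (x :* (b :+ b′) :+ x :* (b :+ b′)) :- (y :* (c :+ c′) :+ y :* (c :+ c′))) :+
          (x :* x :* (d :+ d′) :+ y :* y :* (e :+ e′) :+ (x :* y :* (f :+ f′) :+ x :* y :* (f :+ f′)))) refl
          (X₁ * X₁) (X₁ * B₁) (X₁ * C₁) (B₁ * B₁) (C₁ * C₁) (B₁ * C₁)
          (X₂ * X₂) (X₂ * B₂) (X₂ * C₂) (B₂ * B₂) (C₂ * C₂) (B₂ * C₂) x y)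
        where
        one : ∀ X B C → (X - (x * B + y * C)) * (X - (x * B + y * C)) ≈
          (X * X - (x * (X * B) + x * (X * B)) - (y * (X * C) + y * (X * C))) +
          (x * x * (B * B) + y * y * (C * C) + (x * y * (B * C) + x * y * (B * C)))
        one X B C = solve 5 (λ X B C x y → (X :- (x :* B :+ y :* C)) :* (X :- (x :* B :+ y :* C)) :=
          (X :* X :- (x :* (X :* B) :+ x :* (X :* B)) :- (y :* (X :* C) :+ y :* (X :* C))) :+
          (x :* x :* (B :* B) :+ y :* y :* (C :* C) :+ (x :* y :* (B :* C) :+ x :* y :* (B :* C)))) refl X B C x y
      norm : dot (X ⊖ (x · B ⊕ y · C)) (X ⊖ (x · B ⊕ y · C)) ≈ 0#
      norm = begin
        dot (X ⊖ (x · B ⊕ y · C)) (X ⊖ (x · B ⊕ y · C))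
          ≈⟨ bilinear X B C x y ⟩
        (dot X X - (x * dot X B + x * dot X B) - (y * dot X C + y * dot X C)) +
        (x * x * dot B B + y * y * dot C C + (x * y * dot B C + x * y * dot B C))
          ≈⟨ +-cong (+-cong (+-cong (preserves-dot p p)
            (-‿cong (+-cong (*-congˡ (image-dot₁ p)) (*-congˡ (image-dot₁ p)))))
                            (-‿cong (+-cong (*-congˡ (image-dot₂ p)) (*-congˡ (image-dot₂ p)))))
                    (+-cong (+-cong (*-congˡ UU) (*-congˡ VV)) (+-cong (*-congˡ UV) (*-congˡ UV))) ⟩
        ((x * x + y * y) - (x * x + x * x) - (y * y + y * y)) +
        (x * x * 1# + y * y * 1# + (x * y * 0# + x * y * 0#))
          ≈⟨ solve 2 (λ x y → ((x :* x :+ y :* y) :- (x :* x :+ x :* x) :- (y :* y :+ y :* y)) :+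
               (x :* x :* con 1ℤ :+ y :* y :* con 1ℤ :+ (x :* y :* con 0ℤ :+ x :* y :* con 0ℤ)) := con 0ℤ) refl x y ⟩
        0# ∎
        where open Orthonormal image-orthonormal
      shift : X ⊖ (x · B ⊕ y · C) ≈ₚ (0# , 0#) → F p ≈ₚ F o ⊕ (x · B ⊕ y · C)
      shift (a , b) = one a , one b
        where
        one : ∀ {a b c} → (a - b) - c ≈ 0# → a ≈ b + c
        one {a} {b} {c} e = trans (solve 3 (λ a b c → a := ((a :- b) :- c) :+ (b :+ c)) refl a b c)
                                  (trans (+-congʳ e) (+-identityˡ _))

    -- `Isometry` has no field for compatibility with the setoid equality; it follows from the
    -- affine form.
    isometry-cong : ∀ {p q} → p ≈ₚ q → F p ≈ₚ F q
    isometry-cong {p} {q} e = ≈ₚ-trans (isometry-affine p)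
      (≈ₚ-trans (⊕-cong ≈ₚ-refl (lin-cong image (⊖-cong e ≈ₚ-refl))) (≈ₚ-sym (isometry-affine q)))

    isometry-at : ∀ u → F (at (frame o e₁ e₂) u) ≈ₚ at image u
    isometry-at u = ≈ₚ-trans (isometry-affine (at (frame o e₁ e₂) u))
      (⊕-cong ≈ₚ-refl (lin-cong image (one (proj₁ o) (ev (ℓ d0 u)) (ev (ℓ d2 u)) ,
        two (proj₂ o) (ev (ℓ d0 u)) (ev (ℓ d2 u)))))
      where
      one : ∀ o x y → (o + (x * 1# + y * 0#)) - o ≈ x
      one = solve 3 (λ o x y → (o :+ (x :* con 1ℤ :+ y :* con 0ℤ)) :- o := x) refl
      two : ∀ o x y → (o + (x * 0# + y * 1#)) - o ≈ y
      two = solve 3 (λ o x y → (o :+ (x :* con 0ℤ :+ y :* con 1ℤ)) :- o := y) refl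

  ≈ₛ-trans : ∀ {s t u} → s ≈ₛ t → t ≈ₛ u → s ≈ₛ u
  ≈ₛ-trans = Setoid.trans segmentSetoid

  ≈ₛ-sym : ∀ {s t} → s ≈ₛ t → t ≈ₛ s
  ≈ₛ-sym = Setoid.sym segmentSetoid

  ≈ₜ-trans : ∀ {t t′ t″} → t ≈ₜ t′ → t′ ≈ₜ t″ → t ≈ₜ t″
  ≈ₜ-trans (triangle p q r) (triangle p′ q′ r′) =
    triangle (≈ₚ-trans p p′) (≈ₚ-trans q q′) (≈ₚ-trans r r′)
  ≈ₜ-trans (rhombus p q) (rhombus p′ q′) = rhombus (≈ₛ-trans p p′) (≈ₛ-trans q q′)

  record NormalTile (f : Lat → Point) (t : Tile) : Set where
    constructor normalTile
    field
      shape    : Shape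
      index    : Fin 8
      side     : Bool
      position : Lat
      tile≈    : t ≈ₜ realise f (mapL (position ⊹_) (oriented shape index side))
      octagonal : All (λ δ → InOctagon (position ⊹ δ)) (orientedOutline shape index side)

  -- Unlike the windows, the octagon is invariant under all symmetries. Once the corners are known
  -- to lie in it, the symmetry of the tile can be absorbed into its position and its orientation.
  normalise : ∀ {f t t′} → t ≈ₜ t′ → TileAt f t′ → NormalTile f t
  normalise {f} {t} {t′} e (tileAt g w s t≋ win) = normalTile s (actDir g d0) b (act g w)
    (≈ₜ-trans e (≡.subst (t′ ≈ₜ_) eq (≋⇒≈ₜ t≋)))
    (≡.subst (All _) (act-outline g s)
      (Allₚ.map⁺ (All.map (λ {δ} oct → ≡.subst InOctagon (act-⊹ g w δ) (act-inOctagon g oct))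
        (outline-inOctagon s win))))
    where
    b = proj₁ (actDir-next g d0)
    realise-≡ : ∀ {k k′ : Lat → Lat} → (∀ u → k u ≡ k′ u) → ∀ l → realise (f ∘ k) l ≡ realise (f ∘ k′) l
    realise-≡ p (triangle t u a)  rewrite p t | p u | p a = ≡.refl
    realise-≡ p (rhombus a b c d) rewrite p a | p b | p c | p d = ≡.refl
    eq : realise (λ u → f (act g (w ⊹ u))) (protoL s) ≡ realise f (mapL (act g w ⊹_) (oriented s (actDir g d0) b))
    eq = begin
      realise (λ u → f (act g (w ⊹ u))) (protoL s)             ≡⟨ realise-≡ (act-⊹ g w) (protoL s) ⟩
      realise (λ u → f (act g w ⊹ act g u)) (protoL s)         ≡⟨ realise-mapL (λ v → f (act g w ⊹ v)) (act g) (protoL s) ⟨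
      realise (λ v → f (act g w ⊹ v)) (mapL (act g) (protoL s)) ≡⟨ ≡.cong (realise _) (act-protoL g s) ⟩
      realise (λ v → f (act g w ⊹ v)) (oriented s (actDir g d0) b) ≡⟨ realise-mapL f (act g w ⊹_)
        (oriented s (actDir g d0) b) ⟨
      realise f (mapL (act g w ⊹_) (oriented s (actDir g d0) b)) ∎
      where open ≡.≡-Reasoning

  tileAt-act : ∀ {f f′} g → (∀ u → f u ≈ₚ f′ (act g u)) → ∀ {t} → TileAt f t → TileAt f′ t
  tileAt-act {f} {f′} g e (tileAt g′ w s t≋ win) = tileAt (g ++ g′) w s
    (≋-trans t≋ (realise-cong (λ u →
      ≡.subst (λ v → f (act g′ (w ⊹ u)) ≈ₚ f′ v) (≡.sym (act-++ g g′ (w ⊹ u))) (e (act g′ (w ⊹ u))))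
      (protoL s)))
    win

  CopyAt : (Lat → Point) → Tile → Set
  CopyAt f t = ∃ λ t′ → t ≈ₜ t′ × TileAt f t′

  contained⇒copies : ∀ {F} → ContainedInSupertile F →
    ∃ λ φ → Orthonormal φ × All (CopyAt (at φ)) F
  contained⇒copies (n , k , f , inside) with shapeOf k
    where
    shapeOf : ∀ k → ∃ λ s → kindOf s ≡ k
    shapeOf △ = △ , ≡.refl
    shapeOf ◇ = ◇ , ≡.refl
  ... | s , ≡.refl with supertile-tiles s n
  ... | o , tiles = image f o , image-orthonormal f o , All.map copy inside
    where
    copies : All (TileAt (at (image f o))) (map (mapTile (Isometry.to f)) (ω^ n (prototile (kindOf s))))
    copies = Allₚ.map⁺ (All.map
      (λ (tileAt g w s′ t≋ win) → tileAt g w s′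
        (≋-trans (mapTile-realise (Isometry.to f) _ (protoL s′) (isometry-cong f o) t≋)
                 (realise-cong (λ u → isometry-at f o (act g (w ⊹ u))) (protoL s′))) win)
      tiles)
    copy : ∀ {t} → Any (t ≈ₜ_) (map (mapTile (Isometry.to f)) (ω^ n (prototile (kindOf s)))) →
           CopyAt (at (image f o)) t
    copy any = let (t≈ , at′) = All.lookupAny copies any in Any.lookup any , at′ , t≈

  -- Sides and axes

  -- Every side of a rhombus joins an end of one diagonal to an end of the other, so relabelling
  -- only permutes or reverses sides.
  sides-resp : ∀ {t t′} → t ≈ₜ t′ → ∀ {s} → Any (s ≈ₛ_) (sides t) → Any (s ≈ₛ_) (sides t′)
  sides-resp (triangle p q r) (here e) = here (≈ₛ-trans e (inj₁ (p , q)))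
  sides-resp (triangle p q r) (there (here e)) = there (here (≈ₛ-trans e (inj₁ (q , r))))
  sides-resp (triangle p q r) (there (there (here e))) = there (there (here (≈ₛ-trans e (inj₁ (r , p)))))
  sides-resp (rhombus (inj₁ (a , c)) (inj₁ (b , d))) (here e) = here (≈ₛ-trans e (inj₁ (a , b)))
  sides-resp (rhombus (inj₁ (a , c)) (inj₁ (b , d))) (there (here e)) = there (here (≈ₛ-trans e (inj₁ (b , c))))
  sides-resp (rhombus (inj₁ (a , c)) (inj₁ (b , d))) (there (there (here e))) =
    there (there (here (≈ₛ-trans e (inj₁ (c , d)))))
  sides-resp (rhombus (inj₁ (a , c)) (inj₁ (b , d))) (there (there (there (here e)))) =
    there (there (there (here (≈ₛ-trans e (inj₁ (d , a))))))
  sides-resp (rhombus (inj₁ (a , c)) (inj₂ (b , d))) (here e) =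
    there (there (there (here (≈ₛ-trans e (inj₂ (a , b))))))
  sides-resp (rhombus (inj₁ (a , c)) (inj₂ (b , d))) (there (here e)) =
    there (there (here (≈ₛ-trans e (inj₂ (b , c)))))
  sides-resp (rhombus (inj₁ (a , c)) (inj₂ (b , d))) (there (there (here e))) =
    there (here (≈ₛ-trans e (inj₂ (c , d))))
  sides-resp (rhombus (inj₁ (a , c)) (inj₂ (b , d))) (there (there (there (here e)))) =
    here (≈ₛ-trans e (inj₂ (d , a)))
  sides-resp (rhombus (inj₂ (a , c)) (inj₁ (b , d))) (here e) = there (here (≈ₛ-trans e (inj₂ (a , b))))
  sides-resp (rhombus (inj₂ (a , c)) (inj₁ (b , d))) (there (here e)) = here (≈ₛ-trans e (inj₂ (b , c)))
  sides-resp (rhombus (inj₂ (a , c)) (inj₁ (b , d))) (there (there (here e))) =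
    there (there (there (here (≈ₛ-trans e (inj₂ (c , d))))))
  sides-resp (rhombus (inj₂ (a , c)) (inj₁ (b , d))) (there (there (there (here e)))) =
    there (there (here (≈ₛ-trans e (inj₂ (d , a)))))
  sides-resp (rhombus (inj₂ (a , c)) (inj₂ (b , d))) (here e) = there (there (here (≈ₛ-trans e (inj₁ (a , b)))))
  sides-resp (rhombus (inj₂ (a , c)) (inj₂ (b , d))) (there (here e)) =
    there (there (there (here (≈ₛ-trans e (inj₁ (b , c))))))
  sides-resp (rhombus (inj₂ (a , c)) (inj₂ (b , d))) (there (there (here e))) = here (≈ₛ-trans e (inj₁ (c , d)))
  sides-resp (rhombus (inj₂ (a , c)) (inj₂ (b , d))) (there (there (there (here e)))) =
    there (here (≈ₛ-trans e (inj₁ (d , a))))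

  corners-resp : ∀ {t t′} → t ≈ₜ t′ → ∀ {v} → Any (v ≈ₚ_) (corners t) → Any (v ≈ₚ_) (corners t′)
  corners-resp (triangle p q r) (here e) = here (≈ₚ-trans e p)
  corners-resp (triangle p q r) (there (here e)) = there (here (≈ₚ-trans e q))
  corners-resp (triangle p q r) (there (there (here e))) = there (there (here (≈ₚ-trans e r)))
  corners-resp (rhombus (inj₁ (a , c)) _) (here e) = here (≈ₚ-trans e a)
  corners-resp (rhombus (inj₂ (a , c)) _) (here e) = there (there (here (≈ₚ-trans e a)))
  corners-resp (rhombus _ (inj₁ (b , d))) (there (here e)) = there (here (≈ₚ-trans e b))
  corners-resp (rhombus _ (inj₂ (b , d))) (there (here e)) = there (there (there (here (≈ₚ-trans e b))))
  corners-resp (rhombus (inj₁ (a , c)) _) (there (there (here e))) = there (there (here (≈ₚ-trans e c)))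
  corners-resp (rhombus (inj₂ (a , c)) _) (there (there (here e))) = here (≈ₚ-trans e c)
  corners-resp (rhombus _ (inj₁ (b , d))) (there (there (there (here e)))) =
    there (there (there (here (≈ₚ-trans e d))))
  corners-resp (rhombus _ (inj₂ (b , d))) (there (there (there (here e)))) = there (here (≈ₚ-trans e d))

  step : Bool → Fin 8 → Lat
  step false j = unit j
  step true  j = mul√2 (unit j)

  -- The edge is directed along one of ζ⁰, ..., ζ³, so its two ends have a canonical order; `long`
  -- marks hypotenuses, of length √2.
  record NormalEdge (f : Lat → Point) (s : Segment) : Set where
    constructor normalEdge
    field
      index  : Fin 4
      long   : Bool
      base   : Lat
      edge≈  : s ≈ₛ (f base , f (base ⊹ step long (index ↑ˡ 4)))
      baseOct : InOctagon base
      tipOct  : InOctagon (base ⊹ step long (index ↑ˡ 4))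

  sidesL-steps : ∀ s i b → All (λ (u , v) → ∃ λ (j : Fin 4) →
    (v ≡ u ⊹ step false (j ↑ˡ 4) ⊎ u ≡ v ⊹ step false (j ↑ˡ 4)) ⊎
    (v ≡ u ⊹ step true (j ↑ˡ 4) ⊎ u ≡ v ⊹ step true (j ↑ˡ 4))) (sidesL (oriented s i b))
  sidesL-steps = toWitness {a? = all-shape? λ s → all? λ i → all-bool? λ b →
    All.all? (λ (u , v) → any? λ j →
      (v ≟L (u ⊹ step false (j ↑ˡ 4)) ⊎-dec u ≟L (v ⊹ step false (j ↑ˡ 4))) ⊎-dec
      (v ≟L (u ⊹ step true (j ↑ˡ 4)) ⊎-dec u ≟L (v ⊹ step true (j ↑ˡ 4)))) (sidesL (oriented s i b))} _

  outline-sides : ∀ s i b {P : Lat → Set} → All P (orientedOutline s i b) →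
    All (λ (u , v) → P u × P v) (sidesL (oriented s i b))
  outline-sides △ i b (p ∷ q ∷ r ∷ _)     = (p , q) ∷ (q , r) ∷ (r , p) ∷ []
  outline-sides ◇ i b (p ∷ q ∷ r ∷ s ∷ _) = (p , q) ∷ (q , r) ∷ (r , s) ∷ (s , p) ∷ []

  outline-corners : ∀ s i b {P : Lat → Set} → All P (orientedOutline s i b) →
    All P (cornersL (oriented s i b))
  outline-corners △ i b (p ∷ q ∷ r ∷ _)     = p ∷ q ∷ r ∷ []
  outline-corners ◇ i b (p ∷ q ∷ r ∷ s ∷ _) = p ∷ q ∷ r ∷ s ∷ []

  sides-realise : ∀ f w l → sides (realise f (mapL (w ⊹_) l)) ≡ map (λ (u , v) → f (w ⊹ u) , f (w ⊹ v)) (sidesL l)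
  sides-realise f w (triangle _ _ _)  = ≡.refl
  sides-realise f w (rhombus _ _ _ _) = ≡.refl

  corners-realise : ∀ f w l → corners (realise f (mapL (w ⊹_) l)) ≡ map (λ u → f (w ⊹ u)) (cornersL l)
  corners-realise f w (triangle _ _ _)  = ≡.refl
  corners-realise f w (rhombus _ _ _ _) = ≡.refl

  normalTile-side : ∀ {f t s} → NormalTile f t → Any (s ≈ₛ_) (sides t) → NormalEdge f s
  normalTile-side {f} {t} {s} (normalTile sh i b w t≈ oct) any =
    find (sidesL-steps sh i b) (outline-sides sh i b oct)
         (Anyₚ.map⁻ (≡.subst (Any (s ≈ₛ_)) (sides-realise f w (oriented sh i b)) (sides-resp t≈ any)))
    where
    forward : ∀ {u v} (j : Fin 4) l → v ≡ u ⊹ step l (j ↑ˡ 4) → s ≈ₛ (f (w ⊹ u) , f (w ⊹ v)) →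
              InOctagon (w ⊹ u) → InOctagon (w ⊹ v) → NormalEdge f s
    forward {u} j l ≡.refl e p q = normalEdge j l (w ⊹ u)
      (≡.subst (λ x → s ≈ₛ (f (w ⊹ u) , f x)) (≡.sym (⊹-assoc w u (step l (j ↑ˡ 4)))) e) p
      (≡.subst InOctagon (≡.sym (⊹-assoc w u (step l (j ↑ˡ 4)))) q)
    flip : ∀ {p q} → s ≈ₛ (p , q) → s ≈ₛ (q , p)
    flip (inj₁ e) = inj₂ e
    flip (inj₂ e) = inj₁ e
    find : ∀ {ss} → All _ ss → All (λ (u , v) → InOctagon (w ⊹ u) × InOctagon (w ⊹ v)) ss →
           Any (λ (u , v) → s ≈ₛ (f (w ⊹ u) , f (w ⊹ v))) ss → NormalEdge f s
    find ((j , inj₁ (inj₁ x)) ∷ _) ((p , q) ∷ _) (here e) = forward j false x e p q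
    find ((j , inj₁ (inj₂ x)) ∷ _) ((p , q) ∷ _) (here e) = forward j false x (flip e) q p
    find ((j , inj₂ (inj₁ x)) ∷ _) ((p , q) ∷ _) (here e) = forward j true x e p q
    find ((j , inj₂ (inj₂ x)) ∷ _) ((p , q) ∷ _) (here e) = forward j true x (flip e) q p
    find (_ ∷ xs) (_ ∷ os) (there e) = find xs os e

  actFrame-O : ∀ g φ → O (actFrame g φ) ≡ O φ
  actFrame-O []      φ = ≡.refl
  actFrame-O (𝐀 ∷ g) φ = actFrame-O g (reflectFrame 𝐀 φ)
  actFrame-O (𝐁 ∷ g) φ = actFrame-O g (reflectFrame 𝐁 φ)

  lin-act : ∀ g φ u → lin (actFrame g φ) (emb u) ≈ₚ lin φ (emb (act g u))
  lin-act g φ u = ≈ₚ-trans (cancel (O φ) _)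
    (≈ₚ-trans (⊖-cong (≡.subst (λ o → o ⊕ lin (actFrame g φ) (emb u) ≈ₚ at φ (act g u)) (actFrame-O g φ)
      (at-act g φ u)) ≈ₚ-refl)
              (≈ₚ-sym (cancel (O φ) _)))
    where
    one : ∀ a b → b ≈ (a + b) - a
    one = solve 2 (λ a b → b := (a :+ b) :- a) refl
    cancel : ∀ p q → q ≈ₚ (p ⊕ q) ⊖ p
    cancel (p₁ , p₂) (q₁ , q₂) = one p₁ q₁ , one p₂ q₂

  reflect-orthonormal : ∀ r {φ} → Orthonormal φ → Orthonormal (reflectFrame r φ)
  reflect-orthonormal 𝐀 {frame o (u₁ , u₂) (v₁ , v₂)} (orthonormal UU VV UV) = orthonormal UU
    (trans (solve 2 (λ a b → :- a :* :- a :+ :- b :* :- b := a :* a :+ b :* b) refl v₁ v₂) VV)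
    (trans (solve 4 (λ a b c d → a :* :- b :+ c :* :- d := :- (a :* b :+ c :* d)) refl u₁ v₁ u₂ v₂)
           (trans (-‿cong UV) -0#≈0#))
  reflect-orthonormal 𝐁 {frame o (u₁ , u₂) (v₁ , v₂)} (orthonormal UU VV UV) = orthonormal
    (trans (solve 5 (λ h a b c d →
        h :* (a :+ c) :* (h :* (a :+ c)) :+ h :* (b :+ d) :* (h :* (b :+ d)) :=
        h :* h :* ((a :* a :+ b :* b) :+ (c :* c :+ d :* d) :+ ((a :* c :+ b :* d) :+ (a :* c :+ b :* d)))) refl h u₁ u₂ v₁ v₂)
      (trans (*-congˡ (+-cong (+-cong UU VV) (+-cong UV UV)))
        (trans (solve 1 (λ h → h :* h :* ((con 1ℤ :+ con 1ℤ) :+ (con 0ℤ :+ con 0ℤ)) := h :* h :+ h :* h) refl h) 2hh≈1)))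
    (trans (solve 5 (λ h a b c d →
        h :* (a :- c) :* (h :* (a :- c)) :+ h :* (b :- d) :* (h :* (b :- d)) :=
        h :* h :* ((a :* a :+ b :* b) :+ (c :* c :+ d :* d) :- ((a :* c :+ b :* d) :+ (a :* c :+ b :* d)))) refl h u₁ u₂ v₁ v₂)
      (trans (*-congˡ (+-cong (+-cong UU VV) (-‿cong (+-cong UV UV))))
        (trans (solve 1 (λ h → h :* h :* ((con 1ℤ :+ con 1ℤ) :- (con 0ℤ :+ con 0ℤ)) := h :* h :+ h :* h) refl h) 2hh≈1)))
    (trans (solve 5 (λ h a b c d →
        h :* (a :+ c) :* (h :* (a :- c)) :+ h :* (b :+ d) :* (h :* (b :- d)) :=
        h :* h :* ((a :* a :+ b :* b) :- (c :* c :+ d :* d))) refl h u₁ u₂ v₁ v₂)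
      (trans (*-congˡ (+-cong UU (-‿cong VV)))
        (solve 1 (λ h → h :* h :* (con 1ℤ :- con 1ℤ) := con 0ℤ) refl h)))

  act-orthonormal : ∀ g {φ} → Orthonormal φ → Orthonormal (actFrame g φ)
  act-orthonormal []      o = o
  act-orthonormal (r ∷ g) o = act-orthonormal g (reflect-orthonormal r o)

  square≈1 : ∀ {x} → x * x ≈ 1# → x ≈ 1# ⊎ x ≈ - 1#
  square≈1 {x} e with em {P = x + 1# ≈ 0#}
  ... | yes z = inj₂ (trans (solve 1 (λ x → x := (x :+ con 1ℤ) :- con 1ℤ) refl x)
    (trans (+-congʳ z) (+-identityˡ _)))
  ... | no z  = inj₁ (trans (solve 1 (λ x → x := (x :- con 1ℤ) :+ con 1ℤ) refl x)
      (trans (+-congʳ (*-cancel-≈0 (trans (solve 1 (λ x → (x :- con 1ℤ) :* (x :+ con 1ℤ) := x :* x :- con 1ℤ) refl x)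
                                          (trans (+-congʳ e) (-‿inverseʳ 1#))) z))
             (+-identityˡ _)))

  onAxes : Point → Symmetry → Lat → Point
  onAxes o g u = o ⊕ emb (act g u)

  act-rot : ∀ j → act (rot (toℕ j)) (unit d0) ≡ unit j
  act-rot = toWitness {a? = all? λ j → act (rot (toℕ j)) (unit d0) ≟L unit j} _

  module _ {φ : Frame} (on : Orthonormal φ) where
    private
      frame-onAxes : ∀ {ψ} → Orthonormal ψ → U ψ ≈ₚ e₁ → ∃ λ g → ∀ u → at ψ u ≈ₚ onAxes (O ψ) g u
      frame-onAxes {frame (o₁ , o₂) (u₁ , u₂) (v₁ , v₂)} (orthonormal UU VV UV) (a , b) =
        Sum.[ upward , downward ]′ (square≈1 v₂²≈1)
        where
        Target : Set
        Target = ∃ λ g → ∀ u → at (frame (o₁ , o₂) (u₁ , u₂) (v₁ , v₂)) u ≈ₚ onAxes (o₁ , o₂) g u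
        v₁≈0 : v₁ ≈ 0#
        v₁≈0 = trans (solve 2 (λ x y → x := con 1ℤ :* x :+ con 0ℤ :* y) refl v₁ v₂)
          (trans (sym (+-cong (*-congʳ a) (*-congʳ b))) UV)
        v₂²≈1 : v₂ * v₂ ≈ 1#
        v₂²≈1 = trans (solve 1 (λ y → y :* y := con 0ℤ :* con 0ℤ :+ y :* y) refl v₂)
          (trans (+-congʳ (sym (*-cong v₁≈0 v₁≈0))) VV)
        first : ∀ x y → x * u₁ + y * v₁ ≈ x
        first x y = trans (+-cong (*-congˡ a) (*-congˡ v₁≈0))
          (solve 2 (λ x y → x :* con 1ℤ :+ y :* con 0ℤ := x) refl x y)
        upward : v₂ ≈ 1# → Target
        upward c = [] , λ u → +-congˡ (first _ _)
          , +-congˡ (trans (+-cong (*-congˡ b) (*-congˡ c))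
            (solve 2 (λ x y → x :* con 0ℤ :+ y :* con 1ℤ := y) refl _ _))
        downward : v₂ ≈ - 1# → Target
        downward c = 𝐀 ∷ [] , λ u → +-congˡ (trans (first _ _) (ev-cong (≡.sym (ℓ-reflect 𝐀 d0 u))))
          , +-congˡ (trans (+-cong (*-congˡ b) (*-congˡ c))
              (trans (solve 2 (λ x y → x :* con 0ℤ :+ y :* (:- con 1ℤ) := :- y) refl _ _)
                (trans (sym (ev-neg (ℓ d2 u))) (ev-cong (≡.sym (ℓ-reflect 𝐀 d2 u))))))

      rotated : ∀ j → lin φ (emb (unit j)) ≈ₚ e₁ → ∃ λ g → ∀ u → at φ u ≈ₚ onAxes (O φ) g u
      rotated j e = g ++ reverse r , λ u →
        ≈ₚ-trans (≡.subst (λ v → at φ u ≈ₚ at φ v) (≡.sym (act-reverse r u)) ≈ₚ-refl)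
        (≈ₚ-trans (≈ₚ-sym (at-act r φ (act (reverse r) u)))
        (≈ₚ-trans (proj₂ standard (act (reverse r) u))
        (≡.subst₂ (λ o v → onAxes (O (actFrame r φ)) g (act (reverse r) u) ≈ₚ o ⊕ emb v)
          (actFrame-O r φ) (≡.sym (act-++ g (reverse r) u)) ≈ₚ-refl)))
        where
        r = rot (toℕ j)
        standard = frame-onAxes (act-orthonormal r on)
          (≈ₚ-trans (≈ₚ-sym (lin-d0 (actFrame r φ)))
            (≈ₚ-trans (lin-act r φ (unit d0)) (≡.subst (λ v → lin φ (emb v) ≈ₚ e₁) (≡.sym (act-rot j)) e)))
        g = proj₁ standard

      lin-opp : ∀ j → lin φ (emb (unit (opp j))) ≈ₚ (- 1#) · lin φ (emb (unit j))
      lin-opp j = ≈ₚ-trans (lin-cong φ (coordinate d0 , coordinate d2))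
        (one (proj₁ (U φ)) (proj₁ (V φ)) , one (proj₂ (U φ)) (proj₂ (V φ)))
        where
        opp-unit : ∀ m j → ℓ m (unit (opp j)) ≡ ⊟ ℓ m (unit j)
        opp-unit = toWitness {a? = all? λ m → all? λ j → ≡-dec ℤₚ._≟_ ℤₚ._≟_ (ℓ m (unit (opp j))) (⊟ ℓ m (unit j))} _
        coordinate : ∀ m → ev (ℓ m (unit (opp j))) ≈ - ev (ℓ m (unit j))
        coordinate m = trans (ev-cong (opp-unit m j)) (ev-neg (ℓ m (unit j)))
        one : ∀ a b → - ev (ℓ d0 (unit j)) * a + - ev (ℓ d2 (unit j)) * b ≈
                      (- 1#) * (ev (ℓ d0 (unit j)) * a + ev (ℓ d2 (unit j)) * b)
        one = solve 4 (λ x y a b → (:- x) :* a :+ (:- y) :* b := (:- con 1ℤ) :* (x :* a :+ y :* b)) refl _ _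

      unit-horizontal : ∀ j → lin φ (emb (unit j)) ∥ e₁ →
        lin φ (emb (unit j)) ≈ₚ e₁ ⊎ lin φ (emb (unit (opp j))) ≈ₚ e₁
      unit-horizontal j par = result (square≈1 x²)
        where
        r = rot (toℕ j)
        x y : Carrier
        x = proj₁ (lin φ (emb (unit j)))
        y = proj₂ (lin φ (emb (unit j)))
        U≈ : U (actFrame r φ) ≈ₚ (x , y)
        U≈ = ≈ₚ-trans (≈ₚ-sym (lin-d0 (actFrame r φ)))
          (≡.subst (λ v → lin (actFrame r φ) (emb (unit d0)) ≈ₚ lin φ (emb v)) (act-rot j) (lin-act r φ (unit d0)))
        y≈0 : y ≈ 0#
        y≈0 = trans (solve 2 (λ x y → y := :- (x :* con 0ℤ :- y :* con 1ℤ)) refl x y)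
          (trans (-‿cong par) -0#≈0#)
        x² : x * x ≈ 1#
        x² = trans (solve 1 (λ x → x :* x := x :* x :+ con 0ℤ :* con 0ℤ) refl x)
          (trans (+-congˡ (sym (*-cong y≈0 y≈0)))
            (trans (sym (+-cong (*-cong (proj₁ U≈) (proj₁ U≈)) (*-cong (proj₂ U≈) (proj₂ U≈))))
              (Orthonormal.UU (act-orthonormal r on))))
        result : x ≈ 1# ⊎ x ≈ - 1# → _
        result (inj₁ e) = inj₁ (e , y≈0)
        result (inj₂ e) = inj₂ (≈ₚ-trans (lin-opp j)
          ( trans (*-congˡ e) (solve 0 ((:- con 1ℤ) :* (:- con 1ℤ) := con 1ℤ) refl)
          , trans (*-congˡ y≈0) (zeroʳ _)))

    -- Rotating the horizontal unit vector onto the first axis leaves an orthonormal frame whose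
    -- second axis is vertical up to sign, and `𝐀` absorbs the sign. Thus the frame differs from the
    -- standard axes by a symmetry of the lattice and a translation.
    axes : ∀ j → lin φ (emb (unit j)) ∥ e₁ → ∃ λ g → ∀ u → at φ u ≈ₚ onAxes (O φ) g u
    axes j par = Sum.[ rotated j , rotated (opp j) ] (unit-horizontal j par)

  ∥-e₁ : ∀ {p} → p ∥ e₁ → proj₂ p ≈ 0#
  ∥-e₁ {x , y} par = trans (solve 2 (λ x y → y := :- (x :* con 0ℤ :- y :* con 1ℤ)) refl x y)
    (trans (-‿cong par) -0#≈0#)

  e₁-∥ : ∀ {p} → proj₂ p ≈ 0# → p ∥ e₁
  e₁-∥ {x , y} e = trans (solve 2 (λ x y → x :* con 0ℤ :- y :* con 1ℤ := :- y) refl x y)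
    (trans (-‿cong e) -0#≈0#)

  step-horizontal : ∀ φ l j → lin φ (emb (step l j)) ∥ e₁ → lin φ (emb (unit j)) ∥ e₁
  step-horizontal φ false j par = par
  step-horizontal φ true  j par = e₁-∥ {lin φ (emb (unit j))}
    (*-cancel-≈0 (trans (*-comm _ _) (trans (sym scaled) (∥-e₁ {lin φ (emb (step true j))} par))) √2≉0)
    where
    √2≉0 : ¬ √2 ≈ 0#
    √2≉0 e = proj₂ h-positive (sym (halve-≈0 (trans h+h≈√2 e)))
    scaled : proj₂ (lin φ (emb (mul√2 (unit j)))) ≈ √2 * proj₂ (lin φ (emb (unit j)))
    scaled = trans (+-cong (*-congʳ (coordinate d0)) (*-congʳ (coordinate d2)))
      (solve 5 (λ s x y a b → s :* x :* a :+ s :* y :* b := s :* (x :* a :+ y :* b)) refl √2 _ _ _ _)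
      where
      coordinate : ∀ m → ev (ℓ m (mul√2 (unit j))) ≈ √2 * ev (ℓ m (unit j))
      coordinate m = trans (ev-cong (ℓ-mul√2 m (unit j))) (ev-mul√2 (ℓ m (unit j)))

  normalEdge-horizontal : ∀ φ {s} (n : NormalEdge (at φ) s) → direction s ∥ e₁ →
                          lin φ (emb (unit (NormalEdge.index n ↑ˡ 4))) ∥ e₁
  normalEdge-horizontal φ {s} (normalEdge i l u s≈ _ _) par =
    step-horizontal φ l (i ↑ˡ 4) (e₁-∥ {lin φ (emb (step l (i ↑ˡ 4)))} (vertical s≈))
    where
    δ = step l (i ↑ˡ 4)
    vertical : s ≈ₛ (at φ u , at φ (u ⊹ δ)) → proj₂ (lin φ (emb δ)) ≈ 0#
    vertical (inj₁ (a , b)) = trans (sym (proj₂ (at-difference φ u δ)))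
      (trans (sym (proj₂ (⊖-cong b a))) (∥-e₁ {direction s} par))
    vertical (inj₂ (a , b)) = trans (sym (proj₂ (at-difference φ u δ)))
      (trans (sym (proj₂ (⊖-cong a b)))
        (trans (solve 2 (λ x y → x :- y := :- (y :- x)) refl _ _)
          (trans (-‿cong (∥-e₁ {direction s} par)) -0#≈0#)))

  edge-axes : ∀ {φ s} → Orthonormal φ → NormalEdge (at φ) s → direction s ∥ e₁ →
              ∃ λ g → ∀ u → at φ u ≈ₚ onAxes (O φ) g u
  edge-axes {φ} on n par = axes on (NormalEdge.index n ↑ˡ 4) (normalEdge-horizontal φ n par)

  tile-axes : ∀ {φ t} → Orthonormal φ → NormalTile (at φ) t →
              Any (λ s → direction s ∥ e₁) (sides t) → ∃ λ g → ∀ u → at φ u ≈ₚ onAxes (O φ) g u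
  tile-axes {φ} {t} on n side = let (s , s∈ , par) = find side in
    edge-axes {φ} {s} on (normalTile-side n s∈) par
    where
    find : ∀ {ss} → Any (λ s → direction s ∥ e₁) ss → ∃ λ s → Any (s ≈ₛ_) ss × direction s ∥ e₁
    find (here {x = s} par) = s , here (inj₁ (≈ₚ-refl , ≈ₚ-refl)) , par
    find (there any) = let (s , a , par) = find any in s , there a , par

  standardise : ∀ {φ F} g → (∀ u → at φ u ≈ₚ onAxes (O φ) g u) → All (CopyAt (at φ)) F →
                All (NormalTile (λ u → O φ ⊕ emb u)) F
  standardise g e = All.map λ (t′ , t≈t′ , t′-at) → normalise t≈t′ (tileAt-act g e t′-at)

  -- The tile with the horizontal side is adjoined to `F`, as it fixes the axes of the frame in
  -- which `F` is found. The origin `o` still depends on `F`, so tiles to be compared must be passed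
  -- in one list.
  normalTiles : ∀ {T : Pred Tile 0ℓ} → IsAmmannBeenkerTiling T → HasHorizontalRhombusSide T →
    ∀ F → All (_∈ T) F → ∃ λ o → All (NormalTile (λ u → o ⊕ emb u)) F
  normalTiles ab (t , t∈T , _ , side) F F⊆T =
    from-copies (contained⇒copies (IsAmmannBeenkerTiling.supertiles ab (t ∷ F) (t∈T ∷ F⊆T)))
    where
    from-copies : (∃ λ φ → Orthonormal φ × All (CopyAt (at φ)) (t ∷ F)) →
                  ∃ λ o → All (NormalTile (λ u → o ⊕ emb u)) F
    from-copies (φ , on , (t₀ , t≈t₀ , t₀-at) ∷ copies) =
      let (g , e) = tile-axes on (normalise t≈t₀ t₀-at) side
      in O φ , standardise g e copies

  -- Collinear edges


  -- Half the sum of the slack of `v` in direction `m` and that of `u` in the opposite direction.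
  octagon-difference : ∀ m {u v} → InOctagon u → InOctagon v →
    Positive (ev (octagon ⊟ conj (ℓ m v ⊟ ℓ m u)))
  octagon-difference m {u} {v} ou ov = halve-positive (positive-resp
    (trans (sym (ev-⊞ (slack octagon m v) (slack octagon (opp m) u)))
      (trans (ev-cong (≡.trans (≡.cong (λ z → slack octagon m v ⊞ (octagon ⊟ twice (conj z))) (ℓ-opp m u))
                               (identity (ℓ m u) (ℓ m v))))
             (ev-twice (octagon ⊟ conj (ℓ m v ⊟ ℓ m u)))))
    (+-positive (ov m) (proj₁ (ou (opp m)))))
    where
    one : ∀ k p q → (k ℤ.- + 2 ℤ.* q) ℤ.+ (k ℤ.- + 2 ℤ.* (ℤ.- p)) ≡ + 2 ℤ.* (k ℤ.- (q ℤ.- p))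
    one = solve-∀
    two : ∀ k p q → (k ℤ.- + 2 ℤ.* (ℤ.- q)) ℤ.+ (k ℤ.- + 2 ℤ.* (ℤ.- (ℤ.- p))) ≡ + 2 ℤ.* (k ℤ.- (ℤ.- (q ℤ.- p)))
    two = solve-∀
    identity : ∀ y z → (octagon ⊟ twice (conj z)) ⊞ (octagon ⊟ twice (conj (⊟ y))) ≡
                       twice (octagon ⊟ conj (z ⊟ y))
    identity (p , q) (p′ , q′) = ≡.cong₂ _,_ (one 1ℤ p p′) (two (+ 2) q q′)

  octagon-difference₊ : ∀ m {u v} → InOctagon u → InOctagon v →
    Positive (ev (octagon ⊞ conj (ℓ m v ⊟ ℓ m u)))
  octagon-difference₊ m {u} {v} ou ov = ≡.subst (λ z → Positive (ev z))
    (≡.trans (≡.cong (λ z → octagon ⊟ conj z) (≡.sym (⊟-swap (ℓ m v) (ℓ m u)))) (⊞-conj octagon (ℓ m v ⊟ ℓ m u)))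
    (octagon-difference m ov ou)

  -- Bounding the conjugate spares us the irrationality of √2.
  ev≈0⇒≡0 : ∀ {z} → ev z ≈ 0# → Positive (ev (octagon ⊞ conj z)) → Positive (ev (octagon ⊟ conj z)) →
            z ≡ (0ℤ , 0ℤ)
  ev≈0⇒≡0 {p , q} e a b = result
    (trit-range (first p q e a) (neg-bound (+ 2) (first (ℤ.- p) (ℤ.- q) e₋ b)))
    (trit-range (second p q e b) (neg-bound (+ 2) (second (ℤ.- p) (ℤ.- q) e₋ a′)))
    where
    e₋ : ev (⊟ (p , q)) ≈ 0#
    e₋ = trans (ev-neg (p , q)) (trans (-‿cong e) -0#≈0#)
    a′ : Positive (ev (octagon ⊟ conj (⊟ (p , q))))
    a′ = ≡.subst₂ (λ x y → Positive (ev (1ℤ ℤ.+ x , + 2 ℤ.+ y))) (≡.sym (ℤₚ.neg-involutive p))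
      (≡.sym (ℤₚ.neg-involutive (ℤ.- q))) a
    shift : ∀ x z {y} → Positive (ev x) → ev z ≈ 0# → x ⊞ z ≡ y → Positive (ev y)
    shift x z px e ≡.refl = positive-resp
      (sym (trans (ev-⊞ x z) (trans (+-congˡ e) (+-identityʳ _)))) px
    first : ∀ p q → ev (p , q) ≈ 0# → Positive (ev (octagon ⊞ conj (p , q))) → -[1+ 1 ] ℤ.< p
    first p q e a = linear-cancel 2 {1ℤ} (bound₁ -[1+ 1 ]
      (shift (octagon ⊞ conj (p , q)) (p , q) a e (≡.cong₂ _,_ (f p) (g q)))
      (from-yes (pos? (⊟ (-[1+ 1 ] , + 2)))))
      where
      f : ∀ p → (1ℤ ℤ.+ p) ℤ.+ p ≡ 1ℤ ℤ.+ + 2 ℤ.* p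
      f = solve-∀
      g : ∀ q → (+ 2 ℤ.+ (ℤ.- q)) ℤ.+ q ≡ + 2
      g = solve-∀
    second : ∀ p q → ev (p , q) ≈ 0# → Positive (ev (octagon ⊟ conj (p , q))) → -[1+ 1 ] ℤ.< q
    second p q e b = linear-cancel 2 {+ 2} (bound₂ -[1+ 1 ]
      (shift (octagon ⊟ conj (p , q)) (p , q) b e (≡.cong₂ _,_ (f p) (g q)))
      (from-yes (pos? (⊟ (1ℤ , -[1+ 1 ])))))
      where
      f : ∀ p → (1ℤ ℤ.- p) ℤ.+ p ≡ 1ℤ
      f = solve-∀
      g : ∀ q → (+ 2 ℤ.- (ℤ.- q)) ℤ.+ q ≡ + 2 ℤ.+ + 2 ℤ.* q
      g = solve-∀
    sign : ∀ s t → (trit s , trit t) ≡ (0ℤ , 0ℤ) ⊎ Apart (trit s , trit t)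
    sign = toWitness {a? = all? λ s → all? λ t → ≡-dec ℤₚ._≟_ ℤₚ._≟_ (trit s , trit t) (0ℤ , 0ℤ) ⊎-dec
      apart? (trit s , trit t)} _
    result : (∃ λ t → p ≡ trit t) → (∃ λ t → q ≡ trit t) → (p , q) ≡ (0ℤ , 0ℤ)
    result (s , ≡.refl) (t , ≡.refl) =
      Sum.[ (λ x → x) , (λ x → contradiction x (≈0⇒¬Apart e)) ]′ (sign s t)

  -- An overlap forces |β| < √2, as edges have length at most √2, and the octagon forces the
  -- conjugate of β below 1 + √2 in absolute value. Together they leave three values for each of p
  -- and n, and `no-overlap` does the rest.
  overlap-impossible : ∀ {β} l l′ n → proj₂ β ≡ + 2 ℤ.* n →
    All (λ z → Positive (ev z)) (overlapBounds β l l′) → β ≡ (0ℤ , 0ℤ) × l ≡ l′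
  overlap-impossible {p , k} l l′ n k≡2n bounds@(b₁ ∷ b₂ ∷ b₃ ∷ b₄ ∷ _) = result
    (trit-range (first p k (longer l′ p k b₁) b₄) (neg-bound (+ 2) (first (ℤ.- p) (ℤ.- k) longer₋ b₃)))
    (trit-range (halve n (≡.subst (-[1+ 3 ] ℤ.<_) k≡2n (second p k (longer l′ p k b₁) b₃)))
      (neg-bound (+ 2) (halve (ℤ.- n) (≡.subst (-[1+ 3 ] ℤ.<_)
        (≡.trans (≡.cong ℤ.-_ k≡2n) (ℤₚ.neg-distribʳ-* (+ 2) n)) (second (ℤ.- p) (ℤ.- k) longer₋ b₄′)))))
    where
    longer : ∀ l p k → Positive (ev ((p , k) ⊞ edgeLength l)) → Positive (ev ((0ℤ , + 2) ⊞ (p , k)))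
    longer l p k b = positive-resp
      (trans (sym (ev-⊞ ((p , k) ⊞ edgeLength l) ((0ℤ , + 2) ⊟ edgeLength l)))
        (ev-cong (≡.cong₂ _,_ (f (proj₁ (edgeLength l)) p 0ℤ) (f (proj₂ (edgeLength l)) k (+ 2)))))
      (+-positive b (ev-nonneg (short l)))
      where
      short : ∀ l → NonNeg ((0ℤ , + 2) ⊟ edgeLength l)
      short = toWitness {a? = all-bool? λ l → nonNeg? ((0ℤ , + 2) ⊟ edgeLength l)} _
      f : ∀ e p k → (p ℤ.+ e) ℤ.+ (k ℤ.- e) ≡ k ℤ.+ p
      f = solve-∀
    longer₋ : Positive (ev ((0ℤ , + 2) ⊞ ⊟ (p , k)))
    longer₋ = longer l (ℤ.- p) (ℤ.- k) (≡.subst₂ (λ x y → Positive (ev (x , y)))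
      (ℤₚ.+-comm (proj₁ (edgeLength l)) (ℤ.- p)) (ℤₚ.+-comm (proj₂ (edgeLength l)) (ℤ.- k)) b₂)
    b₄′ : Positive (ev (octagon ⊟ conj (⊟ (p , k))))
    b₄′ = ≡.subst₂ (λ x y → Positive (ev (1ℤ ℤ.+ x , + 2 ℤ.+ y))) (≡.sym (ℤₚ.neg-involutive p))
      (≡.sym (ℤₚ.neg-involutive (ℤ.- k))) b₄
    add : ∀ z w {v} → Positive (ev z) → Positive (ev w) → z ⊞ w ≡ v → Positive (ev v)
    add z w a b e = positive-resp (trans (sym (ev-⊞ z w)) (ev-cong e)) (+-positive a (proj₁ b))
    first : ∀ p k → Positive (ev ((0ℤ , + 2) ⊞ (p , k))) → Positive (ev (octagon ⊞ conj (p , k))) → -[1+ 1 ] ℤ.< p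
    -- Adding the inequality for β and the one for its conjugate removes k: 1 + 2p + 4h > 0, while
    -- 4h < 3.
    first p k a b = linear-cancel 2 {1ℤ} (bound₁ -[1+ 2 ]
      (add ((0ℤ , + 2) ⊞ (p , k)) (octagon ⊞ conj (p , k)) a b (≡.cong₂ _,_ (f p) (g k)))
      (from-yes (pos? (⊟ (-[1+ 2 ] , + 4)))))
      where
      f : ∀ p → (0ℤ ℤ.+ p) ℤ.+ (1ℤ ℤ.+ p) ≡ 1ℤ ℤ.+ + 2 ℤ.* p
      f = solve-∀
      g : ∀ k → (+ 2 ℤ.+ k) ℤ.+ (+ 2 ℤ.+ ℤ.- k) ≡ + 4
      g = solve-∀
    second : ∀ p k → Positive (ev ((0ℤ , + 2) ⊞ (p , k))) → Positive (ev (octagon ⊟ conj (p , k))) → -[1+ 3 ] ℤ.< k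
    -- With the other sign of the conjugate p drops out: 1 + (4 + 2k) h > 0, while 1 - 2h < 0.
    second p k a b = linear-cancel 2 {+ 4} (bound₂ -[1+ 1 ]
      (add ((0ℤ , + 2) ⊞ (p , k)) (octagon ⊟ conj (p , k)) a b (≡.cong₂ _,_ (f p) (g k)))
      (from-yes (pos? (⊟ (1ℤ , -[1+ 1 ])))))
      where
      f : ∀ p → (0ℤ ℤ.+ p) ℤ.+ (1ℤ ℤ.- p) ≡ 1ℤ
      f = solve-∀
      g : ∀ k → (+ 2 ℤ.+ k) ℤ.+ (+ 2 ℤ.- ℤ.- k) ≡ + 4 ℤ.+ + 2 ℤ.* k
      g = solve-∀
    halve : ∀ n → -[1+ 3 ] ℤ.< + 2 ℤ.* n → -[1+ 1 ] ℤ.< n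
    halve n lt = linear-cancel 2 {0ℤ} (≡.subst (-[1+ 3 ] ℤ.<_) (≡.sym (ℤₚ.+-identityˡ (+ 2 ℤ.* n))) lt)
    result : (∃ λ t → p ≡ trit t) → (∃ λ t → n ≡ trit t) → (p , k) ≡ (0ℤ , 0ℤ) × l ≡ l′
    result (s , ≡.refl) (t , n≡) = decide (no-overlap s t l l′)
      where
      k≡ : k ≡ + 2 ℤ.* trit t
      k≡ = ≡.trans k≡2n (≡.cong (+ 2 ℤ.*_) n≡)
      decide : (trit s ≡ 0ℤ × trit t ≡ 0ℤ × l ≡ l′) ⊎
               Any (λ z → NonNeg (⊟ z)) (overlapBounds (trit s , + 2 ℤ.* trit t) l l′) →
               (trit s , k) ≡ (0ℤ , 0ℤ) × l ≡ l′
      decide (inj₁ (a , b , c)) = ≡.cong₂ _,_ a (≡.trans k≡ (≡.cong (+ 2 ℤ.*_) b)) , c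
      decide (inj₂ any) =
        let (a , b) = All.lookupAny (≡.subst (λ y → All (λ z → Positive (ev z)) (overlapBounds (trit s , y) l l′)) k≡ bounds) any
        in contradiction b (positive⇒¬NonNeg a)

  ℓ-step : ∀ l (m : Fin 4) → ℓ (m ↑ˡ 4) (step l (m ↑ˡ 4)) ≡ edgeLength l ×
    ℓ (quarter m) (step l (m ↑ˡ 4)) ≡ (0ℤ , 0ℤ)
  ℓ-step = toWitness {a? = all-bool? λ l → all? λ m →
    ≡-dec ℤₚ._≟_ ℤₚ._≟_ (ℓ (m ↑ˡ 4) (step l (m ↑ˡ 4))) (edgeLength l) ×-dec
    ≡-dec ℤₚ._≟_ ℤₚ._≟_ (ℓ (quarter m) (step l (m ↑ˡ 4))) (0ℤ , 0ℤ)} _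

  -- If neither edge ends before the other begins, they overlap. The offset of their bases has
  -- vanishing transverse part in the field and a bounded conjugate, hence vanishing transverse part
  -- in the lattice; so it equals p + n√2 along the line, and the table of overlaps applies.
  collinear : ∀ (m : Fin 4) l l′ {u u′} →
    InOctagon u → InOctagon (u ⊹ step l (m ↑ˡ 4)) → InOctagon u′ → InOctagon (u′ ⊹ step l′ (m ↑ˡ 4)) →
    ev (ℓ (quarter m) u) ≈ ev (ℓ (quarter m) u′) →
    (u ≡ u′ × l ≡ l′) ⊎
    ev (ℓ (m ↑ˡ 4) u) + ev (edgeLength l) ≤ ev (ℓ (m ↑ˡ 4) u′) ⊎
    ev (ℓ (m ↑ˡ 4) u′) + ev (edgeLength l′) ≤ ev (ℓ (m ↑ˡ 4) u)
  collinear m l l′ {u} {u′} o₁ o₂ o₃ o₄ e = decide em em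
    where
    i = m ↑ˡ 4
    j = quarter m
    D = u′ ⊹ neg u
    α = edgeLength l
    γ = edgeLength l′
    β = ℓ i u′ ⊟ ℓ i u
    ℓ-D : ∀ k → ℓ k D ≡ ℓ k u′ ⊟ ℓ k u
    ℓ-D k = ≡.trans (ℓ-⊹ k u′ (neg u)) (≡.cong (ℓ k u′ ⊞_) (ℓ-neg k u))
    orthogonal : ℓ j D ≡ (0ℤ , 0ℤ)
    orthogonal = ≡.trans (ℓ-D j) (ev≈0⇒≡0
      (trans (ev-⊟ (ℓ j u′) (ℓ j u)) (trans (+-congʳ (sym e)) (-‿inverseʳ _)))
      (octagon-difference₊ j {u} {u′} o₁ o₃) (octagon-difference j {u} {u′} o₁ o₃))
    tip : ∀ u l → ℓ i (u ⊹ step l i) ≡ ℓ i u ⊞ edgeLength l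
    tip u l = ≡.trans (ℓ-⊹ i u (step l i)) (≡.cong (ℓ i u ⊞_) (proj₁ (ℓ-step l m)))
    s₁ : ∀ a b c → (a ⊞ c) ⊟ b ≡ (a ⊟ b) ⊞ c
    s₁ (a , a′) (b , b′) (c , c′) = ≡.cong₂ _,_ (f a b c) (f a′ b′ c′)
      where f : ∀ a b c → (a ℤ.+ c) ℤ.- b ≡ (a ℤ.- b) ℤ.+ c
            f = solve-∀
    s₂ : ∀ a b c → a ⊟ (b ⊞ c) ≡ (a ⊟ b) ⊟ c
    s₂ (a , a′) (b , b′) (c , c′) = ≡.cong₂ _,_ (f a b c) (f a′ b′ c′)
      where f : ∀ a b c → a ℤ.- (b ℤ.+ c) ≡ (a ℤ.- b) ℤ.- c
            f = solve-∀
    β-tip′ : ℓ i (u′ ⊹ step l′ i) ⊟ ℓ i u ≡ β ⊞ γ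
    β-tip′ = ≡.trans (≡.cong (λ z → z ⊟ ℓ i u) (tip u′ l′)) (s₁ (ℓ i u′) (ℓ i u) γ)
    β-tip : ℓ i u′ ⊟ ℓ i (u ⊹ step l i) ≡ β ⊟ α
    β-tip = ≡.trans (≡.cong (λ z → ℓ i u′ ⊟ z) (tip u l)) (s₂ (ℓ i u′) (ℓ i u) α)
    β-tips : ℓ i (u′ ⊹ step l′ i) ⊟ ℓ i (u ⊹ step l i) ≡ β ⊞ γ ⊟ α
    β-tips = ≡.trans (≡.cong₂ (λ z w → z ⊟ w) (tip u′ l′) (tip u l))
      (≡.trans (s₂ (ℓ i u′ ⊞ γ) (ℓ i u) α) (≡.cong (λ z → z ⊟ α) (s₁ (ℓ i u′) (ℓ i u) γ)))
    minus : ∀ {u v z} → InOctagon u → InOctagon v → ℓ i v ⊟ ℓ i u ≡ z → Positive (ev (octagon ⊟ conj z))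
    minus {u} {v} a b e = ≡.subst (λ z → Positive (ev (octagon ⊟ conj z))) e (octagon-difference i {u} {v} a b)
    plus : ∀ {u v z} → InOctagon u → InOctagon v → ℓ i v ⊟ ℓ i u ≡ z → Positive (ev (octagon ⊞ conj z))
    plus {u} {v} a b e = ≡.subst (λ z → Positive (ev (octagon ⊞ conj z))) e (octagon-difference₊ i {u} {v} a b)
    bounds : Positive (ev (β ⊞ γ)) → Positive (ev (α ⊟ β)) → All (λ z → Positive (ev z)) (overlapBounds β l l′)
    bounds x y = x ∷ y ∷ minus {u} {u′} o₁ o₃ ≡.refl ∷ plus {u} {u′} o₁ o₃ ≡.refl
      ∷ minus {u} o₁ o₄ β-tip′ ∷ plus {u} o₁ o₄ β-tip′
      ∷ minus {v = u′} o₂ o₃ β-tip ∷ plus {v = u′} o₂ o₃ β-tip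
      ∷ minus o₂ o₄ β-tips ∷ plus o₂ o₄ β-tips ∷ []
    regroup : ev (α ⊟ β) ≈ - (ev (ℓ i u′) - (ev (ℓ i u) + ev α))
    regroup = trans (ev-⊟ α β) (trans (+-congˡ (-‿cong (ev-⊟ (ℓ i u′) (ℓ i u))))
      (solve 3 (λ a b c → c :- (a :- b) := :- (a :- (b :+ c))) refl (ev (ℓ i u′)) (ev (ℓ i u)) (ev α)))
    regroup′ : ev (β ⊞ γ) ≈ - (ev (ℓ i u) - (ev (ℓ i u′) + ev γ))
    regroup′ = trans (ev-⊞ β γ) (trans (+-congʳ (ev-⊟ (ℓ i u′) (ℓ i u)))
      (solve 3 (λ a b c → (a :- b) :+ c := :- (b :- (a :+ c))) refl (ev (ℓ i u′)) (ev (ℓ i u)) (ev γ)))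
    coincide : β ≡ (0ℤ , 0ℤ) → u ≡ u′
    coincide β≡0 = ≡.sym (begin
      u′                   ≡⟨ ⊹-identityʳ u′ ⟨
      u′ ⊹ 𝟎               ≡⟨ ≡.cong (u′ ⊹_) (⊹-inverseʳ u) ⟨
      u′ ⊹ (u ⊹ neg u)     ≡⟨ ≡.cong (u′ ⊹_) (⊹-comm u (neg u)) ⟩
      u′ ⊹ (neg u ⊹ u)     ≡⟨ ⊹-assoc u′ (neg u) u ⟨
      D ⊹ u                ≡⟨ ≡.cong (_⊹ u) (proj₂ (proj₂ (axial m D orthogonal)) (≡.trans (ℓ-D i) β≡0)) ⟩
      𝟎 ⊹ u                ≡⟨ ⊹-identityˡ u ⟩
      u                    ∎)
      where open ≡.≡-Reasoning
    decide : Dec (Nonneg (ev (ℓ i u′) - (ev (ℓ i u) + ev α))) → Dec (Nonneg (ev (ℓ i u) - (ev (ℓ i u′) + ev γ))) → _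
    decide (yes p) _ = inj₂ (inj₁ (nonneg⇒≤ p))
    decide (no _) (yes q) = inj₂ (inj₂ (nonneg⇒≤ q))
    decide (no ¬p) (no ¬q) =
      let (β≡0 , l≡l′) = overlap-impossible l l′ (proj₁ (axial m D orthogonal))
            (≡.trans (≡.cong proj₂ (≡.sym (ℓ-D i))) (proj₁ (proj₂ (axial m D orthogonal))))
            (bounds (strict ¬q regroup′) (strict ¬p regroup))
      in inj₁ (coincide β≡0 , l≡l′)
      where
      strict : ∀ {x y} → ¬ Nonneg y → x ≈ - y → Positive x
      strict {x} {y} ¬n e = ¬nonneg-neg⇒positive λ n → ¬n (nonneg-resp
        (trans (-‿cong e) (solve 1 (λ y → :- (:- y) := y) refl y)) n)

  -- Vertices of degree eight

  -- The half-plane inequalities of the corners, weighted and added. The weights are not assumed to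
  -- have sum 1, which lets the induction drop one corner at a time.
  weighted-nonneg : ∀ ps (n : Point) b (w : Fin (length ps) → Carrier) → (∀ i → Nonneg (w i)) →
    All (λ p → Nonneg (b - dot n p)) ps →
    Nonneg (b * sum w - (proj₁ n * sum (λ i → w i * proj₁ (lookup ps i)) +
                         proj₂ n * sum (λ i → w i * proj₂ (lookup ps i))))
  weighted-nonneg [] (n₁ , n₂) b w _ [] = nonneg-resp
    (solve 3 (λ b n₁ n₂ → con 0ℤ := b :* con 0ℤ :- (n₁ :* con 0ℤ :+ n₂ :* con 0ℤ)) refl b n₁ n₂) ≤-refl
  weighted-nonneg ((x , y) ∷ ps) (n₁ , n₂) b w w≥0 (p ∷ rest) = nonneg-resp
    (solve 9 (λ b n₁ n₂ x y k S X Y →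
       k :* (b :- (n₁ :* x :+ n₂ :* y)) :+ (b :* S :- (n₁ :* X :+ n₂ :* Y)) :=
       b :* (k :+ S) :- (n₁ :* (k :* x :+ X) :+ n₂ :* (k :* y :+ Y))) refl
       b n₁ n₂ x y (w zero) (sum (w ∘ suc))
       (sum (λ i → w (suc i) * proj₁ (lookup ps i))) (sum (λ i → w (suc i) * proj₂ (lookup ps i))))
    (+-nonneg (*-nonNeg (w≥0 zero) p) (weighted-nonneg ps (n₁ , n₂) b (w ∘ suc) (w≥0 ∘ suc) rest))

  hull-halfplane : ∀ {ps q} n b → ConvexHull ps q → All (λ p → Nonneg (b - dot n p)) ps → Nonneg (b - dot n q)
  hull-halfplane {ps} (n₁ , n₂) b (w , w≥0 , sum≈1 , (x , y)) all = nonneg-resp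
    (+-cong (trans (*-congˡ sum≈1) (*-identityʳ b)) (-‿cong (+-cong (*-congˡ x) (*-congˡ y))))
    (weighted-nonneg ps (n₁ , n₂) b w w≥0 all)

  hull-resp : ∀ {ps q q′} → q ≈ₚ q′ → ConvexHull ps q → ConvexHull ps q′
  hull-resp e (w , w≥0 , s , x) = w , w≥0 , s , ≈ₚ-trans x e

  dot-unit : ∀ m u → dot (emb (unit m)) (emb u) ≈ ev (ℓ m u)
  dot-unit = λ where
      d0 u → first (ev (ℓ d0 u)) (ev (ℓ d2 u))
      d1 u → trans (second (ev (ℓ d0 u)) (ev (ℓ d2 u))) (sym (ev-d1 u))
      d2 u → third (ev (ℓ d0 u)) (ev (ℓ d2 u))
      d3 u → trans (fourth (ev (ℓ d0 u)) (ev (ℓ d2 u))) (sym (ev-d3 u))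
      d4 u → trans (fifth (ev (ℓ d0 u)) (ev (ℓ d2 u))) (sym (ev-neg (ℓ d0 u)))
      d5 u → trans (sixth (ev (ℓ d0 u)) (ev (ℓ d2 u))) (trans (-‿cong (sym (ev-d1 u))) (sym (ev-neg (ℓ d1 u))))
      d6 u → trans (seventh (ev (ℓ d0 u)) (ev (ℓ d2 u))) (sym (ev-neg (ℓ d2 u)))
      d7 u → trans (eighth (ev (ℓ d0 u)) (ev (ℓ d2 u))) (trans (-‿cong (sym (ev-d3 u))) (sym (ev-neg (ℓ d3 u))))
    where
    first : ∀ x y → ev (1ℤ , 0ℤ) * x + ev (0ℤ , 0ℤ) * y ≈ x
    first = solve 3 (λ h x y → (con 1ℤ :+ con 0ℤ :* h) :* x :+ (con 0ℤ :+ con 0ℤ :* h) :* y := x) refl h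
    second : ∀ x y → ev (0ℤ , 1ℤ) * x + ev (0ℤ , 1ℤ) * y ≈ h * (x + y)
    second = solve 3 (λ h x y → (con 0ℤ :+ con 1ℤ :* h) :* x :+ (con 0ℤ :+ con 1ℤ :* h) :* y := h :* (x :+ y)) refl h
    third : ∀ x y → ev (0ℤ , 0ℤ) * x + ev (1ℤ , 0ℤ) * y ≈ y
    third = solve 3 (λ h x y → (con 0ℤ :+ con 0ℤ :* h) :* x :+ (con 1ℤ :+ con 0ℤ :* h) :* y := y) refl h
    fourth : ∀ x y → ev (0ℤ , -1ℤ) * x + ev (0ℤ , 1ℤ) * y ≈ h * (y - x)
    fourth = solve 3 (λ h x y → (con 0ℤ :+ con -1ℤ :* h) :* x :+ (con 0ℤ :+ con 1ℤ :* h) :* y := h :* (y :- x)) refl h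
    fifth : ∀ x y → ev (-1ℤ , 0ℤ) * x + ev (0ℤ , 0ℤ) * y ≈ - x
    fifth = solve 3 (λ h x y → (con -1ℤ :+ con 0ℤ :* h) :* x :+ (con 0ℤ :+ con 0ℤ :* h) :* y := :- x) refl h
    sixth : ∀ x y → ev (0ℤ , -1ℤ) * x + ev (0ℤ , -1ℤ) * y ≈ - (h * (x + y))
    sixth = solve 3 (λ h x y → (con 0ℤ :+ con -1ℤ :* h) :* x :+ (con 0ℤ :+ con -1ℤ :* h) :* y := :-
      (h :* (x :+ y))) refl h
    seventh : ∀ x y → ev (0ℤ , 0ℤ) * x + ev (-1ℤ , 0ℤ) * y ≈ - y
    seventh = solve 3 (λ h x y → (con 0ℤ :+ con 0ℤ :* h) :* x :+ (con -1ℤ :+ con 0ℤ :* h) :* y := :- y) refl h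
    eighth : ∀ x y → ev (0ℤ , 1ℤ) * x + ev (0ℤ , -1ℤ) * y ≈ - (h * (y - x))
    eighth = solve 3 (λ h x y → (con 0ℤ :+ con 1ℤ :* h) :* x :+ (con 0ℤ :+ con -1ℤ :* h) :* y := :-
      (h :* (y :- x))) refl h

  placed : Point → Lat → Point
  placed o u = o ⊕ emb u

  dot-placed : ∀ m o u → dot (emb (unit m)) (placed o u) ≈ dot (emb (unit m)) o + ev (ℓ m u)
  dot-placed m (o₁ , o₂) u = trans (expand-dot (proj₁ (emb (unit m))) (proj₂ (emb (unit m))) o₁ o₂ (ev (ℓ d0 u))
    (ev (ℓ d2 u)))
                                   (+-congˡ (dot-unit m u))
    where
    expand-dot : ∀ a b x y x′ y′ → a * (x + x′) + b * (y + y′) ≈ (a * x + b * y) + (a * x′ + b * y′)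
    expand-dot = solve 6 (λ a b x y x′ y′ → a :* (x :+ x′) :+ b :* (y :+ y′) :=
      (a :* x :+ b :* y) :+ (a :* x′ :+ b :* y′)) refl

  dot-congʳ : ∀ n {p q} → p ≈ₚ q → dot n p ≈ dot n q
  dot-congʳ n (a , b) = +-cong (*-congˡ a) (*-congˡ b)

  -- Chosen so that (1 + √2) + (√2 - 1) = 2√2: seen from a central point, every point of the octagon
  -- has conjugates smaller than √2 in all eight directions. The number √2 - 1 is also the length of
  -- a spoke.
  central-bound : Num
  central-bound = -1ℤ , + 2

  Central : Lat → Set
  Central v = ∀ m → Nonneg (ev (slack central-bound m v))

  reposition : ∀ v w δ → w ⊹ δ ≡ v ⊹ ((w ⊹ neg v) ⊹ δ)
  reposition (lat a b c d) (lat a′ b′ c′ d′) (lat a″ b″ c″ d″) =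
    lat-≡ (f a a′ a″) (f b b′ b″) (f c c′ c″) (f d d′ d″)
    where
    f : ∀ v w δ → w ℤ.+ δ ≡ v ℤ.+ ((w ℤ.+ (ℤ.- v)) ℤ.+ δ)
    f = solve-∀

  -- The bounds on z and on its conjugate, added with either sign, leave three values of p and five
  -- of q; of these fifteen pairs the table `check` discards those that violate one of the four
  -- bounds.
  near-value : ∀ z → Nonneg (ev ((0ℤ , + 3) ⊞ z)) → Nonneg (ev ((0ℤ , + 3) ⊟ z)) →
    Positive (ev ((0ℤ , + 2) ⊞ conj z)) → Positive (ev ((0ℤ , + 2) ⊟ conj z)) → NearValue z
  near-value (p , q) a b c d = result
    (trit-range (first p q a c) (neg-bound (+ 2) (first (ℤ.- p) (ℤ.- q) b d)))
    (quint-range (second p q a d) (neg-bound (+ 3) (second (ℤ.- p) (ℤ.- q) b c′)))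
    where
    c′ : Positive (ev ((0ℤ , + 2) ⊟ conj (⊟ (p , q))))
    c′ = ≡.subst₂ (λ x y → Positive (ev (0ℤ ℤ.+ x , + 2 ℤ.+ y))) (≡.sym (ℤₚ.neg-involutive p))
      (≡.sym (ℤₚ.neg-involutive (ℤ.- q))) c
    quint : Fin 5 → ℤ
    quint = Vec.lookup (-[1+ 1 ] ∷ -1ℤ ∷ 0ℤ ∷ 1ℤ ∷ + 2 ∷ [])
    quint-range : ∀ {p} → -[1+ 2 ] ℤ.< p → p ℤ.< + 3 → ∃ λ t → p ≡ quint t
    quint-range {+ 0} _ _ = d2 , ≡.refl
    quint-range {+ 1} _ _ = d3 , ≡.refl
    quint-range {+ 2} _ _ = d4 , ≡.refl
    quint-range {+ suc (suc (suc n))} _ (ℤ.+<+ (ℕ.s≤s (ℕ.s≤s (ℕ.s≤s ()))))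
    quint-range { -[1+ 0 ]} _ _ = d1 , ≡.refl
    quint-range { -[1+ 1 ]} _ _ = d0 , ≡.refl
    quint-range { -[1+ suc (suc n) ]} (ℤ.-<- (ℕ.s≤s (ℕ.s≤s ()))) _
    add : ∀ z w {v} → Nonneg (ev z) → Positive (ev w) → w ⊞ z ≡ v → Positive (ev v)
    add z w a b e = positive-resp (trans (sym (ev-⊞ w z)) (ev-cong e)) (+-positive b a)
    first : ∀ p q → Nonneg (ev ((0ℤ , + 3) ⊞ (p , q))) → Positive (ev ((0ℤ , + 2) ⊞ conj (p , q))) → -[1+ 1 ] ℤ.< p
    first p q a c = linear-cancel 2 {0ℤ} (bound₁ -[1+ 3 ]
      (add ((0ℤ , + 3) ⊞ (p , q)) ((0ℤ , + 2) ⊞ conj (p , q)) a c (≡.cong₂ _,_ (f p) (g q)))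
      (from-yes (pos? (⊟ (-[1+ 3 ] , + 5)))))
      where
      f : ∀ p → (0ℤ ℤ.+ p) ℤ.+ (0ℤ ℤ.+ p) ≡ 0ℤ ℤ.+ + 2 ℤ.* p
      f = solve-∀
      g : ∀ q → (+ 2 ℤ.+ ℤ.- q) ℤ.+ (+ 3 ℤ.+ q) ≡ + 5
      g = solve-∀
    second : ∀ p q → Nonneg (ev ((0ℤ , + 3) ⊞ (p , q))) → Positive (ev ((0ℤ , + 2) ⊟ conj (p , q))) →
      -[1+ 2 ] ℤ.< q
    second p q a d = linear-cancel 2 {+ 5} (bound₂ {0ℤ} -1ℤ
      (add ((0ℤ , + 3) ⊞ (p , q)) ((0ℤ , + 2) ⊟ conj (p , q)) a d (≡.cong₂ _,_ (f p) (g q)))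
      (from-yes (pos? (⊟ (0ℤ , -1ℤ)))))
      where
      f : ∀ p → (0ℤ ℤ.- p) ℤ.+ (0ℤ ℤ.+ p) ≡ 0ℤ
      f = solve-∀
      g : ∀ q → (+ 2 ℤ.- ℤ.- q) ℤ.+ (+ 3 ℤ.+ q) ≡ + 5 ℤ.+ + 2 ℤ.* q
      g = solve-∀
    check : ∀ s t → let z = trit s , quint t in NearValue z ⊎
      Pos (⊟ ((0ℤ , + 3) ⊞ z)) ⊎ Pos (⊟ ((0ℤ , + 3) ⊟ z)) ⊎
      NonNeg (⊟ ((0ℤ , + 2) ⊞ conj z)) ⊎ NonNeg (⊟ ((0ℤ , + 2) ⊟ conj z))
    check = toWitness {a? = all? λ s → all? λ t → let z = trit s , quint t in nearValue? z ⊎-dec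
      pos? (⊟ ((0ℤ , + 3) ⊞ z)) ⊎-dec pos? (⊟ ((0ℤ , + 3) ⊟ z)) ⊎-dec
      nonNeg? (⊟ ((0ℤ , + 2) ⊞ conj z)) ⊎-dec nonNeg? (⊟ ((0ℤ , + 2) ⊟ conj z))} _
    negative : ∀ z → Pos (⊟ z) → ¬ Nonneg (ev z)
    negative z x y = positive⇒¬nonneg-neg (ev-positive x)
      (nonneg-resp (trans (solve 1 (λ x → x := :- (:- x)) refl (ev z)) (-‿cong (sym (ev-neg z)))) y)
    result : (∃ λ t → p ≡ trit t) → (∃ λ t → q ≡ quint t) → NearValue (p , q)
    result (s , ≡.refl) (t , ≡.refl) = decide (check s t)
      where
      z : Num
      z = trit s , quint t
      decide : _ → NearValue z
      decide (inj₁ n) = n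
      decide (inj₂ (inj₁ x)) = contradiction a (negative ((0ℤ , + 3) ⊞ z) x)
      decide (inj₂ (inj₂ (inj₁ x))) = contradiction b (negative ((0ℤ , + 3) ⊟ z) x)
      decide (inj₂ (inj₂ (inj₂ (inj₁ x)))) = contradiction x (positive⇒¬NonNeg c)
      decide (inj₂ (inj₂ (inj₂ (inj₂ x)))) = contradiction x (positive⇒¬NonNeg d)

  spoke-length : ∀ m k → NonNeg (central-bound ⊞ ℓ m (spoke k))
  spoke-length = toWitness {a? = all? λ m → all? λ k → nonNeg? (central-bound ⊞ ℓ m (spoke k))} _

  module _ (o : Point) (v : Lat) (central : Central v) (k : Fin 8) {t : Tile}
           (s : Shape) (i : Fin 8) (b : Bool) (w : Lat)
           (t≈ : t ≈ₜ realise (placed o) (mapL (w ⊹_) (oriented s i b)))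
           (oct : All (λ δ → InOctagon (w ⊹ δ)) (orientedOutline s i b))
           (covered : region t (placed o (v ⊹ spoke k))) where
    private
      D : Lat
      D = w ⊹ neg v

      hull-bound : ∀ m B → All (λ δ → Nonneg (ev (B ⊟ ℓ m (w ⊹ δ)))) (cornersL (oriented s i b)) →
                   Nonneg (ev (B ⊟ ℓ m (v ⊹ spoke k)))
      hull-bound m B all = nonneg-resp (relate (v ⊹ spoke k))
        (hull-halfplane {corners t} (emb (unit m)) (dot (emb (unit m)) o + ev B) covered
          (All.tabulate λ {c} c∈ → corner (Anyₚ.map⁻
            (≡.subst (Any (c ≈ₚ_)) (corners-realise (placed o) w (oriented s i b))
            (corners-resp t≈ (Any.map (λ { ≡.refl → ≈ₚ-refl }) c∈))))))
        where
        relate : ∀ u → (dot (emb (unit m)) o + ev B) - dot (emb (unit m)) (placed o u) ≈ ev (B ⊟ ℓ m u)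
        relate u = trans (+-congˡ (-‿cong (dot-placed m o u)))
          (trans (solve 3 (λ x y z → (x :+ y) :- (x :+ z) := y :- z) refl _ (ev B) (ev (ℓ m u)))
                 (sym (ev-⊟ B (ℓ m u))))
        corner : ∀ {c} → Any (λ u → c ≈ₚ placed o (w ⊹ u)) (cornersL (oriented s i b)) →
                 Nonneg ((dot (emb (unit m)) o + ev B) - dot (emb (unit m)) c)
        corner any = let (n , e) = All.lookupAny all any in
          nonneg-resp (trans (sym (relate (w ⊹ Any.lookup any)))
            (+-congˡ (-‿cong (dot-congʳ (emb (unit m)) (≈ₚ-sym e))))) n

      ℓ-relative : ∀ m δ → ℓ m (w ⊹ δ) ≡ ℓ m v ⊞ ℓ m (D ⊹ δ)
      ℓ-relative m δ = ≡.trans (≡.cong (ℓ m) (reposition v w δ)) (ℓ-⊹ m v (D ⊹ δ))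

      -- The covered point is at distance √2 - 1 from `v`, and the outline extends at most 1 + h in
      -- any of the eight directions; the sum of the two is 3h.
      physical : ∀ m {δ} → δ ∈ˡ orientedOutline s i b → Nonneg (ev ((0ℤ , + 3) ⊞ ℓ m (D ⊹ δ)))
      physical m {δ} δ∈ = nonneg-resp
        (trans (sym (ev-⊞ (((1ℤ , 1ℤ) ⊞ ℓ m (w ⊹ δ)) ⊟ ℓ m (v ⊹ spoke k)) (central-bound ⊞ ℓ m (spoke k))))
          (ev-cong (≡.trans (≡.cong₂ (λ x y → (((1ℤ , 1ℤ) ⊞ x) ⊟ y) ⊞ (central-bound ⊞ ℓ m (spoke k)))
                               (ℓ-relative m δ) (ℓ-⊹ m v (spoke k)))
                            (identity (ℓ m v) (ℓ m (D ⊹ δ)) (ℓ m (spoke k))))))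
        (+-nonneg (hull-bound m ((1ℤ , 1ℤ) ⊞ ℓ m (w ⊹ δ))
            (outline-corners s i b (All.map (λ {δ′} all →
              nonneg-resp (ev-cong (shifted δ′)) (ev-nonneg (All.lookup all δ∈ m)))
              (diameter s i b))))
          (ev-nonneg (spoke-length m k)))
        where
        identity : ∀ x y z → (((1ℤ , 1ℤ) ⊞ (x ⊞ y)) ⊟ (x ⊞ z)) ⊞ (central-bound ⊞ z) ≡ (0ℤ , + 3) ⊞ y
        identity (a , a′) (c , c′) (d , d′) = ≡.cong₂ _,_ (f 1ℤ -1ℤ a c d) (f 1ℤ (+ 2) a′ c′ d′)
          where
          f : ∀ k l a c d → ((k ℤ.+ (a ℤ.+ c)) ℤ.- (a ℤ.+ d)) ℤ.+ (l ℤ.+ d) ≡ (k ℤ.+ l) ℤ.+ c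
          f = solve-∀
        shifted : ∀ δ′ → (1ℤ , 1ℤ) ⊟ ℓ m δ′ ⊞ ℓ m δ ≡ ((1ℤ , 1ℤ) ⊞ ℓ m (w ⊹ δ)) ⊟ ℓ m (w ⊹ δ′)
        shifted δ′ = ≡.trans (f (ℓ m w) (ℓ m δ) (ℓ m δ′))
          (≡.sym (≡.cong₂ (λ x y → ((1ℤ , 1ℤ) ⊞ x) ⊟ y) (ℓ-⊹ m w δ) (ℓ-⊹ m w δ′)))
          where
          f : ∀ x y z → (1ℤ , 1ℤ) ⊟ z ⊞ y ≡ ((1ℤ , 1ℤ) ⊞ (x ⊞ y)) ⊟ (x ⊞ z)
          f (a , a′) (c , c′) (d , d′) = ≡.cong₂ _,_ (g a c d) (g a′ c′ d′)
            where g : ∀ a c d → (1ℤ ℤ.- d) ℤ.+ c ≡ (1ℤ ℤ.+ (a ℤ.+ c)) ℤ.- (a ℤ.+ d)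
                  g = solve-∀

      -- The slack in the octagon and the slack of the central point add up to a bound 2√2 on twice
      -- the conjugate.
      conjugate : ∀ m {δ} → δ ∈ˡ orientedOutline s i b → Positive (ev ((0ℤ , + 2) ⊞ conj (ℓ m (D ⊹ δ))))
      conjugate m {δ} δ∈ = halve-positive (positive-resp
        (trans (sym (ev-⊞ (slack octagon (opp m) (w ⊹ δ)) (slack central-bound m v)))
          (trans (ev-cong (≡.trans
              (≡.cong (λ z → (octagon ⊟ twice (conj z)) ⊞ slack central-bound m v)
                (≡.trans (ℓ-opp m (w ⊹ δ)) (≡.cong ⊟_ (ℓ-relative m δ))))
              (identity (ℓ m v) (ℓ m (D ⊹ δ)))))
            (ev-twice ((0ℤ , + 2) ⊞ conj (ℓ m (D ⊹ δ))))))
        (+-positive (All.lookup oct δ∈ (opp m)) (central m)))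
        where
        identity : ∀ x y → (octagon ⊟ twice (conj (⊟ (x ⊞ y)))) ⊞ (central-bound ⊟ twice (conj x)) ≡
                           twice ((0ℤ , + 2) ⊞ conj y)
        identity (a , a′) (c , c′) = ≡.cong₂ _,_ (f a c) (g a′ c′)
          where f : ∀ a c → (1ℤ ℤ.- + 2 ℤ.* (ℤ.- (a ℤ.+ c))) ℤ.+ (-1ℤ ℤ.- + 2 ℤ.* a) ≡ + 2 ℤ.* (0ℤ ℤ.+ c)
                f = solve-∀
                g : ∀ a c → (+ 2 ℤ.- + 2 ℤ.* (ℤ.- (ℤ.- (a ℤ.+ c)))) ℤ.+ (+ 2 ℤ.- + 2 ℤ.* (ℤ.- a)) ≡ + 2 ℤ.*
                  (+ 2 ℤ.+ ℤ.- c)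
                g = solve-∀

      near : ∀ {δ} → δ ∈ˡ orientedOutline s i b → Near (D ⊹ δ)
      near {δ} δ∈ m = near-value (ℓ m (D ⊹ δ)) (physical m δ∈)
        (≡.subst (λ z → Nonneg (ev z)) (flip (0ℤ , + 3)) (physical (opp m) δ∈))
        (conjugate m δ∈)
        (≡.subst (λ z → Positive (ev z)) (≡.trans (≡.cong (λ z → (0ℤ , + 2) ⊞ conj z) (ℓ-opp m (D ⊹ δ)))
          (minus (0ℤ , + 2) (conj (ℓ m (D ⊹ δ)))))
          (conjugate (opp m) δ∈))
        where
        minus : ∀ c z → c ⊞ ⊟ z ≡ c ⊟ z
        minus (a , a′) (p , q) = ≡.refl
        flip : ∀ c → c ⊞ ℓ (opp m) (D ⊹ δ) ≡ c ⊟ ℓ m (D ⊹ δ)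
        flip c = ≡.trans (≡.cong (c ⊞_) (ℓ-opp m (D ⊹ δ))) (minus c (ℓ m (D ⊹ δ)))

      𝟎∈ : ∀ s i b → 𝟎 ∈ˡ orientedOutline s i b
      𝟎∈ △ i b = here ≡.refl
      𝟎∈ ◇ i b = here ≡.refl

      near-D : Near D
      near-D = ≡.subst Near (⊹-identityʳ D) (near (𝟎∈ s i b))

      in-box : ∀ {u} → Near u → ∃ λ a → ∃ λ b → ∃ λ c → ∃ λ d → u ≡ box a b c d
      in-box n = let ((a , e₀) , _) = n d0
                     ((b , e₁) , _) = n d1
                     ((c , e₂) , _) = n d2
                     ((d , e₃) , _) = n d3
                 in a , b , c , d , lat-≡ e₀ e₁ e₂ e₃

      star-D : HasSpoke k (mapL (D ⊹_) (oriented s i b)) ⊎ AvoidsSpoke k (mapL (D ⊹_) (oriented s i b))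
      star-D = from-box (in-box near-D) near-D (All.tabulate near)
        where
        from-box : ∀ {u} → (∃ λ a → ∃ λ b → ∃ λ c → ∃ λ d → u ≡ box a b c d) → Near u →
          All (λ δ → Near (u ⊹ δ)) (orientedOutline s i b) →
          HasSpoke k (mapL (u ⊹_) (oriented s i b)) ⊎ AvoidsSpoke k (mapL (u ⊹_) (oriented s i b))
        from-box (a , b′ , c , d , ≡.refl) n ns = star a b′ c d n s i b ns k

      cornersL-mapL : ∀ f l → cornersL (mapL f l) ≡ map f (cornersL l)
      cornersL-mapL f (triangle _ _ _)  = ≡.refl
      cornersL-mapL f (rhombus _ _ _ _) = ≡.refl

      sidesL-mapL : ∀ f l → sidesL (mapL f l) ≡ map (λ (u , v) → f u , f v) (sidesL l)
      sidesL-mapL f (triangle _ _ _)  = ≡.refl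
      sidesL-mapL f (rhombus _ _ _ _) = ≡.refl

      not-avoided : ¬ AvoidsSpoke k (mapL (D ⊹_) (oriented s i b))
      not-avoided (m , p , all) = positive⇒¬nonneg-neg (ev-positive p)
        (nonneg-resp (trans (ev-⊟ (ℓ m v) (ℓ m (v ⊹ spoke k)))
            (trans (+-congˡ (-‿cong (trans (ev-cong (ℓ-⊹ m v (spoke k))) (ev-⊞ (ℓ m v) (ℓ m (spoke k))))))
              (solve 2 (λ x y → x :- (x :+ y) := :- y) refl (ev (ℓ m v)) (ev (ℓ m (spoke k))))))
          (hull-bound m (ℓ m v) (All.map (λ {δ} n → nonneg-resp (ev-cong (identity δ)) (ev-nonneg n))
            (Allₚ.map⁻ (≡.subst (All (λ u → NonNeg (⊟ ℓ m u))) (cornersL-mapL (D ⊹_) (oriented s i b)) all)))))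
        where
        f : ∀ x y → ⊟ y ≡ x ⊟ (x ⊞ y)
        f (a , a′) (c , c′) = ≡.cong₂ _,_ (g a c) (g a′ c′)
          where g : ∀ a c → ℤ.- c ≡ a ℤ.- (a ℤ.+ c)
                g = solve-∀
        identity : ∀ δ → ⊟ ℓ m (D ⊹ δ) ≡ ℓ m v ⊟ ℓ m (w ⊹ δ)
        identity δ = ≡.trans (f (ℓ m v) (ℓ m (D ⊹ δ))) (≡.cong (λ z → ℓ m v ⊟ z) (≡.sym (ℓ-relative m δ)))

      spoke-side : HasSpoke k (mapL (D ⊹_) (oriented s i b)) →
        Any ((placed o v , placed o (v ⊹ unit k)) ≈ₛ_) (sides (realise (placed o) (mapL (w ⊹_) (oriented s i b))))
      spoke-side has = ≡.subst (Any _) (≡.sym (sides-realise (placed o) w (oriented s i b)))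
        (Anyₚ.map⁺ (Any.map (λ {e} → side {e})
          (Anyₚ.map⁻ (≡.subst (Any _) (sidesL-mapL (D ⊹_) (oriented s i b)) has))))
        where
        at-v : ∀ {u x} → D ⊹ u ≡ x → placed o (v ⊹ x) ≈ₚ placed o (w ⊹ u)
        at-v {u} ≡.refl = ≡.subst (λ y → placed o (v ⊹ (D ⊹ u)) ≈ₚ placed o y) (≡.sym (reposition v w u)) ≈ₚ-refl
        at-v₀ : ∀ {u} → D ⊹ u ≡ 𝟎 → placed o v ≈ₚ placed o (w ⊹ u)
        at-v₀ {u} e = ≡.subst (λ y → placed o y ≈ₚ placed o (w ⊹ u)) (⊹-identityʳ v) (at-v e)
        side : ∀ {e : Lat × Lat} → let (u , u′) = e in
          (D ⊹ u ≡ 𝟎 × D ⊹ u′ ≡ unit k) ⊎ (D ⊹ u ≡ unit k × D ⊹ u′ ≡ 𝟎) →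
          (placed o v , placed o (v ⊹ unit k)) ≈ₛ (placed o (w ⊹ u) , placed o (w ⊹ u′))
        side (inj₁ (x , y)) = inj₁ (at-v₀ x , at-v y)
        side (inj₂ (x , y)) = inj₂ (at-v₀ y , at-v x)

    -- Of the two alternatives in `star`, the separating half-plane is excluded: by convexity it
    -- would contain the covered point as well.
    covered-side : Any ((placed o v , placed o (v ⊹ unit k)) ≈ₛ_)
      (sides (realise (placed o) (mapL (w ⊹_) (oriented s i b))))
    covered-side = Sum.[ spoke-side , (λ a → contradiction a not-avoided) ] star-D

  -- Central lattice points by rounding of conjugates

  σ : Fin 8 → Lat → Carrier
  σ m u = ev (conj (ℓ m u))

  σ-opp : ∀ m u → σ (opp m) u ≈ - σ m u
  σ-opp m u = trans (ev-cong (≡.cong conj (ℓ-opp m u))) (ev-neg (conj (ℓ m u)))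

  σ-⊹ : ∀ m u v → σ m (u ⊹ v) ≈ σ m u + σ m v
  σ-⊹ m u v = trans (ev-cong (≡.trans (≡.cong conj (ℓ-⊹ m u v)) (conj-⊞ (ℓ m u) (ℓ m v))))
    (ev-⊞ (conj (ℓ m u)) (conj (ℓ m v)))

  ev-slack : ∀ b m u → ev (slack b m u) ≈ ev b - (σ m u + σ m u)
  ev-slack b m u = trans (ev-⊟ b (twice (conj (ℓ m u)))) (+-congˡ (-‿cong (ev-twice (conj (ℓ m u)))))

  private
    conjL : Lat → Lat
    conjL (lat a b c d) = lat a (ℤ.- b) c (ℤ.- d)

    σ-conjL₀ : ∀ u → σ d0 u ≈ ev (ℓ d0 (conjL u))
    σ-conjL₀ (lat a b c d) = ev-cong (≡.cong (a ,_) (f b d))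
      where f : ∀ b d → ℤ.- (b ℤ.- d) ≡ ℤ.- b ℤ.- ℤ.- d
            f = solve-∀

    σ-conjL₂ : ∀ u → σ d2 u ≈ ev (ℓ d2 (conjL u))
    σ-conjL₂ (lat a b c d) = ev-cong (≡.cong (c ,_) (ℤₚ.neg-distrib-+ b d))

  -- Conjugation changes the sign of h in ζ = h (1 + i).
  σ-d1 : ∀ u → σ d1 u ≈ - (h * (σ d0 u + σ d2 u))
  σ-d1 u@(lat a b c d) = trans (ev-cong (≡.cong (_, ℤ.- (a ℤ.+ c)) (≡.sym (ℤₚ.neg-involutive b))))
    (trans (ev-neg (ℓ d1 (conjL u)))
      (-‿cong (trans (ev-d1 (conjL u)) (*-congˡ (+-cong (sym (σ-conjL₀ u)) (sym (σ-conjL₂ u)))))))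

  σ-d3 : ∀ u → σ d3 u ≈ - (h * (σ d2 u - σ d0 u))
  σ-d3 u@(lat a b c d) = trans (ev-cong (≡.cong (_, ℤ.- (c ℤ.- a)) (≡.sym (ℤₚ.neg-involutive d))))
    (trans (ev-neg (ℓ d3 (conjL u)))
      (-‿cong (trans (ev-d3 (conjL u)) (*-congˡ (+-cong (sym (σ-conjL₂ u)) (-‿cong (sym (σ-conjL₀ u))))))))

  -- The conjugate 5 √2 - 7 of - (7 + 5 √2), a small positive number.
  mesh : Carrier
  mesh = ev (-[1+ 6 ] , + 10)

  round-down : ∀ N x → Nonneg x → Positive (ιℕ N * mesh - x) →
    ∃ λ k → k ℕ.< N × Nonneg (x - ιℕ k * mesh) × Nonneg (mesh - (x - ιℕ k * mesh))
  round-down zero x p q = contradiction (nonneg-resp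
    (solve 2 (λ x s → x := :- (con 0ℤ :* s :- x)) refl x mesh) p) (positive⇒¬nonneg-neg q)
  round-down (suc n) x p q = decide em
    where
    decide : Dec (Nonneg (x - ιℕ n * mesh)) →
             ∃ λ k → k ℕ.< suc n × Nonneg (x - ιℕ k * mesh) × Nonneg (mesh - (x - ιℕ k * mesh))
    decide (yes r) = n , ℕₚ.n<1+n n , r , nonneg-resp
      (trans (+-congʳ (*-congʳ (ιℕ-suc n)))
        (solve 3 (λ k x s → (k :+ con 1ℤ) :* s :- x := s :- (x :- k :* s)) refl (ιℕ n) x mesh)) (proj₁ q)
    decide (no ¬r) =
      let (k , k<n , a , b) = round-down n x p (¬nonneg-neg⇒positive λ r → ¬r (nonneg-resp
            (solve 2 (λ x y → :- (y :- x) := x :- y) refl x (ιℕ n * mesh)) r))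
      in k , ℕₚ.m<n⇒m<1+n k<n , a , b

  -- (7 + 5 √2) (j + k i), moved so that j and k range over natural numbers.
  offset : ℕ → ℕ → Lat
  offset j k = let j′ = + j ℤ.- + 24
                   k′ = + k ℤ.- + 24
               in lat (+ 7 ℤ.* j′) (+ 5 ℤ.* (j′ ℤ.+ k′)) (+ 7 ℤ.* k′) (+ 5 ℤ.* (k′ ℤ.- j′))

  ι-mesh : ∀ j → ev (+ 7 ℤ.* (+ j ℤ.- + 24) , ℤ.- (+ 10 ℤ.* (+ j ℤ.- + 24))) ≈ ι (+ 24) * mesh - ιℕ j * mesh
  ι-mesh j = trans (+-cong (trans (ι-* (+ 7) (+ j ℤ.- + 24)) (*-congˡ (ι-- (+ j) (+ 24))))
      (*-congʳ (trans (ι-neg (+ 10 ℤ.* (+ j ℤ.- + 24)))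
        (-‿cong (trans (ι-* (+ 10) (+ j ℤ.- + 24)) (*-congˡ (ι-- (+ j) (+ 24))))))))
    (solve 2 (λ j h → con (+ 7) :* (j :- con (+ 24)) :+ (:- (con (+ 10) :* (j :- con (+ 24)))) :* h :=
      con (+ 24) :* (con -[1+ 6 ] :+ con (+ 10) :* h) :- j :* (con -[1+ 6 ] :+ con (+ 10) :* h)) refl (ιℕ j) h)

  σ-offset₀ : ∀ j k → σ d0 (offset j k) ≈ ι (+ 24) * mesh - ιℕ j * mesh
  σ-offset₀ j k = trans (ev-cong (≡.cong (+ 7 ℤ.* (+ j ℤ.- + 24) ,_)
    (≡.cong ℤ.-_ (f (+ j ℤ.- + 24) (+ k ℤ.- + 24))))) (ι-mesh j)
    where
    f : ∀ x y → + 5 ℤ.* (x ℤ.+ y) ℤ.- + 5 ℤ.* (y ℤ.- x) ≡ + 10 ℤ.* x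
    f = solve-∀

  σ-offset₂ : ∀ j k → σ d2 (offset j k) ≈ ι (+ 24) * mesh - ιℕ k * mesh
  σ-offset₂ j k = trans (ev-cong (≡.cong (+ 7 ℤ.* (+ k ℤ.- + 24) ,_)
    (≡.cong ℤ.-_ (f (+ j ℤ.- + 24) (+ k ℤ.- + 24))))) (ι-mesh k)
    where
    f : ∀ x y → + 5 ℤ.* (x ℤ.+ y) ℤ.+ + 5 ℤ.* (y ℤ.- x) ≡ + 10 ℤ.* y
    f = solve-∀

  -- The diagonal directions decide: conjugate coordinates up to `mesh` give 2h (x + y) ≤ 4h ·
  -- `mesh`, which must not exceed √2 - 1. Among the powers of √2 - 1 the third, `mesh`, is the
  -- first one small enough.
  central-square : ∀ v → Nonneg (σ d0 v) → Nonneg (mesh - σ d0 v) → Nonneg (σ d2 v) → Nonneg (mesh - σ d2 v) → Central v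
  central-square v a a′ b b′ m = nonneg-resp (sym (ev-slack central-bound m v)) (bound m)
    where
    x y c : Carrier
    x = σ d0 v
    y = σ d2 v
    c = ev central-bound
    hh : ∀ {p} → Nonneg p → Nonneg (h * p)
    hh = *-nonNeg h-nonneg
    dbl : ∀ {p} → Nonneg p → Nonneg (p + p)
    dbl p = +-nonneg p p
    c≥0 : Nonneg c
    c≥0 = ev-nonneg (from-yes (nonNeg? central-bound))
    s₁ : Nonneg (c - (mesh + mesh))
    s₁ = nonneg-resp (trans (ev-⊟ central-bound (twice (-[1+ 6 ] , + 10)))
      (+-congˡ (-‿cong (ev-twice (-[1+ 6 ] , + 10)))))
      (ev-nonneg (from-yes (nonNeg? (central-bound ⊟ twice (-[1+ 6 ] , + 10)))))
    h-mesh : h * mesh ≈ ev (+ 5 , -[1+ 6 ])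
    h-mesh = trans (solve 1 (λ h → h :* (con -[1+ 6 ] :+ con (+ 10) :* h) :=
      con (+ 5) :* (h :* h :+ h :* h) :+ con -[1+ 6 ] :* h) refl h)
      (+-congʳ (trans (*-congˡ 2hh≈1) (*-identityʳ _)))
    s₂ : Nonneg (c - (h * mesh + h * mesh))
    s₂ = nonneg-resp (trans (ev-⊟ central-bound (twice (+ 5 , -[1+ 6 ])))
        (+-congˡ (-‿cong (trans (ev-twice (+ 5 , -[1+ 6 ])) (sym (+-cong h-mesh h-mesh))))))
      (ev-nonneg (from-yes (nonNeg? (central-bound ⊟ twice (+ 5 , -[1+ 6 ])))))
    s₃ : Nonneg (c - (h * mesh + h * mesh) - (h * mesh + h * mesh))
    s₃ = nonneg-resp (trans (ev-⊟ (central-bound ⊟ z) z)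
      (+-cong (trans (ev-⊟ central-bound z) (+-congˡ (-‿cong e))) (-‿cong e)))
      (ev-nonneg (from-yes (nonNeg? (central-bound ⊟ z ⊟ z))))
      where
      z = twice (+ 5 , -[1+ 6 ])
      e : ev z ≈ h * mesh + h * mesh
      e = trans (ev-twice (+ 5 , -[1+ 6 ])) (sym (+-cong h-mesh h-mesh))
    negate : ∀ {p q} → p ≈ - q → Nonneg (c + (q + q)) → Nonneg (c - (p + p))
    negate {p} {q} e n = nonneg-resp (trans (solve 2 (λ c q → c :+ (q :+ q) := c :- ((:- q) :+ (:- q))) refl c q)
      (+-congˡ (-‿cong (sym (+-cong e e))))) n
    replace : ∀ {p q} → p ≈ q → Nonneg (c - (q + q)) → Nonneg (c - (p + p))
    replace e n = nonneg-resp (+-congˡ (-‿cong (sym (+-cong e e)))) n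
    bound : ∀ m → Nonneg (c - (σ m v + σ m v))
    bound d0 = nonneg-resp (solve 3 (λ c s x → (c :- (s :+ s)) :+ ((s :- x) :+ (s :- x)) := c :- (x :+ x)) refl c mesh x)
      (+-nonneg s₁ (dbl a′))
    bound d1 = negate (σ-d1 v) (+-nonneg c≥0 (dbl (hh (+-nonneg a b))))
    bound d2 = nonneg-resp (solve 3 (λ c s x → (c :- (s :+ s)) :+ ((s :- x) :+ (s :- x)) := c :- (x :+ x)) refl c mesh y)
      (+-nonneg s₁ (dbl b′))
    bound d3 = negate (σ-d3 v) (nonneg-resp
      (solve 5 (λ c h s x y → (c :- (h :* s :+ h :* s)) :+
        ((h :* y :+ h :* y) :+ (h :* (s :- x) :+ h :* (s :- x))) :=
        c :+ (h :* (y :- x) :+ h :* (y :- x))) refl c h mesh x y)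
      (+-nonneg s₂ (+-nonneg (dbl (hh b)) (dbl (hh a′)))))
    bound d4 = negate (σ-opp d0 v) (+-nonneg c≥0 (dbl a))
    bound d5 = replace (trans (σ-opp d1 v) (trans (-‿cong (σ-d1 v)) (solve 1 (λ z → :- (:- z) := z) refl _))) (nonneg-resp
      (solve 5 (λ c h s x y → (c :- (h :* s :+ h :* s) :- (h :* s :+ h :* s)) :+
          ((h :* (s :- x) :+ h :* (s :- x)) :+ (h :* (s :- y) :+ h :* (s :- y))) :=
        c :- (h :* (x :+ y) :+ h :* (x :+ y))) refl c h mesh x y)
      (+-nonneg s₃ (+-nonneg (dbl (hh a′)) (dbl (hh b′)))))
    bound d6 = negate (σ-opp d2 v) (+-nonneg c≥0 (dbl b))
    bound d7 = replace (trans (σ-opp d3 v) (trans (-‿cong (σ-d3 v)) (solve 1 (λ z → :- (:- z) := z) refl _))) (nonneg-resp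
      (solve 5 (λ c h s x y → (c :- (h :* s :+ h :* s)) :+
        ((h :* x :+ h :* x) :+ (h :* (s :- y) :+ h :* (s :- y))) :=
        c :- (h :* (y :- x) :+ h :* (y :- x))) refl c h mesh x y)
      (+-nonneg s₂ (+-nonneg (dbl (hh a)) (dbl (hh b′)))))

  -- Both conjugate coordinates are rounded down to multiples of `mesh`. The range of `j` and `k`
  -- does not depend on `u`, as `full-star` must place its probes before it knows `u`.
  central-point : ∀ {u} → InOctagon u → ∃ λ j → ∃ λ k → j ℕ.< 48 × k ℕ.< 48 × Central (u ⊹ offset j k)
  central-point {u} oct = assemble (rounded d0) (rounded d2)
    where
    range : ∀ m → Nonneg (σ m u + ι (+ 24) * mesh) × Positive (ιℕ 48 * mesh - (σ m u + ι (+ 24) * mesh))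
    range m =
      halve-nonneg (nonneg-resp
        (trans (+-cong (ev-slack octagon (opp m) u) margin)
          (trans (+-congʳ (+-congˡ (-‿cong (+-cong (σ-opp m u) (σ-opp m u)))))
            (solve 3 (λ x s o → (o :- (:- x :+ :- x)) :+ (con (+ 48) :* s :- o) :=
              (x :+ con (+ 24) :* s) :+ (x :+ con (+ 24) :* s))
              refl (σ m u) mesh (ev octagon))))
        (proj₁ (+-positive (oct (opp m)) margin≥0))) ,
      halve-positive (positive-resp
        (trans (+-cong (ev-slack octagon m u) margin)
          (solve 3 (λ x s o → (o :- (x :+ x)) :+ (con (+ 48) :* s :- o) :=
              (con (+ 48) :* s :- (x :+ con (+ 24) :* s)) :+ (con (+ 48) :* s :- (x :+ con (+ 24) :* s)))
            refl (σ m u) mesh (ev octagon)))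
        (+-positive (oct m) margin≥0))
      where
      -- 48 · `mesh` - (1 + √2) = 478h - 337: steps from -24 to 24 reach beyond the octagon on both
      -- sides.
      margin≥0 : Nonneg (ev (-[1+ 336 ] , + 478))
      margin≥0 = ev-nonneg (from-yes (nonNeg? (-[1+ 336 ] , + 478)))
      margin : ev (-[1+ 336 ] , + 478) ≈ ι (+ 48) * mesh - ev octagon
      margin = solve 1 (λ h → con -[1+ 336 ] :+ con (+ 478) :* h :=
        con (+ 48) :* (con -[1+ 6 ] :+ con (+ 10) :* h) :- (con 1ℤ :+ con (+ 2) :* h)) refl h
    rounded : ∀ m → ∃ λ k → k ℕ.< 48 × Nonneg (σ m u + ι (+ 24) * mesh - ιℕ k * mesh) ×
                            Nonneg (mesh - (σ m u + ι (+ 24) * mesh - ιℕ k * mesh))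
    rounded m = round-down 48 (σ m u + ι (+ 24) * mesh) (proj₁ (range m)) (proj₂ (range m))
    assemble : _ → _ → ∃ λ j → ∃ λ k → j ℕ.< 48 × k ℕ.< 48 × Central (u ⊹ offset j k)
    assemble (j , j< , a , a′) (k , k< , b , b′) = j , k , j< , k< , central-square (u ⊹ offset j k)
      (nonneg-resp (sym x) a) (nonneg-resp (+-congˡ (-‿cong (sym x))) a′)
      (nonneg-resp (sym y) b) (nonneg-resp (+-congˡ (-‿cong (sym y))) b′)
      where
      x : σ d0 (u ⊹ offset j k) ≈ σ d0 u + ι (+ 24) * mesh - ιℕ j * mesh
      x = trans (σ-⊹ d0 u (offset j k)) (trans (+-congˡ (σ-offset₀ j k)) (sym (+-assoc _ _ _)))
      y : σ d2 (u ⊹ offset j k) ≈ σ d2 u + ι (+ 24) * mesh - ιℕ k * mesh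
      y = trans (σ-⊹ d2 u (offset j k)) (trans (+-congˡ (σ-offset₂ j k)) (sym (+-assoc _ _ _)))

  firstCorner : Tile → Point
  firstCorner (triangle t _ _)  = t
  firstCorner (rhombus a _ _ _) = a

  firstCorner-corner : ∀ t → Any (firstCorner t ≈ₚ_) (corners t)
  firstCorner-corner (triangle _ _ _)  = here ≈ₚ-refl
  firstCorner-corner (rhombus _ _ _ _) = here ≈ₚ-refl

  normalTile-corner : ∀ {f t c} → NormalTile f t → Any (c ≈ₚ_) (corners t) → ∃ λ u → c ≈ₚ f u × InOctagon u
  normalTile-corner {f} {t} {c} (normalTile s i b w t≈ oct) any =
    find (outline-corners s i b oct) (Anyₚ.map⁻ (≡.subst (Any (c ≈ₚ_)) (corners-realise f w (oriented s i b))
      (corners-resp t≈ any)))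
    where
    find : ∀ {us} → All (λ δ → InOctagon (w ⊹ δ)) us → Any (λ u → c ≈ₚ f (w ⊹ u)) us → ∃ λ u → c ≈ₚ f u × InOctagon u
    find all any = let (o , e) = All.lookupAny all any in w ⊹ Any.lookup any , e , o

  module _ {T : Pred Tile 0ℓ} (ab : IsAmmannBeenkerTiling T) (horizontal : HasHorizontalRhombusSide T) where
    open IsAmmannBeenkerTiling ab
    open IsTiling isTiling

    -- The tiles covering the probes are put into one finite set together with `t₀`, so that a
    -- single origin serves all of them.
    probed : ∀ {t₀} → t₀ ∈ T → ∀ {I : Set} (probe : I → Point) (is : List I) →
      ∃ λ o → (∃ λ u → firstCorner t₀ ≈ₚ placed o u × InOctagon u) ×
              (∀ {i} → i ∈ˡ is → ∃ λ t → t ∈ T × NormalTile (placed o) t × probe i ∈ region t)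
    probed {t₀} t₀∈T probe is = normal
      (normalTiles ab horizontal (t₀ ∷ map tile is) (t₀∈T ∷ Allₚ.map⁺
        (All.tabulate λ {i} _ → proj₁ (proj₂ (covers (probe i))))))
      where
      tile : _ → Tile
      tile i = proj₁ (covers (probe i))
      normal : (∃ λ o → All (NormalTile (placed o)) (t₀ ∷ map tile is)) → _
      normal (o , n₀ ∷ ns) = o , normalTile-corner n₀ (firstCorner-corner t₀) ,
        λ {i} i∈ → tile i , proj₁ (proj₂ (covers (probe i))) , All.lookup ns (∈-map⁺ tile i∈) ,
          proj₂ (proj₂ (covers (probe i)))

    -- Which offset leads to a central point depends on the lattice position of `t₀`, thus on a
    -- frame that is found only after the tiles have been listed. Therefore every candidate centre
    -- receives its eight probes, relative to a corner of `t₀`, and the right one is selected later.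
    full-star : ∀ {t₀} → t₀ ∈ T → ∃ λ o → ∃ λ v → ∀ k → IsSide T (placed o v , placed o (v ⊹ unit k))
    full-star {t₀} t₀∈T = find (probed t₀∈T probe indices)
      where
      Index : Set
      Index = Fin 48 × Fin 48 × Fin 8
      indices : List Index
      indices = cartesianProduct (allFin 48) (cartesianProduct (allFin 48) (allFin 8))
      probe : Index → Point
      probe (j , k , i) = firstCorner t₀ ⊕ emb (offset (toℕ j) (toℕ k) ⊹ spoke i)
      find : (∃ λ o → (∃ λ u → firstCorner t₀ ≈ₚ placed o u × InOctagon u) ×
                (∀ {i} → i ∈ˡ indices → ∃ λ t → t ∈ T × NormalTile (placed o) t × probe i ∈ region t)) →
             ∃ λ o → ∃ λ v → ∀ k → IsSide T (placed o v , placed o (v ⊹ unit k))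
      find (o , (u , t₀≈ , oct) , tiles) = with-centre (central-point oct)
        where
        with-centre : (∃ λ j → ∃ λ k → j ℕ.< 48 × k ℕ.< 48 × Central (u ⊹ offset j k)) →
                      ∃ λ o → ∃ λ v → ∀ k → IsSide T (placed o v , placed o (v ⊹ unit k))
        with-centre (j , k , j< , k< , central) = o , v , spokes
          where
          v : Lat
          v = u ⊹ offset j k
          j′ k′ : Fin 48
          j′ = fromℕ< j<
          k′ = fromℕ< k<
          probe≈ : ∀ i → probe (j′ , k′ , i) ≈ₚ placed o (v ⊹ spoke i)
          probe≈ i = ≡.subst₂ (λ x y → firstCorner t₀ ⊕ emb (offset x y ⊹ spoke i) ≈ₚ placed o (v ⊹ spoke i))
            (≡.sym (Finₚ.toℕ-fromℕ< j<)) (≡.sym (Finₚ.toℕ-fromℕ< k<))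
            (≈ₚ-trans (⊕-cong t₀≈ ≈ₚ-refl)
            (≈ₚ-trans (+-assoc _ _ _ , +-assoc _ _ _)
            (⊕-cong ≈ₚ-refl (≈ₚ-trans (≈ₚ-sym (emb-⊹ u (offset j k ⊹ spoke i)))
              (≡.subst (λ x → emb (u ⊹ (offset j k ⊹ spoke i)) ≈ₚ emb x) (≡.sym (⊹-assoc u (offset j k) (spoke i))) ≈ₚ-refl)))))
          spokes : ∀ i → IsSide T (placed o v , placed o (v ⊹ unit i))
          spokes i = from-tile (tiles (∈-cartesianProduct⁺ (∈-allFin j′)
            (∈-cartesianProduct⁺ (∈-allFin k′) (∈-allFin i))))
            where
            from-tile : (∃ λ t → t ∈ T × NormalTile (placed o) t × probe (j′ , k′ , i) ∈ region t) →
                        IsSide T (placed o v , placed o (v ⊹ unit i))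
            from-tile (t , t∈T , normalTile s n b w t≈ octs , cov) =
              _ , respects t≈ t∈T ,
              covered-side o v central i s n b w t≈ octs (hull-resp {corners t} (probe≈ i) cov)

  side-corners : ∀ t {s} → Any (s ≈ₛ_) (sides t) → Any (proj₁ s ≈ₚ_) (corners t)
  side-corners (triangle _ _ _) (here (inj₁ (p , q))) = here p
  side-corners (triangle _ _ _) (here (inj₂ (p , q))) = there (here p)
  side-corners (triangle _ _ _) (there (here (inj₁ (p , q)))) = there (here p)
  side-corners (triangle _ _ _) (there (here (inj₂ (p , q)))) = there (there (here p))
  side-corners (triangle _ _ _) (there (there (here (inj₁ (p , q))))) = there (there (here p))
  side-corners (triangle _ _ _) (there (there (here (inj₂ (p , q))))) = here p
  side-corners (rhombus _ _ _ _) (here (inj₁ (p , q))) = here p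
  side-corners (rhombus _ _ _ _) (here (inj₂ (p , q))) = there (here p)
  side-corners (rhombus _ _ _ _) (there (here (inj₁ (p , q)))) = there (here p)
  side-corners (rhombus _ _ _ _) (there (here (inj₂ (p , q)))) = there (there (here p))
  side-corners (rhombus _ _ _ _) (there (there (here (inj₁ (p , q))))) = there (there (here p))
  side-corners (rhombus _ _ _ _) (there (there (here (inj₂ (p , q))))) = there (there (there (here p)))
  side-corners (rhombus _ _ _ _) (there (there (there (here (inj₁ (p , q)))))) = there (there (there (here p)))
  side-corners (rhombus _ _ _ _) (there (there (there (here (inj₂ (p , q)))))) = here p

  unit-injective : ∀ {k k′} → emb (unit k) ≈ₚ emb (unit k′) → k ≡ k′
  unit-injective {k} {k′} (x , y) =
    Sum.[ (λ e → e) , Sum.[ (λ a → contradiction a (equal d0 x)) ,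
      (λ a → contradiction a (equal d2 y)) ]′ ]′ (separate k k′)
    where
    separate : ∀ k k′ → k ≡ k′ ⊎ Apart (ℓ d0 (unit k) ⊟ ℓ d0 (unit k′)) ⊎ Apart (ℓ d2 (unit k) ⊟ ℓ d2 (unit k′))
    separate = toWitness {a? = all? λ k → all? λ k′ → k Finₚ.≟ k′ ⊎-dec
      apart? (ℓ d0 (unit k) ⊟ ℓ d0 (unit k′)) ⊎-dec apart? (ℓ d2 (unit k) ⊟ ℓ d2 (unit k′))} _
    equal : ∀ m → ev (ℓ m (unit k)) ≈ ev (ℓ m (unit k′)) → ¬ Apart (ℓ m (unit k) ⊟ ℓ m (unit k′))
    equal m e = ≈0⇒¬Apart (trans (ev-⊟ (ℓ m (unit k)) (ℓ m (unit k′))) (trans (+-congʳ e) (-‿inverseʳ _)))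

  unit-nonzero : ∀ k → ¬ emb (unit k) ≈ₚ (0# , 0#)
  unit-nonzero k (x , y) = Sum.[ ≈0⇒¬Apart x , ≈0⇒¬Apart y ]′ (separate k)
    where
    separate : ∀ k → Apart (ℓ d0 (unit k)) ⊎ Apart (ℓ d2 (unit k))
    separate = toWitness {a? = all? λ k → apart? (ℓ d0 (unit k)) ⊎-dec apart? (ℓ d2 (unit k))} _

  ⊕-cancelˡ : ∀ p {q r} → p ⊕ q ≈ₚ p ⊕ r → q ≈ₚ r
  ⊕-cancelˡ (p₁ , p₂) (x , y) = one x , one y
    where
    one : ∀ {p q r} → p + q ≈ p + r → q ≈ r
    one {p} {q} {r} e = trans (solve 2 (λ p q → q := (p :+ q) :- p) refl p q)
      (trans (+-congʳ e) (solve 2 (λ p r → (p :+ r) :- p := r) refl p r))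

  module _ {T : Pred Tile 0ℓ} (ab : IsAmmannBeenkerTiling T) (horizontal : HasHorizontalRhombusSide T) where
    open Graph (graph T)

    -- The eight spokes of a full star are distinct edges at a common vertex, so their colours embed
    -- `Fin 8` into the set of colours.
    chromatic-lower-bound : ∀ m → EdgeColourable m → 8 ℕ.≤ m
    chromatic-lower-bound m (c , proper) = from-star (full-star ab horizontal (proj₁ (proj₂ horizontal)))
      where
      from-star : (∃ λ o → ∃ λ v → ∀ k → IsSide T (placed o v , placed o (v ⊹ unit k))) → 8 ℕ.≤ m
      from-star (o , v , side) = Finₚ.injective⇒≤ {f = λ k → Func.to c (edge k)} λ {k} {k′} e →
        decidable-stable (k Finₚ.≟ k′) λ k≢k′ → proper (edge k) (edge k′) (adjacent k k′ k≢k′) e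
        where
        edge : Fin 8 → Edge
        edge k = (placed o v , placed o (v ⊹ unit k)) , side k
        vertex : Vertex
        vertex = placed o v , proj₁ (side d0) , proj₁ (proj₂ (side d0)) ,
          side-corners (proj₁ (side d0)) {placed o v , placed o (v ⊹ unit d0)} (proj₂ (proj₂ (side d0)))
        relative : ∀ {u u′} → placed o (v ⊹ u) ≈ₚ placed o (v ⊹ u′) → emb u ≈ₚ emb u′
        relative {u} {u′} e = ⊕-cancelˡ (emb v) (≈ₚ-trans (≈ₚ-sym (emb-⊹ v u))
          (≈ₚ-trans (⊕-cancelˡ o e) (emb-⊹ v u′)))
        relative₀ : ∀ {u} → placed o v ≈ₚ placed o (v ⊹ u) → emb u ≈ₚ (0# , 0#)
        relative₀ {u} e = ⊕-cancelˡ (emb v) (≈ₚ-trans (≈ₚ-sym (emb-⊹ v u))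
          (≈ₚ-trans (≈ₚ-sym (⊕-cancelˡ o e)) (sym (+-identityʳ _) , sym (+-identityʳ _))))
        adjacent : ∀ k k′ → k ≢ k′ → Adjacent (edge k) (edge k′)
        adjacent k k′ k≢k′ = different , vertex , inj₁ ≈ₚ-refl , inj₁ ≈ₚ-refl
          where
          different : ¬ ((placed o v , placed o (v ⊹ unit k)) ≈ₛ (placed o v , placed o (v ⊹ unit k′)))
          different (inj₁ (_ , e)) = k≢k′ (unit-injective (relative {unit k} {unit k′} e))
          different (inj₂ (e , _)) = unit-nonzero k′ (relative₀ {unit k′} e)

  -- Positions of edges on a line

  -- A way to number edges without enumerating them: the rank is the length of the longest
  -- descending chain, which exists by excluded middle as soon as chain lengths are bounded.
  module Rank {E : Set} (_≺_ : E → E → Set) where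
    data Chain : ℕ → E → Set where
      []  : ∀ {e} → Chain 0 e
      _∷_ : ∀ {n f e} → f ≺ e → Chain n f → Chain (suc n) e

    Bounded : Set
    Bounded = ∀ e → ∃ λ N → ∀ n → Chain n e → n ℕ.≤ N

    IsRank : ℕ → E → Set
    IsRank r e = Chain r e × (∀ n → Chain n e → n ℕ.≤ r)

    maximum : ∀ e N → (∀ n → Chain n e → n ℕ.≤ N) → ∃ λ r → IsRank r e
    maximum e zero    bound = zero , [] , bound
    maximum e (suc N) bound = decide em
      where
      decide : Dec (Chain (suc N) e) → ∃ λ r → IsRank r e
      decide (yes c) = suc N , c , bound
      decide (no ¬c) = maximum e N λ n c → ℕₚ.≤-pred (ℕₚ.≤∧≢⇒< (bound n c) λ { ≡.refl → ¬c c })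

    isRank-step : ∀ {r s e f} → f ≺ e → IsRank r f → IsRank s e → r ℕ.< s
    isRank-step f≺e (c , _) (_ , max) = max _ (f≺e ∷ c)

    isRank-resp : ∀ {r s e f} → (∀ {g} → g ≺ e → g ≺ f) → (∀ {g} → g ≺ f → g ≺ e) →
                  IsRank r e → IsRank s f → r ≡ s
    isRank-resp up down (c , max) (c′ , max′) =
      ℕₚ.≤-antisym (max′ _ (move up c)) (max _ (move down c′))
      where
      move : ∀ {n e f} → (∀ {g} → g ≺ e → g ≺ f) → Chain n e → Chain n f
      move k []       = []
      move k (x ∷ c) = k x ∷ c

    module _ (bounded : Bounded) where
      rank : E → ℕ
      rank e = proj₁ (maximum e (proj₁ (bounded e)) (proj₂ (bounded e)))

      rank-isRank : ∀ e → IsRank (rank e) e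
      rank-isRank e = proj₂ (maximum e (proj₁ (bounded e)) (proj₂ (bounded e)))

      rank-pred : ∀ {r e} → IsRank (suc r) e → ∃ λ f → f ≺ e × IsRank r f
      rank-pred (_∷_ {f = f} f≺e c , max) = f , f≺e , c , λ n c′ → ℕₚ.≤-pred (max (suc n) (f≺e ∷ c′))

      -- Removing the top of a longest chain leaves a longest chain of the next element, so the rank
      -- drops by exactly one and no smaller value is skipped. `Q` carries along what is known about
      -- the line.
      descend : ∀ {Q : E → Set} → (∀ {f e} → f ≺ e → Q e → Q f) →
                ∀ r {n e} → IsRank r e → n ℕ.≤ r → Q e → ∃ λ g → rank g ≡ n × Q g
      descend {Q} inherit r {n} {e} isr n≤r q = decide (n ℕₚ.≟ r)
        where
        below : ∀ r → IsRank r e → n ℕ.< r → ∃ λ g → rank g ≡ n × Q g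
        below (suc r) isr n<r = let (f , f≺e , isr′) = rank-pred isr in
          descend inherit r isr′ (ℕₚ.≤-pred n<r) (inherit f≺e q)
        decide : Dec (n ≡ r) → ∃ λ g → rank g ≡ n × Q g
        decide (yes ≡.refl) = e , ≡.trans (isRank-resp (λ x → x) (λ x → x) (rank-isRank e) isr) ≡.refl , q
        decide (no n≢r) = below r isr (ℕₚ.≤∧≢⇒< n≤r n≢r)

  -- Otherwise the naturals would be bounded and have a supremum s; but n + 1 ≤ s for all n makes s
  -- - 1 an upper bound too.
  archimedean : ∀ x → ∃ λ N → x ≤ ιℕ N
  archimedean x = decide em
    where
    decide : Dec (∃ λ N → x ≤ ιℕ N) → ∃ λ N → x ≤ ιℕ N
    decide (yes p) = p
    decide (no ¬p) = contradiction (nonneg-resp (solve 1 (λ s → (s :- con 1ℤ) :- s := :- con 1ℤ) refl s)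
        (≤⇒nonneg (least (s - 1#) λ y (n , y≈) → nonneg⇒≤ (nonneg-resp
          (trans (+-congˡ (-‿cong (trans (ιℕ-suc n) (+-congʳ (sym y≈)))))
            (solve 2 (λ s y → s :- (y :+ con 1ℤ) := (s :- con 1ℤ) :- y) refl s y))
          (≤⇒nonneg (upper (ιℕ (suc n)) (suc n , refl)))))))
      (positive⇒¬nonneg-neg 1-positive)
      where
      supremum = complete (λ y → ∃ λ n → y ≈ ιℕ n) (0# , 0 , refl)
        (x , λ y (n , y≈) → Sum.[ (λ p → contradiction (n , ≤-respʳ-≈ y≈ p) ¬p) , (λ p → p) ] (total x y))
      s = proj₁ supremum
      upper = proj₁ (proj₂ supremum)
      least = proj₂ (proj₂ supremum)

  ιℕ-reflects-≤ : ∀ {m n} → ιℕ m ≤ ιℕ n → m ℕ.≤ n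
  ιℕ-reflects-≤ {m} {n} p = ℕₚ.≮⇒≥ λ n<m → positive⇒¬nonneg-neg
    (positive-resp (ι-- (+ m) (+ n)) (ι-positive (ℤₚ.≤-<-trans (ℤₚ.≤-reflexive (≡.sym (ℤₚ.+-inverseʳ (+ n))))
      (ℤₚ.+-monoˡ-< (ℤ.- + n) (ℤ.+<+ n<m)))))
    (nonneg-resp (solve 2 (λ m n → n :- m := :- (m :- n)) refl (ιℕ m) (ιℕ n)) (≤⇒nonneg p))

  -- Coordinates along and across the four directions

  𝐮 : Fin 4 → Point
  𝐮 m = emb (unit (m ↑ˡ 4))

  τ χ : Fin 4 → Point → Carrier
  τ m p = dot (𝐮 m) p
  χ m p = cross (𝐮 m) p

  -- Twice the coordinate of the midpoint; being symmetric in the ends, it is well defined for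
  -- unordered segments.
  κ : Fin 4 → Segment → Carrier
  κ m (p , q) = τ m p + τ m q

  cross-unit : ∀ m u → cross (𝐮 m) (emb u) ≈ ev (ℓ (quarter m) u)
  cross-unit = λ where
      d0 u → first (ev (ℓ d0 u)) (ev (ℓ d2 u))
      d1 u → trans (second (ev (ℓ d0 u)) (ev (ℓ d2 u))) (sym (ev-d3 u))
      d2 u → trans (third (ev (ℓ d0 u)) (ev (ℓ d2 u))) (sym (ev-neg (ℓ d0 u)))
      d3 u → trans (fourth (ev (ℓ d0 u)) (ev (ℓ d2 u))) (trans (-‿cong (sym (ev-d1 u))) (sym (ev-neg (ℓ d1 u))))
    where
    first : ∀ x y → ev (1ℤ , 0ℤ) * y - ev (0ℤ , 0ℤ) * x ≈ y
    first = solve 3 (λ h x y → (con 1ℤ :+ con 0ℤ :* h) :* y :- (con 0ℤ :+ con 0ℤ :* h) :* x := y) refl h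
    second : ∀ x y → ev (0ℤ , 1ℤ) * y - ev (0ℤ , 1ℤ) * x ≈ h * (y - x)
    second = solve 3 (λ h x y → (con 0ℤ :+ con 1ℤ :* h) :* y :- (con 0ℤ :+ con 1ℤ :* h) :* x := h :* (y :- x)) refl h
    third : ∀ x y → ev (0ℤ , 0ℤ) * y - ev (1ℤ , 0ℤ) * x ≈ - x
    third = solve 3 (λ h x y → (con 0ℤ :+ con 0ℤ :* h) :* y :- (con 1ℤ :+ con 0ℤ :* h) :* x := :- x) refl h
    fourth : ∀ x y → ev (0ℤ , -1ℤ) * y - ev (0ℤ , 1ℤ) * x ≈ - (h * (x + y))
    fourth = solve 3 (λ h x y → (con 0ℤ :+ con -1ℤ :* h) :* y :- (con 0ℤ :+ con 1ℤ :* h) :* x := :-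
      (h :* (x :+ y))) refl h

  τ-cong : ∀ m {p q} → p ≈ₚ q → τ m p ≈ τ m q
  τ-cong m (a , b) = +-cong (*-congˡ a) (*-congˡ b)

  χ-cong : ∀ m {p q} → p ≈ₚ q → χ m p ≈ χ m q
  χ-cong m (a , b) = +-cong (*-congˡ b) (-‿cong (*-congˡ a))

  κ-cong : ∀ m {s t} → s ≈ₛ t → κ m s ≈ κ m t
  κ-cong m (inj₁ (a , b)) = +-cong (τ-cong m a) (τ-cong m b)
  κ-cong m (inj₂ (a , b)) = trans (+-cong (τ-cong m a) (τ-cong m b)) (+-comm _ _)

  χ-placed : ∀ m o u → χ m (placed o u) ≈ χ m o + ev (ℓ (quarter m) u)
  χ-placed m (o₁ , o₂) u = trans (solve 6 (λ a b x y x′ y′ → a :* (y :+ y′) :- b :* (x :+ x′) :=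
    (a :* y :- b :* x) :+ (a :* y′ :- b :* x′)) refl
      (proj₁ (𝐮 m)) (proj₂ (𝐮 m)) o₁ o₂ (ev (ℓ d0 u)) (ev (ℓ d2 u)))
    (+-congˡ (cross-unit m u))

  OnDir : Fin 4 → Segment → Set
  OnDir m (p , q) = χ m p ≈ χ m q

  onDir-resp : ∀ m {s t} → s ≈ₛ t → OnDir m s → OnDir m t
  onDir-resp m (inj₁ (a , b)) e = trans (sym (χ-cong m a)) (trans e (χ-cong m b))
  onDir-resp m (inj₂ (a , b)) e = trans (sym (χ-cong m b)) (trans (sym e) (χ-cong m a))

  offset-resp : ∀ m {s t} → s ≈ₛ t → OnDir m s → χ m (proj₁ s) ≈ χ m (proj₁ t)
  offset-resp m (inj₁ (a , b)) e = χ-cong m a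
  offset-resp m (inj₂ (a , b)) e = trans e (χ-cong m b)

  record Spread (m : Fin 4) (s : Segment) : Set where
    constructor spread
    field
      start tip : Point
      ends      : s ≈ₛ (start , tip)
      gap       : Nonneg (τ m tip - τ m start - 1#)

  module _ {o s} (n : NormalEdge (placed o) s) where
    private
      open NormalEdge n renaming (index to m; base to u; long to l)
      δ = step l (m ↑ˡ 4)

    χ-step : χ m (placed o (u ⊹ δ)) ≈ χ m (placed o u)
    χ-step = trans (χ-placed m o (u ⊹ δ)) (trans (+-congˡ (ev-cong zero-step)) (sym (χ-placed m o u)))
      where
      zero-step : ℓ (quarter m) (u ⊹ δ) ≡ ℓ (quarter m) u
      zero-step = ≡.trans (ℓ-⊹ (quarter m) u δ) (≡.trans (≡.cong (ℓ (quarter m) u ⊞_) (proj₂ (ℓ-step l m)))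
        (≡.cong₂ _,_ (ℤₚ.+-identityʳ _) (ℤₚ.+-identityʳ _)))

    τ-step : τ m (placed o (u ⊹ δ)) ≈ τ m (placed o u) + ev (edgeLength l)
    τ-step = trans (dot-placed (m ↑ˡ 4) o (u ⊹ δ))
      (trans (+-congˡ (trans (ev-cong (≡.trans (ℓ-⊹ (m ↑ˡ 4) u δ) (≡.cong (ℓ (m ↑ˡ 4) u ⊞_) (proj₁ (ℓ-step l m)))))
                             (ev-⊞ (ℓ (m ↑ˡ 4) u) (edgeLength l))))
        (trans (sym (+-assoc _ _ _)) (+-congʳ (sym (dot-placed (m ↑ˡ 4) o u)))))

    normalEdge-onDir : OnDir m s
    normalEdge-onDir = onDir-resp m (≈ₛ-sym edge≈) (sym χ-step)

    normalEdge-spread : Spread m s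
    normalEdge-spread = spread (placed o u) (placed o (u ⊹ δ)) edge≈
      (nonneg-resp
        (trans (ev-⊟ (edgeLength l) (1ℤ , 0ℤ))
          (trans (+-congˡ (-‿cong (solve 1 (λ h → con 1ℤ :+ con 0ℤ :* h := con 1ℤ) refl h)))
            (+-congʳ (trans (solve 2 (λ x y → y := (x :+ y) :- x) refl (τ m (placed o u)) (ev (edgeLength l)))
                            (+-congʳ (sym τ-step))))))
        (ev-nonneg (long≥1 l)))
      where
      long≥1 : ∀ l → NonNeg (edgeLength l ⊟ (1ℤ , 0ℤ))
      long≥1 = toWitness {a? = all-bool? λ l → nonNeg? (edgeLength l ⊟ (1ℤ , 0ℤ))} _

  spread-nondegenerate : ∀ {m s} → Spread m s → ¬ proj₁ s ≈ₚ proj₂ s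
  spread-nondegenerate {m} {s} (spread P Q ends gap) e = positive⇒¬nonneg-neg 1-positive (nonneg-resp
    (trans (+-congʳ (+-congˡ (-‿cong (τ-cong m (same ends)))))
      (solve 1 (λ x → x :- x :- con 1ℤ := :- con 1ℤ) refl (τ m Q))) gap)
    where
    same : s ≈ₛ (P , Q) → P ≈ₚ Q
    same (inj₁ (a , b)) = ≈ₚ-trans (≈ₚ-sym a) (≈ₚ-trans e b)
    same (inj₂ (a , b)) = ≈ₚ-trans (≈ₚ-sym b) (≈ₚ-trans (≈ₚ-sym e) a)

  zero-difference : ∀ {a b} → a - b ≈ 0# → a ≈ b
  zero-difference {a} {b} x = trans (solve 2 (λ a b → a := (a :- b) :+ b) refl a b)
    (trans (+-congʳ x) (+-identityˡ b))

  difference-zero : ∀ {a b} → a ≈ b → a - b ≈ 0#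
  difference-zero {a} {b} x = trans (+-congʳ x) (-‿inverseʳ b)

  -- Cramer's rule: the transverse coordinates for two different directions are independent, so ends
  -- that agree in both would be equal.
  onDir-unique : ∀ {m m′ s} → OnDir m s → OnDir m′ s → ¬ proj₁ s ≈ₚ proj₂ s → m ≡ m′
  onDir-unique {m} {m′} {(p₁ , p₂) , (q₁ , q₂)} e e′ ne =
    Sum.[ (λ x → x) , (λ a → contradiction (collapse (independent a)) ne) ]′ (separate m m′)
    where
    separate : ∀ m m′ → m ≡ m′ ⊎ Apart (ℓ (quarter m) (unit (m′ ↑ˡ 4)))
    separate = toWitness {a? = all? λ m → all? λ m′ → m Finₚ.≟ m′ ⊎-dec apart? (ℓ (quarter m) (unit (m′ ↑ˡ 4)))} _
    independent : Apart (ℓ (quarter m) (unit (m′ ↑ˡ 4))) → ¬ cross (𝐮 m) (𝐮 m′) ≈ 0#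
    independent a z = ≈0⇒¬Apart (trans (sym (cross-unit m (unit (m′ ↑ˡ 4)))) z) a
    collapse : ¬ cross (𝐮 m) (𝐮 m′) ≈ 0# → (p₁ , p₂) ≈ₚ (q₁ , q₂)
    collapse ind = zero-difference (*-cancel-≈0 (product (proj₁ (𝐮 m)) (proj₁ (𝐮 m′))
        (solve 8 (λ a b a′ b′ p₁ p₂ q₁ q₂ → (p₁ :- q₁) :* (a :* b′ :- b :* a′) :=
          a′ :* ((a :* p₂ :- b :* p₁) :- (a :* q₂ :- b :* q₁)) :- a :*
            ((a′ :* p₂ :- b′ :* p₁) :- (a′ :* q₂ :- b′ :* q₁))) refl
          (proj₁ (𝐮 m)) (proj₂ (𝐮 m)) (proj₁ (𝐮 m′)) (proj₂ (𝐮 m′)) p₁ p₂ q₁ q₂)) ind)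
      , zero-difference (*-cancel-≈0 (product (proj₂ (𝐮 m)) (proj₂ (𝐮 m′))
        (solve 8 (λ a b a′ b′ p₁ p₂ q₁ q₂ → (p₂ :- q₂) :* (a :* b′ :- b :* a′) :=
          b′ :* ((a :* p₂ :- b :* p₁) :- (a :* q₂ :- b :* q₁)) :- b :*
            ((a′ :* p₂ :- b′ :* p₁) :- (a′ :* q₂ :- b′ :* q₁))) refl
          (proj₁ (𝐮 m)) (proj₂ (𝐮 m)) (proj₁ (𝐮 m′)) (proj₂ (𝐮 m′)) p₁ p₂ q₁ q₂)) ind)
      where
      product : ∀ c c′ {x} → x ≈ c′ * (χ m (p₁ , p₂) - χ m (q₁ , q₂)) - c * (χ m′ (p₁ , p₂) - χ m′ (q₁ , q₂)) → x ≈ 0#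
      product c c′ x = trans x (trans (+-cong (*-congˡ (difference-zero e))
        (-‿cong (*-congˡ (difference-zero e′))))
        (solve 2 (λ c c′ → c′ :* con 0ℤ :- c :* con 0ℤ := con 0ℤ) refl c c′))

  -- The second field makes the edges on a line discrete and thereby bounds chains. It holds because
  -- each edge extends over at least 1 along the line.
  record Before (m : Fin 4) (s t : Segment) : Set where
    constructor before
    field
      ends  : ∀ p q → p EndOf s → q EndOf t → τ m p ≤ τ m q
      centres : Nonneg (κ m t - κ m s - 1#)

  before-spreads : ∀ {m s t} (a : Spread m s) (b : Spread m t) →
    τ m (Spread.tip a) ≤ τ m (Spread.start b) → Before m s t
  before-spreads {m} {s} {t} (spread P Q s≈ gap) (spread P′ Q′ t≈ gap′) Q≤P′ = before
    (λ p q p∈ q∈ → ≤-trans (below s≈ p∈) (≤-trans Q≤P′ (above t≈ q∈)))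
    (nonneg-resp
      (trans (solve 4 (λ P Q P′ Q′ → ((Q :- P :- con 1ℤ) :+ (Q′ :- P′ :- con 1ℤ)) :+
        (((P′ :- Q) :+ (P′ :- Q)) :+ con 1ℤ) :=
               (P′ :+ Q′) :- (P :+ Q) :- con 1ℤ) refl (τ m P) (τ m Q) (τ m P′) (τ m Q′))
        (+-congʳ (+-cong (κ-cong m (≈ₛ-sym t≈)) (-‿cong (κ-cong m (≈ₛ-sym s≈))))))
      (+-nonneg (+-nonneg gap gap′) (+-nonneg (+-nonneg (≤⇒nonneg Q≤P′) (≤⇒nonneg Q≤P′)) (proj₁ 1-positive))))
    where
    ordered : ∀ {P Q} → Nonneg (τ m Q - τ m P - 1#) → τ m P ≤ τ m Q
    ordered {P} {Q} g = nonneg⇒≤ (nonneg-resp (solve 2 (λ p q → (q :- p :- con 1ℤ) :+ con 1ℤ := q :- p) refl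
      (τ m P) (τ m Q))
      (+-nonneg g (proj₁ 1-positive)))
    toEnd : ∀ {s P Q v} → s ≈ₛ (P , Q) → v EndOf s → v ≈ₚ P ⊎ v ≈ₚ Q
    toEnd (inj₁ (a , b)) (inj₁ x) = inj₁ (≈ₚ-trans x a)
    toEnd (inj₁ (a , b)) (inj₂ x) = inj₂ (≈ₚ-trans x b)
    toEnd (inj₂ (a , b)) (inj₁ x) = inj₂ (≈ₚ-trans x a)
    toEnd (inj₂ (a , b)) (inj₂ x) = inj₁ (≈ₚ-trans x b)
    below : ∀ {v} → s ≈ₛ (P , Q) → v EndOf s → τ m v ≤ τ m Q
    below e v∈ = Sum.[ (λ x → ≤-respˡ-≈ (sym (τ-cong m x)) (ordered {P} {Q} gap)) ,
      (λ x → ≤-reflexive (τ-cong m x)) ]′ (toEnd e v∈)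
    above : ∀ {v} → t ≈ₛ (P′ , Q′) → v EndOf t → τ m P′ ≤ τ m v
    above e v∈ = Sum.[ (λ x → ≤-reflexive (sym (τ-cong m x))) ,
      (λ x → ≤-respʳ-≈ (sym (τ-cong m x)) (ordered {P′} {Q′} gap′)) ]′ (toEnd e v∈)

  normalEdges-trichotomy : ∀ {o s t} (n : NormalEdge (placed o) s) (n′ : NormalEdge (placed o) t) {m} →
    NormalEdge.index n ≡ m → NormalEdge.index n′ ≡ m → χ m (proj₁ s) ≈ χ m (proj₁ t) →
    s ≈ₛ t ⊎ Before m s t ⊎ Before m t s
  normalEdges-trichotomy {o} {s} {t} n@(normalEdge m l u s≈ o₁ o₂) n′@(normalEdge _ l′ u′ t≈ o₃ o₄) ≡.refl ≡.refl e =
    Sum.map same (Sum.map (λ p → before-spreads a b (shift n u′ p)) (λ p → before-spreads b a (shift n′ u p)))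
      (collinear m l l′ {u} {u′} o₁ o₂ o₃ o₄ aligned)
    where
    a = normalEdge-spread n
    b = normalEdge-spread n′
    same : u ≡ u′ × l ≡ l′ → s ≈ₛ t
    same (≡.refl , ≡.refl) = ≈ₛ-trans s≈ (≈ₛ-sym t≈)
    cancel : ∀ {x y z} → x + y ≈ x + z → y ≈ z
    cancel {x} {y} {z} eq = trans (solve 2 (λ x y → y := (x :+ y) :- x) refl x y)
      (trans (+-congʳ eq) (solve 2 (λ x z → (x :+ z) :- x := z) refl x z))
    aligned : ev (ℓ (quarter m) u) ≈ ev (ℓ (quarter m) u′)
    aligned = cancel (trans (sym (χ-placed m o u)) (trans (sym (offset-resp m s≈ (normalEdge-onDir n)))
      (trans e (trans (offset-resp m t≈ (normalEdge-onDir n′)) (χ-placed m o u′)))))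
    shift : ∀ {s} (n : NormalEdge (placed o) s) u′ →
      ev (ℓ (NormalEdge.index n ↑ˡ 4) (NormalEdge.base n)) + ev (edgeLength (NormalEdge.long n)) ≤ ev
        (ℓ (NormalEdge.index n ↑ˡ 4) u′) →
      τ (NormalEdge.index n) (placed o (NormalEdge.base n ⊹ step (NormalEdge.long n) (NormalEdge.index n ↑ˡ 4))) ≤
        τ (NormalEdge.index n) (placed o u′)
    shift n u′ p = nonneg⇒≤ (nonneg-resp
      (trans (solve 4 (λ o x y z → z :- (x :+ y) := (o :+ z) :- ((o :+ x) :+ y)) refl (τ k o) _ _ _)
        (+-cong (sym (dot-placed (k ↑ˡ 4) o u′)) (-‿cong
          (trans (+-congʳ (sym (dot-placed (k ↑ˡ 4) o (NormalEdge.base n)))) (sym (τ-step n))))))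
      (≤⇒nonneg p))
      where k = NormalEdge.index n

  -- The order of the edges on a line

  module Edges {T : Pred Tile 0ℓ} (ab : IsAmmannBeenkerTiling T) (horizontal : HasHorizontalRhombusSide T) where
    open Graph (graph T) using (Edge)

    segment : Edge → Segment
    segment = proj₁

    abstract
      edge-normal : ∀ (e : Edge) → ∃ λ o → NormalEdge (placed o) (segment e)
      edge-normal (s , t , t∈T , side) = from (normalTiles ab horizontal (t ∷ []) (t∈T ∷ []))
        where
        from : (∃ λ o → All (NormalTile (placed o)) (t ∷ [])) → ∃ λ o → NormalEdge (placed o) s
        from (o , n ∷ []) = o , normalTile-side n side

      index : Edge → Fin 4
      index e = NormalEdge.index (proj₂ (edge-normal e))

      index-onDir : ∀ e → OnDir (index e) (segment e)
      index-onDir e = normalEdge-onDir (proj₂ (edge-normal e))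

      index-spread : ∀ e → Spread (index e) (segment e)
      index-spread e = normalEdge-spread (proj₂ (edge-normal e))

    nondegenerate : ∀ e → ¬ proj₁ (segment e) ≈ₚ proj₂ (segment e)
    nondegenerate e = spread-nondegenerate (index-spread e)

    -- The index was read off in a frame found for `e` alone. Uniqueness frees it from this choice,
    -- so that indices of different edges can be compared.
    index-unique : ∀ {m} e → OnDir m (segment e) → index e ≡ m
    index-unique e on = onDir-unique {s = segment e} (index-onDir e) on (nondegenerate e)

    index-cong : ∀ e f → segment e ≈ₛ segment f → index e ≡ index f
    index-cong e f e≈f = index-unique e (onDir-resp (index f) (≈ₛ-sym e≈f) (index-onDir f))

    edge-spread : ∀ {m} e → OnDir m (segment e) → Spread m (segment e)
    edge-spread e on = ≡.subst (λ m → Spread m (segment e)) (index-unique e on) (index-spread e)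

    record SameLine (m : Fin 4) (e f : Edge) : Set where
      constructor sameLine
      field
        onˡ     : OnDir m (segment e)
        onʳ     : OnDir m (segment f)
        aligned : χ m (proj₁ (segment e)) ≈ χ m (proj₁ (segment f))

    sameLine-sym : ∀ {m e f} → SameLine m e f → SameLine m f e
    sameLine-sym (sameLine a b c) = sameLine b a (sym c)

    sameLine-trans : ∀ {m e f g} → SameLine m e f → SameLine m f g → SameLine m e g
    sameLine-trans (sameLine a _ c) (sameLine _ b c′) = sameLine a b (trans c c′)

    ≈ₛ⇒sameLine : ∀ {m} e f → segment e ≈ₛ segment f → OnDir m (segment e) → SameLine m e f
    ≈ₛ⇒sameLine {m} e f e≈f on = sameLine on (onDir-resp m e≈f on) (offset-resp m e≈f on)

    Trichotomy : Fin 4 → Edge → Edge → Set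
    Trichotomy m e f =
      segment e ≈ₛ segment f ⊎ Before m (segment e) (segment f) ⊎ Before m (segment f) (segment e)

    abstract
      -- The two tiles are placed in a common frame, and `collinear` is applied there.
      trichotomy : ∀ {m} e f → SameLine m e f → Trichotomy m e f
      trichotomy {m} e@(s , t , t∈T , side) f@(s′ , t′ , t′∈T , side′) (sameLine on on′ al) =
        from (normalTiles ab horizontal (t ∷ t′ ∷ []) (t∈T ∷ t′∈T ∷ []))
        where
        from : (∃ λ o → All (NormalTile (placed o)) (t ∷ t′ ∷ [])) → s ≈ₛ s′ ⊎ Before m s s′ ⊎ Before m s′ s
        from (o , n ∷ n′ ∷ []) = normalEdges-trichotomy edge edge′
          (onDir-unique {s = s} (normalEdge-onDir edge) on (nondegenerate e))
          (onDir-unique {s = s′} (normalEdge-onDir edge′) on′ (nondegenerate f)) al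
          where
          edge : NormalEdge (placed o) s
          edge = normalTile-side n side
          edge′ : NormalEdge (placed o) s′
          edge′ = normalTile-side n′ side′

    module _ (m : Fin 4) where
      key : Edge → Carrier
      key e = κ m (segment e)

      before⇒positive : ∀ {e f} → Before m (segment e) (segment f) → Positive (key f - key e)
      before⇒positive {e} {f} b = positive-resp
        (solve 2 (λ x y → con 1ℤ :+ (y :- x :- con 1ℤ) := y :- x) refl (key e) (key f))
        (+-positive 1-positive (Before.centres b))

      positive-asym : ∀ {x y} → Positive (x - y) → ¬ Positive (y - x)
      positive-asym {x} {y} p q = positive⇒¬nonneg-neg p
        (nonneg-resp (solve 2 (λ x y → y :- x := :- (x :- y)) refl x y) (proj₁ q))

      positive⇒before : ∀ {e f} → SameLine m e f → Positive (key f - key e) → Before m (segment e) (segment f)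
      positive⇒before {e} {f} l p = decide (trichotomy e f l)
        where
        decide : Trichotomy m e f →
                 Before m (segment e) (segment f)
        decide (inj₁ e≈f) = contradiction
          (sym (trans (+-congˡ (-‿cong (κ-cong m e≈f))) (-‿inverseʳ _))) (proj₂ p)
        decide (inj₂ (inj₁ b)) = b
        decide (inj₂ (inj₂ b)) = contradiction p (positive-asym (before⇒positive {f} {e} b))

      -- Edges with nonnegative key are ranked upwards from the foot of the
      -- perpendicular from the origin, the others downwards.
      signed : Bool → Carrier → Carrier
      signed true  x = x
      signed false x = - x

      Guard : Bool → Edge → Set
      Guard true  e = Nonneg (key e)
      Guard false e = ¬ Nonneg (key e)

      guard-nonneg : ∀ b e → Guard b e → Nonneg (signed b (key e))
      guard-nonneg true  e g = g
      guard-nonneg false e g = Sum.[ (λ n → contradiction n g) , (λ n → n) ]′ (nonneg? (key e))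

      record Under (b : Bool) (f e : Edge) : Set where
        constructor under
        field
          line    : SameLine m f e
          guard   : Guard b f
          smaller : Positive (signed b (key e) - signed b (key f))

      under-gap : ∀ b {f e} → Under b f e → Nonneg (signed b (key e) - signed b (key f) - 1#)
      under-gap true  (under l _ p) = Before.centres (positive⇒before l p)
      under-gap false {f} {e} (under l _ p) = nonneg-resp
        (solve 2 (λ x y → y :- x :- con 1ℤ := :- x :- :- y :- con 1ℤ) refl (key e) (key f))
        (Before.centres (positive⇒before (sameLine-sym l)
          (positive-resp (solve 2 (λ x y → :- x :- :- y := y :- x) refl (key e) (key f)) p)))

      module _ (b : Bool) where
        open Rank (Under b) public

        -- The signed key drops by at least 1 at each step and is nonnegative for all members that
        -- satisfy the guard. The top `e` need not satisfy it, whence the separate case of length 0.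
        chain-bound : ∀ {n e} → Chain n e → n ≡ 0 ⊎ Nonneg (signed b (key e) - ιℕ n)
        chain-bound [] = inj₁ ≡.refl
        chain-bound (_∷_ {n} {f} {e} u c) = inj₂ (nonneg-resp
          (trans (solve 3 (λ x y n → (x :- y :- con 1ℤ) :+ (y :- n) := x :- (n :+ con 1ℤ)) refl
                   (signed b (key e)) (signed b (key f)) (ιℕ n))
            (+-congˡ (-‿cong (sym (ιℕ-suc n)))))
          (+-nonneg (under-gap b u) (bound (chain-bound c))))
          where
          bound : n ≡ 0 ⊎ Nonneg (signed b (key f) - ιℕ n) → Nonneg (signed b (key f) - ιℕ n)
          bound (inj₁ ≡.refl) = nonneg-resp (solve 1 (λ x → x := x :- con 0ℤ) refl _)
            (guard-nonneg b f (Under.guard u))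
          bound (inj₂ p) = p

        chains-bounded : Bounded
        chains-bounded e = from (archimedean (signed b (key e)))
          where
          from : (∃ λ N → signed b (key e) ≤ ιℕ N) → ∃ λ N → ∀ n → Chain n e → n ℕ.≤ N
          from (N , e≤N) = N , λ n c → Sum.[ (λ { ≡.refl → ℕ.z≤n }) ,
            (λ p → ιℕ-reflects-≤ (≤-trans (nonneg⇒≤ p) e≤N)) ]′ (chain-bound c)

        abstract
          height : Edge → ℕ
          height = rank chains-bounded

          height-isRank : ∀ e → IsRank (height e) e
          height-isRank = rank-isRank chains-bounded

          height-descend : ∀ {Q : Edge → Set} → (∀ {f e} → Under b f e → Q e → Q f) →
            ∀ {n} e → n ℕ.≤ height e → Q e → ∃ λ g → height g ≡ n × Q g
          height-descend inherit e n≤ q = descend chains-bounded inherit (height e) (height-isRank e) n≤ q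

      -- An edge carries a proof that it is a side, so equal segments may come from different edges;
      -- these have the same edges under them.
      height-cong : ∀ b e f → segment e ≈ₛ segment f → OnDir m (segment e) → height b e ≡ height b f
      height-cong b e f e≈f on = isRank-resp b (move e≈f (≈ₛ⇒sameLine e f e≈f on))
        (move (≈ₛ-sym e≈f) (sameLine-sym (≈ₛ⇒sameLine e f e≈f on))) (height-isRank b e) (height-isRank b f)
        where
        signed-cong : ∀ b {x y} → x ≈ y → signed b x ≈ signed b y
        signed-cong true  e = e
        signed-cong false e = -‿cong e
        move : ∀ {e f} → segment e ≈ₛ segment f → SameLine m e f → ∀ {g} → Under b g e → Under b g f
        move {e} {f} e≈f l (under l′ g p) = under (sameLine-trans l′ l) g
          (positive-resp (+-congʳ (signed-cong b (κ-cong m e≈f))) p)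

      -- Heights begin at 0 on both sides, so the downward side is shifted to begin at -1; the two
      -- halves then meet without gap or collision.
      positionOf : ∀ e → Dec (Nonneg (key e)) → ℤ
      positionOf e (yes _) = + height true e
      positionOf e (no _)  = -[1+ height false e ]

      position : Edge → ℤ
      position e = positionOf e em

      position-cong : ∀ e f → segment e ≈ₛ segment f → OnDir m (segment e) → position e ≡ position f
      position-cong e f e≈f on = cases em em
        where
        cases : ∀ d d′ → positionOf e d ≡ positionOf f d′
        cases (yes _) (yes _) = ≡.cong +_ (height-cong true e f e≈f on)
        cases (no _)  (no _)  = ≡.cong -[1+_] (height-cong false e f e≈f on)
        cases (yes p) (no ¬p) = contradiction (nonneg-resp (κ-cong m e≈f) p) ¬p
        cases (no ¬p) (yes p) = contradiction (nonneg-resp (κ-cong m (≈ₛ-sym e≈f)) p) ¬p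

      position-mono : ∀ {e f} → SameLine m e f → Positive (key f - key e) → position e ℤ.< position f
      position-mono {e} {f} l p = cases em em
        where
        cases : ∀ d d′ → positionOf e d ℤ.< positionOf f d′
        cases (yes q) (yes _) = ℤ.+<+ (isRank-step true (under l q p) (height-isRank true e)
          (height-isRank true f))
        cases (no _)  (yes _) = ℤ.-<+
        cases (yes q) (no ¬q) = contradiction
          (nonneg-resp (solve 2 (λ x y → (y :- x) :+ x := y) refl (key e) (key f)) (+-nonneg (proj₁ p) q)) ¬q
        cases (no _)  (no ¬q) = ℤ.-<- (isRank-step false
          (under (sameLine-sym l) ¬q (positive-resp (solve 2 (λ x y → y :- x := :- x :- :- y) refl (key e) (key f)) p))
          (height-isRank false f) (height-isRank false e))

      position-before : ∀ {e f} → SameLine m e f → Before m (segment e) (segment f) → position e ℤ.< position f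
      position-before {e} {f} l b = position-mono l (before⇒positive {e} {f} b)

      position-reflects-before : ∀ {e f} → SameLine m e f → position e ℤ.< position f →
        Before m (segment e) (segment f)
      position-reflects-before {e} {f} l lt = decide (trichotomy e f l)
        where
        decide : Trichotomy m e f →
                 Before m (segment e) (segment f)
        decide (inj₁ e≈f) = contradiction lt (ℤₚ.<-irrefl (position-cong e f e≈f (SameLine.onˡ l)))
        decide (inj₂ (inj₁ b)) = b
        decide (inj₂ (inj₂ b)) = contradiction (position-before (sameLine-sym l) b) (ℤₚ.<-asym lt)

      position-injective : ∀ {e f} → SameLine m e f → position e ≡ position f → segment e ≈ₛ segment f
      position-injective {e} {f} l eq = decide (trichotomy e f l)
        where
        decide : Trichotomy m e f →
                 segment e ≈ₛ segment f
        decide (inj₁ e≈f) = e≈f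
        decide (inj₂ (inj₁ b)) = contradiction (position-before l b) (ℤₚ.<-irrefl eq)
        decide (inj₂ (inj₂ b)) = contradiction (position-before (sameLine-sym l) b) (ℤₚ.<-irrefl (≡.sym eq))

      -- A nonnegative z is reached by descending from `f`, a negative one by descending from `e`;
      -- line and guard persist on the way.
      position-interval : ∀ {e f} → SameLine m e f → ∀ z → position e ℤ.≤ z → z ℤ.≤ position f →
                          ∃ λ g → SameLine m g e × position g ≡ z
      position-interval {e} {f} l = cases em em
        where
        On : Bool → Edge → Set
        On b g = SameLine m g e × Guard b g
        inherit : ∀ b {f g} → Under b f g → On b g → On b f
        inherit b (under l g _) (l′ , _) = sameLine-trans l l′ , g
        positionOf-yes : ∀ g n → height true g ≡ n → Nonneg (key g) → ∀ d → positionOf g d ≡ + n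
        positionOf-yes g n eq p (yes _) = ≡.cong +_ eq
        positionOf-yes g n eq p (no ¬p) = contradiction p ¬p
        positionOf-no : ∀ g n → height false g ≡ n → ¬ Nonneg (key g) → ∀ d → positionOf g d ≡ -[1+ n ]
        positionOf-no g n eq ¬p (no _)  = ≡.cong -[1+_] eq
        positionOf-no g n eq ¬p (yes p) = contradiction p ¬p
        cases : ∀ d d′ z → positionOf e d ℤ.≤ z → z ℤ.≤ positionOf f d′ → ∃ λ g → SameLine m g e × position g ≡ z
        cases _ (yes p) (+ n) _ (ℤ.+≤+ n≤) =
          let (g , eq , (l′ , gd)) = height-descend true (inherit true) f n≤ (sameLine-sym l , p)
          in g , l′ , positionOf-yes g n eq gd em
        cases _ (no _) (+ n) _ ()
        cases (yes _) _ (-[1+ n ]) () _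
        cases (no ¬p) _ (-[1+ n ]) (ℤ.-≤- n≤) _ =
          let (g , eq , (l′ , gd)) = height-descend false (inherit false) e n≤ (sameLine (SameLine.onˡ l) (SameLine.onˡ l) refl , ¬p)
          in g , l′ , positionOf-no g n eq gd em

  open Line

  -- Alternating colourings

  -- The factor is (v · w)/(v · v).
  ∥⇒multiple : ∀ {v w} → v ∥ w → ¬ v ≈ₚ (0# , 0#) → ∃ λ k → w ≈ₚ k · v
  ∥⇒multiple {v@(x , y)} {w@(x′ , y′)} par v≉0 = dot v w * r
    , rescale (trans (solve 4 (λ x y x′ y′ → x′ :* (x :* x :+ y :* y) :=
      (x :* x′ :+ y :* y′) :* x :- y :* (x :* y′ :- y :* x′)) refl x y x′ y′)
        (trans (+-congˡ (-‿cong (*-congˡ par))) (solve 2 (λ a y → a :- y :* con 0ℤ := a) refl _ y)))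
    , rescale (trans (solve 4 (λ x y x′ y′ → y′ :* (x :* x :+ y :* y) :=
      (x :* x′ :+ y :* y′) :* y :+ x :* (x :* y′ :- y :* x′)) refl x y x′ y′)
        (trans (+-congˡ (*-congˡ par)) (solve 2 (λ a x → a :+ x :* con 0ℤ := a) refl _ x)))
    where
    N⁻¹ : ∃ λ r → dot v v * r ≈ 1#
    N⁻¹ = inverse (dot v v) (v≉0 ∘ dot-self-≈0)
    r : Carrier
    r = proj₁ N⁻¹
    rescale : ∀ {a b} → a * dot v v ≈ dot v w * b → a ≈ dot v w * r * b
    rescale {a} {b} e = trans (sym (trans (*-congˡ (proj₂ N⁻¹)) (*-identityʳ a)))
      (trans (solve 3 (λ a n r → a :* (n :* r) := (a :* n) :* r) refl a (dot v v) r)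
        (trans (*-congʳ e) (solve 3 (λ k b r → (k :* b) :* r := k :* r :* b) refl (dot v w) b r)))

  module AlignedLine (l : Line) (m : Fin 4) (aligned : χ m (dir l) ≈ 0#) where
    private
      u₁ = proj₁ (𝐮 m)
      u₂ = proj₂ (𝐮 m)
      d₁ = proj₁ (dir l)
      d₂ = proj₂ (dir l)

      multiple : ∀ {p} → χ m p ≈ 0# → ∃ λ k → p ≈ₚ k · 𝐮 m
      multiple {p} e = ∥⇒multiple {𝐮 m} {p} e (unit-nonzero (m ↑ˡ 4))

    scale : Carrier
    scale = proj₁ (multiple {dir l} aligned)

    dir≈ : dir l ≈ₚ scale · 𝐮 m
    dir≈ = proj₂ (multiple {dir l} aligned)

    scale≉0 : ¬ scale ≈ 0#
    scale≉0 e = nonzero l (≈ₚ-trans dir≈ (trans (*-congʳ e) (zeroˡ _) , trans (*-congʳ e) (zeroˡ _)))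

    dot-dir : ∀ p → dot (dir l) p ≈ scale * τ m p
    dot-dir (x , y) = trans (+-cong (*-congʳ (proj₁ dir≈)) (*-congʳ (proj₂ dir≈)))
      (solve 5 (λ s u v x y → s :* u :* x :+ s :* v :* y := s :* (u :* x :+ v :* y)) refl scale u₁ u₂ x y)

    χ-line : ∀ {p} → OnLine l p → χ m p ≈ χ m (base l)
    χ-line {p} (t , e) = trans (χ-cong m e)
      (trans (solve 7 (λ u v a b t c d → u :* (b :+ t :* d) :- v :* (a :+ t :* c) :=
        (u :* b :- v :* a) :+ t :* (u :* d :- v :* c)) refl
               u₁ u₂ (proj₁ (base l)) (proj₂ (base l)) t d₁ d₂)
        (trans (+-congˡ (trans (*-congˡ aligned) (zeroʳ t))) (+-identityʳ _)))

    line-χ : ∀ {p} → χ m p ≈ χ m (base l) → OnLine l p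
    line-χ {p} e = t , from (proj₁ along) , from (proj₂ along)
      where
      q : Point
      q = p ⊖ base l
      q-aligned : χ m q ≈ 0#
      q-aligned = trans (solve 6 (λ u v x y a b → u :* (y :- b) :- v :* (x :- a) :=
        (u :* y :- v :* x) :- (u :* b :- v :* a)) refl
        u₁ u₂ (proj₁ p) (proj₂ p) (proj₁ (base l)) (proj₂ (base l))) (difference-zero e)
      r s⁻¹ t : Carrier
      r = proj₁ (multiple {q} q-aligned)
      s⁻¹ = proj₁ (inverse scale scale≉0)
      t = r * s⁻¹
      rescale : ∀ {w d} → d ≈ scale * w → r * w ≈ t * d
      rescale {w} {d} d≈ = sym (trans (*-congˡ d≈) (trans
        (solve 4 (λ r i s w → r :* i :* (s :* w) := r :* (s :* i) :* w) refl r s⁻¹ scale w)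
        (*-congʳ (trans (*-congˡ (proj₂ (inverse scale scale≉0))) (*-identityʳ _)))))
      along : q ≈ₚ t · dir l
      along = ≈ₚ-trans (proj₂ (multiple {q} q-aligned)) (rescale (proj₁ dir≈) , rescale (proj₂ dir≈))
      from : ∀ {a b c} → a - b ≈ c → a ≈ b + c
      from {a} {b} x = trans (solve 2 (λ a b → a := b :+ (a :- b)) refl a b) (+-congˡ x)

    contains-onDir : ∀ {s} → Contains l s → OnDir m s
    contains-onDir (p , q) = trans (χ-line p) (sym (χ-line q))

    onDir-contains : ∀ {s} → OnDir m s → χ m (proj₁ s) ≈ χ m (base l) → Contains l s
    onDir-contains on e = line-χ e , line-χ (trans (sym on) e)

  -- The 𝐮 are the unit vectors at 0°, 45°, 90° and 135°; the prescribed vectors are multiples of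
  -- them, with a negative factor for (1, -1).
  directionMultiple : ∀ m → χ m (directions m) ≈ 0#
  directionMultiple = λ where
    d0 → solve 1 (λ h → (con 1ℤ :+ con 0ℤ :* h) :* con 0ℤ :- (con 0ℤ :+ con 0ℤ :* h) :* con 1ℤ := con 0ℤ) refl h
    d1 → solve 1 (λ h → (con 0ℤ :+ con 1ℤ :* h) :* con 1ℤ :- (con 0ℤ :+ con 1ℤ :* h) :* con 1ℤ := con 0ℤ) refl h
    d2 → solve 1 (λ h → (con 0ℤ :+ con 0ℤ :* h) :* con 1ℤ :- (con 1ℤ :+ con 0ℤ :* h) :* con 0ℤ := con 0ℤ) refl h
    d3 → solve 1 (λ h → (con 0ℤ :+ con -1ℤ :* h) :* (:- con 1ℤ) :- (con 0ℤ :+ con 1ℤ :* h) :* con 1ℤ := con 0ℤ) refl h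

  -- An integer copy of the vectors, for which determinants can be decided.
  directionℤ : Fin 4 → ℤ × ℤ
  directionℤ = Vec.lookup ((1ℤ , 0ℤ) ∷ (1ℤ , 1ℤ) ∷ (0ℤ , 1ℤ) ∷ (1ℤ , -1ℤ) ∷ [])

  directions-ι : ∀ j → directions j ≡ (ι (proj₁ (directionℤ j)) , ι (proj₂ (directionℤ j)))
  directions-ι = λ where
    d0 → ≡.refl
    d1 → ≡.refl
    d2 → ≡.refl
    d3 → ≡.refl

  ι≈0⇒≡0 : ∀ {i} → ι i ≈ 0# → i ≡ 0ℤ
  ι≈0⇒≡0 {i} e = decide (ℤₚ.<-cmp 0ℤ i)
    where
    decide : _ → i ≡ 0ℤ
    decide (tri≈ _ x _) = ≡.sym x
    decide (tri< x _ _) = contradiction (sym e) (proj₂ (ι-positive x))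
    decide (tri> _ _ x) = contradiction (sym (trans (ι-neg i) (trans (-‿cong e) -0#≈0#)))
      (proj₂ (ι-positive (ℤₚ.neg-mono-< x)))

  directions-nonParallel : ∀ i j → i ≢ j → ¬ (directions i ∥ directions j)
  directions-nonParallel i j i≢j par = Sum.[ i≢j , (λ ne → ne (ι≈0⇒≡0 (trans crossℤ par))) ]′ (separate i j)
    where
    c : Fin 4 → Fin 4 → ℤ
    c i j = let (a , b) = directionℤ i ; (a′ , b′) = directionℤ j in a ℤ.* b′ ℤ.- b ℤ.* a′
    separate : ∀ i j → i ≡ j ⊎ ¬ c i j ≡ 0ℤ
    separate = toWitness {a? = all? λ i → all? λ j → i Finₚ.≟ j ⊎-dec ¬? (c i j ℤₚ.≟ 0ℤ)} _
    crossℤ : ι (c i j) ≈ cross (directions i) (directions j)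
    crossℤ = let (a , b) = directionℤ i ; (a′ , b′) = directionℤ j in
      trans (ι-- (a ℤ.* b′) (b ℤ.* a′)) (trans (+-cong (ι-* a b′) (-‿cong (ι-* b a′)))
        (reflexive (≡.sym (≡.cong₂ cross (directions-ι i) (directions-ι j)))))

  parallel-directions : ∀ j {v w} → v ∥ directions j → w ∥ directions j → v ∥ w
  parallel-directions j {x , y} {x′ , y′} = λ p q → cases j p q
    where
    vanish : ∀ {a b c d} → a ≈ 0# → b ≈ 0# → c * a - d * b ≈ 0#
    vanish e e′ = trans (+-cong (trans (*-congˡ e) (zeroʳ _)) (-‿cong (trans (*-congˡ e′) (zeroʳ _))))
      (-‿inverseʳ 0#)
    cases : ∀ j → (x , y) ∥ directions j → (x′ , y′) ∥ directions j → (x , y) ∥ (x′ , y′)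
    cases d0 p q = trans (solve 4 (λ x y x′ y′ → x :* y′ :- y :* x′ :=
      x′ :* (x :* con 0ℤ :- y :* con 1ℤ) :- x :* (x′ :* con 0ℤ :- y′ :* con 1ℤ)) refl x y x′ y′)
      (vanish p q)
    cases d1 p q = trans (solve 4 (λ x y x′ y′ → x :* y′ :- y :* x′ :=
      x′ :* (x :* con 1ℤ :- y :* con 1ℤ) :- x :* (x′ :* con 1ℤ :- y′ :* con 1ℤ)) refl x y x′ y′)
      (vanish p q)
    cases d2 p q = trans (solve 4 (λ x y x′ y′ → x :* y′ :- y :* x′ :=
      y′ :* (x :* con 1ℤ :- y :* con 0ℤ) :- y :* (x′ :* con 1ℤ :- y′ :* con 0ℤ)) refl x y x′ y′)
      (vanish p q)
    cases d3 p q = trans (solve 4 (λ x y x′ y′ → x :* y′ :- y :* x′ :=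
      x′ :* (x :* :- con 1ℤ :- y :* con 1ℤ) :- x :* (x′ :* :- con 1ℤ :- y′ :* con 1ℤ)) refl x y x′ y′)
      (vanish p q)

  parity-neg : ∀ z → parity (ℤ.- z) ≡ parity z
  parity-neg z = ≡.cong (_mod 2) (ℤₚ.∣-i∣≡∣i∣ z)

  mod2-suc : ∀ n → suc n mod 2 ≢ n mod 2
  mod2-suc zero          = λ ()
  mod2-suc (suc zero)    = λ ()
  mod2-suc (suc (suc n)) = λ e → mod2-suc n (≡.trans (≡.sym (period (suc n))) (≡.trans e (period n)))
    where
    period : ∀ n → suc (suc n) mod 2 ≡ n mod 2
    period n = Finₚ.toℕ-injective (≡.trans (Finₚ.toℕ-fromℕ< _) (≡.trans
      (≡.trans (≡.cong (_% 2) (ℕₚ.+-comm 2 n)) ([m+n]%n≡m%n n 2)) (≡.sym (Finₚ.toℕ-fromℕ< _))))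

  parity-suc : ∀ z → parity (ℤ.suc z) ≢ parity z
  parity-suc (+ n)          = mod2-suc n
  parity-suc (-[1+ zero ])  = λ ()
  parity-suc (-[1+ suc n ]) = λ e → mod2-suc (suc n) (≡.sym e)

  module _ {T : Pred Tile 0ℓ} (ab : IsAmmannBeenkerTiling T) (horizontal : HasHorizontalRhombusSide T) where
    open Graph (graph T)
    open Edges {T} ab horizontal

    colour : Edge → Fin 8
    colour e = combine (index e) (parity (position (index e) e))

    colouring : EdgeColouring 8
    colouring = record
      { to   = colour
      ; cong = λ {e} {f} e≈f → ≡.cong₂ combine (index-cong e f e≈f)
          (≡.trans (≡.cong (λ m → parity (position m e)) (index-cong e f e≈f))
                   (≡.cong parity (position-cong (index f) e f e≈f
                     (≡.subst (λ m → OnDir m (segment e)) (index-cong e f e≈f) (index-onDir e)))))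
      }

    module _ (l : Line) (e₀ : Edge) (e₀∈l : Contains l (segment e₀)) where
      private
        m : Fin 4
        m = index e₀

        aligned : χ m (dir l) ≈ 0#
        aligned = from e₀∈l
          where
          from : Contains l (segment e₀) → χ m (dir l) ≈ 0#
          -- The ends of `e₀` have the same transverse coordinate but different parameters on `l`,
          -- so the direction of `l` has no transverse part.
          from ((t , p≈) , (t′ , q≈)) = *-cancel-≈0
            (trans (solve 8 (λ u v a b c d t t′ → (u :* d :- v :* c) :* (t :- t′) :=
                (u :* (b :+ t :* d) :- v :* (a :+ t :* c)) :- (u :* (b :+ t′ :* d) :- v :* (a :+ t′ :* c))) refl
                (proj₁ (𝐮 m)) (proj₂ (𝐮 m)) (proj₁ (base l)) (proj₂ (base l)) (proj₁ (dir l)) (proj₂ (dir l)) t t′)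
              (difference-zero (trans (sym (χ-cong m p≈)) (trans (index-onDir e₀) (χ-cong m q≈)))))
            λ t≈t′ → nondegenerate e₀ (≈ₚ-trans p≈ (≈ₚ-trans
              (⊕-cong ≈ₚ-refl (·-cong (zero-difference t≈t′) ≈ₚ-refl)) (≈ₚ-sym q≈)))

        open AlignedLine l m aligned

        line : ∀ e f → Contains l (segment e) → Contains l (segment f) → SameLine m e f
        line e f e∈ f∈ = sameLine (contains-onDir e∈) (contains-onDir f∈)
          (trans (χ-line (proj₁ e∈)) (sym (χ-line (proj₁ f∈))))

        contained : ∀ {g e} → SameLine m g e → Contains l (segment e) → Contains l (segment g)
        contained (sameLine on _ e) e∈ = onDir-contains on (trans e (χ-line (proj₁ e∈)))

        scale-mono : ∀ {p q} → Nonneg scale → τ m p ≤ τ m q → dot (dir l) p ≤ dot (dir l) q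
        scale-mono {p} {q} s le = nonneg⇒≤ (nonneg-resp
          (trans (solve 3 (λ s x y → s :* (y :- x) := s :* y :- s :* x) refl scale (τ m p) (τ m q))
            (+-cong (sym (dot-dir q)) (-‿cong (sym (dot-dir p)))))
          (*-nonNeg s (≤⇒nonneg le)))

        scale-antitone : ∀ {p q} → Nonneg (- scale) → τ m p ≤ τ m q → dot (dir l) q ≤ dot (dir l) p
        scale-antitone {p} {q} s le = nonneg⇒≤ (nonneg-resp
          (trans (solve 3 (λ s x y → (:- s) :* (y :- x) := s :* x :- s :* y) refl scale (τ m p) (τ m q))
            (+-cong (sym (dot-dir p)) (-‿cong (sym (dot-dir q)))))
          (*-nonNeg s (≤⇒nonneg le)))

        cancel-scale : ∀ {p q} → Positive scale → dot (dir l) p ≤ dot (dir l) q → τ m p ≤ τ m q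
        cancel-scale {p} {q} s le = nonneg⇒≤ (*-cancel-nonneg s (nonneg-resp
          (trans (+-cong (dot-dir q) (-‿cong (dot-dir p)))
            (solve 3 (λ s x y → s :* y :- s :* x := (y :- x) :* s) refl scale (τ m p) (τ m q)))
          (≤⇒nonneg le)))

        cancel-scale₋ : ∀ {p q} → Positive (- scale) → dot (dir l) p ≤ dot (dir l) q → τ m q ≤ τ m p
        cancel-scale₋ {p} {q} s le = nonneg⇒≤ (*-cancel-nonneg s (nonneg-resp
          (trans (+-cong (dot-dir q) (-‿cong (dot-dir p)))
            (solve 3 (λ s x y → s :* y :- s :* x := (x :- y) :* (:- s)) refl scale (τ m p) (τ m q)))
          (≤⇒nonneg le)))

        -- An edge extends over at least 1 along the line, so comparing all pairs of ends by weak
        -- inequalities already rules out equality and the opposite order.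
        τ-precedes : ∀ {e f} → SameLine m e f →
          (∀ p q → p EndOf segment e → q EndOf segment f → τ m p ≤ τ m q) → Before m (segment e) (segment f)
        τ-precedes {e} {f} ln le = decide (trichotomy e f ln)
          where
          ends : ∀ {s P Q} → s ≈ₛ (P , Q) → P EndOf s × Q EndOf s
          ends (inj₁ (a , b)) = inj₁ (≈ₚ-sym a) , inj₂ (≈ₚ-sym b)
          ends (inj₂ (a , b)) = inj₂ (≈ₚ-sym b) , inj₁ (≈ₚ-sym a)
          absurd : (r : Point) → r EndOf segment f → (∀ p → p EndOf segment e → τ m r ≤ τ m p) →
                   Before m (segment e) (segment f)
          absurd r r∈ ge = from (edge-spread e (SameLine.onˡ ln))
            where
            from : Spread m (segment e) → Before m (segment e) (segment f)
            from (spread P Q s≈ gap) = contradiction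
              (nonneg-resp (solve 2 (λ p q → (q :- p :- con 1ℤ) :+ (p :- q) := :- con 1ℤ) refl (τ m P) (τ m Q))
                (+-nonneg gap (≤⇒nonneg (≤-trans (le Q r (proj₂ (ends s≈)) r∈) (ge P (proj₁ (ends s≈)))))))
              (positive⇒¬nonneg-neg 1-positive)
          decide : Trichotomy m e f → Before m (segment e) (segment f)
          decide (inj₂ (inj₁ b)) = b
          decide (inj₂ (inj₂ b)) = absurd (proj₁ (segment f)) (inj₁ ≈ₚ-refl) λ p p∈ →
            Before.ends b (proj₁ (segment f)) p (inj₁ ≈ₚ-refl) p∈
          decide (inj₁ e≈f) = from (edge-spread f (SameLine.onʳ ln))
            where
            from : Spread m (segment f) → Before m (segment e) (segment f)
            from (spread P Q s≈ gap) = contradiction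
              (nonneg-resp (solve 2 (λ p q → (q :- p :- con 1ℤ) :+ (p :- q) := :- con 1ℤ) refl (τ m P) (τ m Q))
                (+-nonneg gap (≤⇒nonneg (le Q P (proj₂ (ends (≈ₛ-trans e≈f s≈))) (proj₁ (ends s≈))))))
              (positive⇒¬nonneg-neg 1-positive)

        forward : Positive scale → Numbering T l
        forward s = record
          { position = position m
          ; ordered  = λ e f e∈ f∈ → mk⇔
              (λ pr → position-before m (line e f e∈ f∈)
                (τ-precedes (line e f e∈ f∈) λ p q p∈ q∈ → cancel-scale {p} {q} s (pr p q p∈ q∈)))
              (λ lt p q p∈ q∈ → scale-mono {p} {q} (proj₁ s)
                (Before.ends (position-reflects-before m (line e f e∈ f∈) lt) p q p∈ q∈))
          ; distinct = λ e f e∈ f∈ → position-injective m (line e f e∈ f∈)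
          ; interval = λ e f z e∈ f∈ e≤ ≤f →
              let (g , ln , eq) = position-interval m (line e f e∈ f∈) z e≤ ≤f in g , contained ln e∈ , eq
          }

        -- The line may run against 𝐮 `m`. Negating the positions then reverses their order and
        -- preserves parity, so the same colouring fits.
        backward : Positive (- scale) → Numbering T l
        backward s = record
          { position = λ e → ℤ.- position m e
          ; ordered  = λ e f e∈ f∈ → mk⇔
              (λ pr → ℤₚ.neg-mono-< (position-before m (line f e f∈ e∈)
                (τ-precedes (line f e f∈ e∈) λ p q p∈ q∈ → cancel-scale₋ {q} {p} s (pr q p q∈ p∈))))
              (λ lt p q p∈ q∈ → scale-antitone {q} {p} (proj₁ s)
                (Before.ends (position-reflects-before m (line f e f∈ e∈) (ℤₚ.neg-cancel-< lt)) q p q∈ p∈))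
          ; distinct = λ e f e∈ f∈ eq → position-injective m (line e f e∈ f∈) (ℤₚ.neg-injective eq)
          ; interval = λ e f z e∈ f∈ e≤ ≤f →
              let (g , ln , eq) = position-interval m (line f e f∈ e∈) (ℤ.- z)
                    (≡.subst (ℤ._≤ ℤ.- z) (ℤₚ.neg-involutive (position m f)) (ℤₚ.neg-mono-≤ ≤f))
                    (≡.subst (ℤ.- z ℤ.≤_) (ℤₚ.neg-involutive (position m e)) (ℤₚ.neg-mono-≤ e≤))
              in g , contained ln f∈ , ≡.trans (≡.cong ℤ.-_ eq) (ℤₚ.neg-involutive z)
          }

        colour-position : ∀ e → Contains l (segment e) → colour e ≡ combine m (parity (position m e))
        colour-position e e∈ = ≡.cong (λ k → combine k (parity (position k e)))
          (index-unique {m} e (contains-onDir e∈))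

        colour-reversed : ∀ e → Contains l (segment e) → colour e ≡ combine m (parity (ℤ.- position m e))
        colour-reversed e e∈ = ≡.subst (λ k → colour e ≡ combine m k) (≡.sym (parity-neg (position m e)))
          (colour-position e e∈)

        dir-∥ : dir l ∥ directions m
        dir-∥ = trans (+-cong (*-congʳ (proj₁ dir≈)) (-‿cong (*-congʳ (proj₂ dir≈))))
          (trans (solve 5 (λ s u v x y → s :* u :* y :- s :* v :* x := s :* (u :* y :- v :* x)) refl
                   scale (proj₁ (𝐮 m)) (proj₂ (𝐮 m)) (proj₁ (directions m)) (proj₂ (directions m)))
            (trans (*-congˡ (directionMultiple m)) (zeroʳ scale)))

      line-alternating : ∃ λ j → dir l ∥ directions j × ∃ λ (ν : Numbering T l) →
        ∀ e → Contains l (segment e) → colour e ≡ combine j (parity (Numbering.position ν e))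
      line-alternating = m , dir-∥ , numbering (nonneg? scale)
        where
        numbering : Nonneg scale ⊎ Nonneg (- scale) → ∃ λ (ν : Numbering T l) →
          ∀ e → Contains l (segment e) → colour e ≡ combine m (parity (Numbering.position ν e))
        numbering (inj₁ s) = forward (s , scale≉0 ∘ sym) , colour-position
        numbering (inj₂ s) = backward (s , λ e → scale≉0
          (trans (solve 1 (λ s → s := :- (:- s)) refl scale) (trans (-‿cong (sym e)) -0#≈0#))) ,
          colour-reversed

    colouring-alternating : IsDirectionalAlternating T directions colouring
    colouring-alternating = record
      { nonParallel = directions-nonParallel
      ; alternating = line-alternating
      }

    lineThrough : Edge → Line
    lineThrough e = record
      { base    = proj₁ (segment e)
      ; dir     = direction (segment e)
      ; nonzero = λ (x , y) → nondegenerate e (sym (zero-difference x) , sym (zero-difference y))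
      }

    lineThrough-contains : ∀ e → Contains (lineThrough e) (segment e)
    lineThrough-contains e = (0# , start _ _ , start _ _) , (1# , tip _ _ , tip _ _)
      where
      start : ∀ p q → p ≈ p + 0# * (q - p)
      start = solve 2 (λ p q → p := p :+ con 0ℤ :* (q :- p)) refl
      tip : ∀ p q → q ≈ p + 1# * (q - p)
      tip = solve 2 (λ p q → q := p :+ con 1ℤ :* (q :- p)) refl

    parallel-contained : ∀ e f v → v EndOf segment e → v EndOf segment f →
      direction (segment e) ∥ direction (segment f) → Contains (lineThrough e) (segment f)
    parallel-contained e f v v∈e v∈f par =
      from (on v∈e) (∥⇒multiple {direction (segment e)} {direction (segment f)} par (nonzero l)) v∈f
      where
      l = lineThrough e
      d = dir l
      p = base l
      r s : Point
      r = proj₁ (segment f)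
      s = proj₂ (segment f)
      on : v EndOf segment e → OnLine l v
      on (inj₁ x) = let (t , y) = proj₁ (lineThrough-contains e) in t , ≈ₚ-trans x y
      on (inj₂ x) = let (t , y) = proj₂ (lineThrough-contains e) in t , ≈ₚ-trans x y
      ahead : ∀ {t k r s p d} → r ≈ p + t * d → s - r ≈ k * d → s ≈ p + (t + k) * d
      ahead {t} {k} {r} {s} {p} {d} a b = trans (solve 2 (λ r s → s := r :+ (s :- r)) refl r s)
        (trans (+-cong a b) (solve 4 (λ p t k d → (p :+ t :* d) :+ k :* d := p :+ (t :+ k) :* d) refl p t k d))
      behind : ∀ {t k r s p d} → s ≈ p + t * d → s - r ≈ k * d → r ≈ p + (t - k) * d
      behind {t} {k} {r} {s} {p} {d} a b = trans (solve 2 (λ r s → r := s :- (s :- r)) refl r s)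
        (trans (+-cong a (-‿cong b)) (solve 4 (λ p t k d → (p :+ t :* d) :- k :* d := p :+ (t :- k) :* d) refl p t k d))
      from : OnLine l v → (∃ λ k → direction (segment f) ≈ₚ k · d) → v EndOf segment f → Contains l (segment f)
      from (t , (x , y)) (k , (x′ , y′)) (inj₁ (a , b)) =
        (t , trans (sym a) x , trans (sym b) y) ,
        (t + k , ahead (trans (sym a) x) x′ , ahead (trans (sym b) y) y′)
      from (t , (x , y)) (k , (x′ , y′)) (inj₂ (a , b)) =
        (t - k , behind (trans (sym a) x) x′ , behind (trans (sym b) y) y′) ,
        (t , trans (sym a) x , trans (sym b) y)

    module _ (c : EdgeColouring 8) (alt : IsDirectionalAlternating T directions c) where
      open IsDirectionalAlternating alt

      private
        nothing-between : ∀ (l : Line) (g : Edge) v → Contains l (segment g) →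
          (∀ r → r EndOf segment g → dot (dir l) v ≤ dot (dir l) r) →
          (∀ r → r EndOf segment g → dot (dir l) r ≤ dot (dir l) v) → ⊥
        nothing-between l g v ((t , p≈) , (t′ , q≈)) lower upper = nondegenerate g
          (≈ₚ-trans p≈ (≈ₚ-trans (⊕-cong ≈ₚ-refl (·-cong t≈t′ ≈ₚ-refl)) (≈ₚ-sym q≈)))
          where
          P Q : Point
          P = proj₁ (segment g)
          Q = proj₂ (segment g)
          level : ∀ r → r EndOf segment g → dot (dir l) r ≈ dot (dir l) v
          level r r∈ = antisym (upper r r∈) (lower r r∈)
          expandDot : ∀ t → dot (dir l) (base l ⊕ t · dir l) ≈ dot (dir l) (base l) + t * dot (dir l) (dir l)
          expandDot t = solve 5 (λ a b x y t → a :* (x :+ t :* a) :+ b :* (y :+ t :* b) :=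
            (a :* x :+ b :* y) :+ t :* (a :* a :+ b :* b)) refl
            (proj₁ (dir l)) (proj₂ (dir l)) (proj₁ (base l)) (proj₂ (base l)) t
          dot-resp : ∀ {p q} → p ≈ₚ q → dot (dir l) p ≈ dot (dir l) q
          dot-resp = dot-congʳ (dir l)
          t≈t′ : t ≈ t′
          t≈t′ = zero-difference (*-cancel-≈0 (trans
              (solve 4 (λ t t′ d b → (t :- t′) :* d := (b :+ t :* d) :- (b :+ t′ :* d)) refl t t′
                (dot (dir l) (dir l)) (dot (dir l) (base l)))
              (difference-zero (trans (sym (trans (dot-resp p≈) (expandDot t)))
                (trans (trans (level P (inj₁ ≈ₚ-refl)) (sym (level Q (inj₂ ≈ₚ-refl))))
                  (trans (dot-resp q≈) (expandDot t′))))))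
            λ z → nonzero l (dot-self-≈0 z))

        consecutive : ∀ (l : Line) (ν : Numbering T l) e f v → Contains l (segment e) → Contains l (segment f) →
          v EndOf segment e → v EndOf segment f → Numbering.position ν e ℤ.< Numbering.position ν f →
          Numbering.position ν f ≡ ℤ.suc (Numbering.position ν e)
        consecutive l ν e f v e∈ f∈ v∈e v∈f lt = decide (ℤ.suc (pos′ e) ℤₚ.≟ pos′ f)
          where
          pos′ = Numbering.position ν
          decide : Dec (ℤ.suc (pos′ e) ≡ pos′ f) → pos′ f ≡ ℤ.suc (pos′ e)
          decide (yes eq) = ≡.sym eq
          -- Otherwise some edge is numbered strictly between, and both its ends are squeezed to the
          -- coordinate of `v`.
          decide (no ne) = from (Numbering.interval ν e f (ℤ.suc (pos′ e)) e∈ f∈ (ℤₚ.i≤suc[i] (pos′ e))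
            (ℤₚ.i<j⇒suc[i]≤j lt))
            where
            from : (∃ λ g → Contains l (segment g) × pos′ g ≡ ℤ.suc (pos′ e)) → pos′ f ≡ ℤ.suc (pos′ e)
            from (g , g∈ , eq) = contradiction
              (nothing-between l g v g∈
                (λ r r∈ → Equivalence.from (Numbering.ordered ν e g e∈ g∈)
                  (≡.subst (pos′ e ℤ.<_) (≡.sym eq) (ℤₚ.suc[i]≤j⇒i<j ℤₚ.≤-refl)) v r v∈e r∈)
                (λ r r∈ → Equivalence.from (Numbering.ordered ν g f g∈ f∈)
                  (≡.subst (ℤ._< pos′ f) (≡.sym eq) (ℤₚ.≤∧≢⇒< (ℤₚ.i<j⇒suc[i]≤j lt) ne)) r v r∈ v∈f))
              (λ x → x)

      -- Equal colours mean equal direction indices and equal parities. Equal indices make the edges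
      -- parallel, so their common vertex puts `f` on the line of `e`; there their numbers are
      -- consecutive and the parities differ.
      alternating-proper : Proper c
      alternating-proper e f (e≉f , (v , _) , v∈e , v∈f) same = decide em
        where
        l = lineThrough e
        e∈ = lineThrough-contains e
        at-e = alternating l e e∈
        j = proj₁ at-e
        ν = proj₁ (proj₂ (proj₂ at-e))
        col = proj₂ (proj₂ (proj₂ at-e))
        decide : Dec (Contains l (segment f)) → ⊥
        decide (yes f∈) = compare (ℤₚ.<-cmp (Numbering.position ν e) (Numbering.position ν f))
          where
          parities : parity (Numbering.position ν e) ≡ parity (Numbering.position ν f)
          parities = proj₂ (Finₚ.combine-injective j _ j _ (≡.trans (≡.sym (col e e∈)) (≡.trans same (col f f∈))))
          compare : _ → ⊥
          compare (tri≈ _ eq _) = e≉f (Numbering.distinct ν e f e∈ f∈ eq)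
          compare (tri< lt _ _) = parity-suc (Numbering.position ν e)
            (≡.trans (≡.sym (≡.cong parity (consecutive l ν e f v e∈ f∈ v∈e v∈f lt))) (≡.sym parities))
          compare (tri> _ _ gt) = parity-suc (Numbering.position ν f)
            (≡.trans (≡.sym (≡.cong parity (consecutive l ν f e v f∈ e∈ v∈f v∈e gt))) parities)
        decide (no f∉) = f∉ (parallel-contained e f v v∈e v∈f parallel)
          where
          at-f = alternating (lineThrough f) f (lineThrough-contains f)
          j≡ : j ≡ proj₁ at-f
          j≡ = proj₁ (Finₚ.combine-injective j _ (proj₁ at-f) _
            (≡.trans (≡.sym (col e e∈)) (≡.trans same (proj₂ (proj₂ (proj₂ at-f)) f (lineThrough-contains f)))))
          parallel : direction (segment e) ∥ direction (segment f)
          parallel = parallel-directions j (proj₁ (proj₂ at-e))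
            (≡.subst (λ i → direction (segment f) ∥ directions i) (≡.sym j≡) (proj₁ (proj₂ at-f)))

proposition4p2 : ExcludedMiddle 0ℓ →
    (R : CompleteOrderedField) (ρ : RootTwo R) →
    let open AmmannBeenker R ρ in
    (T : Pred Tile 0ℓ) →
    IsAmmannBeenkerTiling T →
    HasHorizontalRhombusSide T →
    let open Graph (graph T) in
    HasChromaticIndex 8 ×
    (∃ λ (c : EdgeColouring 8) → IsDirectionalAlternating T directions c) ×
    (∀ (c : EdgeColouring 8) → IsDirectionalAlternating T directions c → Proper c)
proposition4p2 em R ρ T ab horizontal =
  ((colouring ab horizontal , alternating-proper ab horizontal _ (colouring-alternating ab horizontal)) ,
   chromatic-lower-bound ab horizontal) ,
  (colouring ab horizontal , colouring-alternating ab horizontal) ,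
  alternating-proper ab horizontal
  where open Tilings em R ρ
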